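{- Let $p$ be a prime, $k\ge0$ and $m\ge1$ integers, and let $\mathcal S_1,\dots,\mathcal S_m$ be $\mathbb Z_p$-combinatorial spheres with pairwise disjoint vertex sets. Then for every $\mathbb Z_p$-equivariant simplicial map $f:\operatorname{Bd}^k(\mathcal S_1*\cdots*\mathcal S_m)\to\mathcal S_1*\cdots*\mathcal S_m$, \[\deg(f)\equiv1\pmod p,\] where $\deg$ denotes the combinatorial degree.
   Context: A simplicial complex $\mathcal K$ is a finite nonempty collection of finite sets closed under subsets (so $\emptyset\in\mathcal K$); $\dim\sigma=|\sigma|-1$; $\alpha$ is a facet of $\beta$ if $\alpha\subseteq\beta$ and $\dim\alpha=\dim\beta-1$. A total order on $V(\mathcal K)=\bigcup\mathcal K$ is fixed and a $q$-simplex with vertices $x_0<\dots<x_q$ is the oriented simplex $[x_0,\dots,x_q]$. $C_q(\mathcal K)$ is the free $\mathbb Z$-module on the $q$-simplices ($q\ge0$; $0$ otherwise). Incidence: for a $q$-simplex $\sigma=[x_0,\dots,x_q]$ and a $(q-1)$-simplex $\tau$, $[\sigma,\tau]=(-1)^i$ if $\tau=\sigma\setminus\{x_i\}$, $0$ if $\tau\not\subseteq\sigma$. Boundary: $\partial_q\sigma=\sum_\tau[\sigma,\tau]\tau$ for $q\ge1$, $\partial_0=0$. A discrete vector field $\mathcal V$ is a set of pairs $(\alpha,\beta)$ of simplices ($\alpha=\emptyset$ allowed) with $\alpha$ a facet of $\beta$, each simplex in at most one pair; a $\mathcal V$-trajectory is $\beta_0,\alpha_1,\beta_1,\dots,\alpha_r,\beta_r$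 (alternately $q$- and $(q-1)$-simplices) with $(\alpha_i,\beta_i)\in\mathcal V$, $\alpha_i\subsetneq\beta_{i-1}\neq\beta_i$; nontrivial closed if $r>0$, $\beta_r=\beta_0$. A gradient vector field has no nontrivial closed trajectory. A nonempty simplex is critical if it lies in no pair, or is a $0$-simplex $\sigma$ with $(\emptyset,\sigma)\in\mathcal V$. A $d$-dimensional pseudomanifold: all maximal simplices of dimension $d$, every $(d-1)$-simplex in exactly two $d$-simplices, any two $d$-simplices joined by a chain of $d$-simplices with consecutive ones meeting in a $(d-1)$-simplex. A combinatorial $d$-sphere is a $d$-dimensional pseudomanifold admitting a gradient vector field with exactly two critical simplices, one $d$-dimensional and one $0$-dimensional. For its $d$-simplices $\sigma_1,\dots,\sigma_n$, an orientation is $\xi\in\{\pm1\}^n$ with $\partial_d(\sum\xi_i\sigma_i)=0$; $[\mathcal S_\xi]=\sum\xi_i\sigma_i$. Join: $\mathcal K_1*\mathcal K_2=\{\sigma\sqcup\tau\}$ for disjoint vertex sets. $\operatorname{Bd}(\mathcal K)$: vertices $v_\sigma$ ($\sigma\ne\emptyset$), simplices the chains $\{v_{\sigma_0},\dots,v_{\sigma_n}\}$, $\sigma_0\subsetneq\dots\subsetneq\sigma_n$; $\operatorname{Bd}^k$ its iterate. A simplicial map $f$ induces $f_q([v_0,\dots,v_q])=[f(v_0),\dots,f(v_q)]$ (as oriented simplex) if the images are distinct and $0$ otherwise. The subdivision chain map $g:C_\#(\mathcal K)\to C_\#(\operatorname{Bd}\mathcal K)$ is $g_0(v)=v_{\{v\}}$,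 $g_q(\sigma)=v_\sigma*g_{q-1}(\partial\sigma)$ with $v*[w_0,\dots,w_{q-1}]=[v,w_0,\dots,w_{q-1}]$; $g^k$ is its $k$-fold composite $C_\#(\mathcal K)\to C_\#(\operatorname{Bd}^k\mathcal K)$. For a combinatorial $d$-sphere $\mathcal S$ and simplicial $f:\operatorname{Bd}^k(\mathcal S)\to\mathcal S$, the combinatorial degree $\deg(f)$ is the integer $m$ with $(g^k_d\circ f_d)([\operatorname{Bd}^k(\mathcal S)_\xi])=m[\operatorname{Bd}^k(\mathcal S)_\xi]$ for an orientation $\xi$ of the combinatorial sphere $\operatorname{Bd}^k(\mathcal S)$ (it exists and is independent of $\xi$). A $\mathbb Z_p$-combinatorial sphere is a combinatorial sphere with a free simplicial $\mathbb Z_p$-action (by simplicial automorphisms, no non-identity element mapping a nonempty simplex to itself). $\mathbb Z_p$ acts diagonally on joins, $g\cdot(\sigma\sqcup\tau)=g\sigma\sqcup g\tau$, and on $\operatorname{Bd}^k$ by $g\cdot v_\sigma=v_{g\sigma}$; $f$ is equivariant if $f(g\sigma)=gf(\sigma)$. -}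

module Defs where

open import Level using (0ℓ)
open import Data.Nat as ℕ using (ℕ; zero; suc; _≤_; _<_)
open import Data.Integer as ℤ using (ℤ; +_; -_)
open import Data.Integer.Divisibility as ℤD using ()
open import Data.Fin using (Fin)
open import Data.List as L using (List; []; _∷_; length; allFin)
open import Data.List.Membership.Propositional using (_∈_)
open import Data.List.Relation.Unary.Linked using (Linked)
open import Data.Maybe using (Maybe; just; nothing)
open import Data.Product using (Σ; Σ-syntax; ∃; _×_; _,_; proj₁; proj₂)
open import Data.Sum using (_⊎_)
open import Data.Empty using (⊥)
open import Relation.Nullary using (¬_; Dec; yes; no)
open import Relation.Binary using (Rel; Tri; tri<; tri≈; tri>; Trichotomous; IsStrictTotalOrder)
open import Relation.Binary.PropositionalEquality using (_≡_; _≢_; refl; cong)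
open import Data.Nat.ListAction using () renaming (sum to sumℕ)
open import Function using (_∘_; id)

-- A vertex type with a fixed total order (propositional equality).
-- Only trichotomy is needed to compute; at the base level we take a
-- genuine strict total order.

record Ordered : Set₁ where
  field
    Carrier : Set
    _≺_     : Carrier → Carrier → Set
    tri     : Trichotomous _≡_ _≺_

open Ordered public

fromSTO : (V : Set) (_<<_ : Rel V 0ℓ) → IsStrictTotalOrder _≡_ _<<_ → Ordered
fromSTO V _<<_ s = record { Carrier = V ; _≺_ = _<<_ ; tri = IsStrictTotalOrder.compare s }

data Lex {A : Set} (_≺_ : A → A → Set) : List A → List A → Set where
  []<   : ∀ {y ys} → Lex _≺_ [] (y ∷ ys)
  here  : ∀ {x y xs ys} → x ≺ y → Lex _≺_ (x ∷ xs) (y ∷ ys)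
  there : ∀ {x xs ys} → Lex _≺_ xs ys → Lex _≺_ (x ∷ xs) (x ∷ ys)

lexTri : {A : Set} {_≺_ : A → A → Set} → Trichotomous _≡_ _≺_ → Trichotomous _≡_ (Lex _≺_)
lexTri t [] [] = tri≈ (λ ()) refl (λ ())
lexTri t [] (y ∷ ys) = tri< []< (λ ()) (λ ())
lexTri t (x ∷ xs) [] = tri> (λ ()) (λ ()) []<
lexTri t (x ∷ xs) (y ∷ ys) with t x y
... | tri< a ¬b ¬c = tri< (here a) (λ { refl → ¬b refl })
        (λ { (here c) → ¬c c ; (there _) → ¬b refl })
... | tri> ¬a ¬b c = tri> (λ { (here a) → ¬a a ; (there _) → ¬b refl })
        (λ { refl → ¬b refl }) (here c)
... | tri≈ ¬a refl ¬c with lexTri t xs ys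
...   | tri< a' ¬b' ¬c' = tri< (there a') (λ { refl → ¬b' refl })
          (λ { (here c) → ¬c c ; (there c) → ¬c' c })
...   | tri≈ ¬a' refl ¬c' = tri≈ (λ { (here a) → ¬a a ; (there a) → ¬a' a }) refl
          (λ { (here c) → ¬c c ; (there c) → ¬c' c })
...   | tri> ¬a' ¬b' c' = tri> (λ { (here a) → ¬a a ; (there a) → ¬a' a })
          (λ { refl → ¬b' refl }) (there c')

-- vertices of Bd K are (nonempty) simplices of K, i.e. sorted lists
ListOrd : Ordered → Ordered
ListOrd O = record { Carrier = List (Carrier O) ; _≺_ = Lex (_≺_ O) ; tri = lexTri (tri O) }

Lv : ℕ → Ordered → Ordered
Lv zero O = O
Lv (suc k) O = ListOrd (Lv k O)

-- Simplices: a simplex is a finite set of vertices, represented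
-- canonically by its strictly increasing list of vertices (this is also
-- the oriented simplex [x_0,...,x_q] with x_0 < ... < x_q).

module _ (O : Ordered) where
  private
    A = Carrier O

  Sorted : List A → Set
  Sorted = Linked (_≺_ O)

  eqV : (x y : A) → Dec (x ≡ y)
  eqV x y with tri O x y
  ... | tri< _ ¬b _ = no ¬b
  ... | tri≈ _ b _ = yes b
  ... | tri> _ ¬b _ = no ¬b

  insC : A → List A → Maybe (ℕ × List A)
  insC x [] = just (0 , x ∷ [])
  insC x (y ∷ ys) with tri O x y
  ... | tri< _ _ _ = just (0 , x ∷ y ∷ ys)
  ... | tri≈ _ _ _ = nothing
  ... | tri> _ _ _ with insC x ys
  ...   | nothing = nothing
  ...   | just (n , l) = just (suc n , y ∷ l)

  sortC : List A → Maybe (ℕ × List A)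
  sortC [] = just (0 , [])
  sortC (x ∷ xs) with sortC xs
  ... | nothing = nothing
  ... | just (n , l) with insC x l
  ...   | nothing = nothing
  ...   | just (m , l') = just (n ℕ.+ m , l')

  insS : A → List A → List A
  insS x [] = x ∷ []
  insS x (y ∷ ys) with tri O x y
  ... | tri< _ _ _ = x ∷ y ∷ ys
  ... | tri≈ _ _ _ = y ∷ ys
  ... | tri> _ _ _ = y ∷ insS x ys

  setOf : List A → List A
  setOf [] = []
  setOf (x ∷ xs) = insS x (setOf xs)

  _⊆_ : List A → List A → Set
  σ ⊆ τ = ∀ x → x ∈ σ → x ∈ τ

  -- chains: formal ℤ-combinations of oriented simplices;
  -- two chains are equal iff all coefficients agree

  record Chain : Set where
    constructor chain
    field terms : List (ℤ × List A)

  coeffL : List (ℤ × List A) → List A → ℤ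
  coeffL [] s = + 0
  coeffL ((a , t) ∷ c) s with eqListV t s
    where
    eqListV : (u v : List A) → Dec (u ≡ v)
    eqListV u v with lexTri (tri O) u v
    ... | tri< _ ¬b _ = no ¬b
    ... | tri≈ _ b _ = yes b
    ... | tri> _ ¬b _ = no ¬b
  ... | yes _ = a ℤ.+ coeffL c s
  ... | no _ = coeffL c s

  coeff : Chain → List A → ℤ
  coeff (chain c) = coeffL c

  sgn : ℕ → ℤ
  sgn zero = + 1
  sgn (suc n) = - sgn n

  oriented : List A → Chain
  oriented l with sortC l
  ... | nothing = chain []
  ... | just (n , s) = chain ((sgn n , s) ∷ [])

  facesSigned : List A → List (ℤ × List A)
  facesSigned [] = []
  facesSigned (x ∷ xs) = (+ 1 , xs) ∷ L.map (λ { (a , t) → (- a , x ∷ t) }) (facesSigned xs)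

  bdS : List A → Chain
  bdS [] = chain []
  bdS (x ∷ []) = chain []
  bdS (x ∷ y ∷ xs) = chain (facesSigned (x ∷ y ∷ xs))

extC : {O O' : Ordered} → (List (Carrier O) → Chain O') → Chain O → Chain O'
extC {O} {O'} h (chain c) = chain (go c)
  where
  go : List (ℤ × List (Carrier O)) → List (ℤ × List (Carrier O'))
  go [] = []
  go ((a , s) ∷ c) = L.map (λ { (b , t) → (a ℤ.* b , t) }) (Chain.terms (h s)) L.++ go c

scaleC : {O : Ordered} → ℤ → Chain O → Chain O
scaleC a (chain c) = chain (L.map (λ { (b , t) → (a ℤ.* b , t) }) c)

∂ : {O : Ordered} → Chain O → Chain O
∂ {O} = extC (bdS O)

_≈C_ : {O : Ordered} → Chain O → Chain O → Set
_≈C_ {O} c c' = ∀ s → coeff O c s ≡ coeff O c' s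

mapC : {O O' : Ordered} → (Carrier O → Carrier O') → Chain O → Chain O'
mapC {O} {O'} f = extC (λ s → oriented O' (L.map f s))

-- subdivision chain map g : C(K) → C(Bd K)
-- g_0(v) = v_{v},  g_q(σ) = v_σ * g_{q-1}(∂σ)
module _ (O : Ordered) where
  gS : ℕ → List (Carrier O) → Chain (ListOrd O)
  gS _ [] = chain []
  gS _ (v ∷ []) = chain ((+ 1 , (v ∷ []) ∷ []) ∷ [])
  gS zero (_ ∷ _ ∷ _) = chain []
  gS (suc n) (x ∷ y ∷ xs) =
    extC {ListOrd O} {ListOrd O} (λ τ → oriented (ListOrd O) ((x ∷ y ∷ xs) ∷ τ))
      (extC {O} {ListOrd O} (gS n) (bdS O (x ∷ y ∷ xs)))

  gC : Chain O → Chain (ListOrd O)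
  gC = extC (λ s → gS (length s) s)

gk : (O : Ordered) (k : ℕ) → Chain O → Chain (Lv k O)
gk O zero c = c
gk O (suc k) c = gC (Lv k O) (gk O k c)

record Cx (O : Ordered) : Set₁ where
  constructor cx
  field _∋_ : List (Carrier O) → Set

open Cx public

module _ {O : Ordered} where
  private
    A = Carrier O

  record IsComplex (K : Cx O) : Set where
    field
      sorted    : ∀ σ → K ∋ σ → Sorted O σ
      nonempty  : Σ (List A) (K ∋_)
      closed    : ∀ σ τ → K ∋ σ → Sorted O τ → _⊆_ O τ σ → K ∋ τ
      finite    : Σ (List (List A)) λ Lst → ∀ σ → K ∋ σ → σ ∈ Lst

  VertexOf : Cx O → A → Set
  VertexOf K v = Σ (List A) λ σ → K ∋ σ × v ∈ σ

  -- d-dimensional pseudomanifold (a (d-1)-simplex has d vertices)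
  Adjacent : ℕ → List A → List A → Set
  Adjacent d σ τ = Σ (List A) λ α → Sorted O α × length α ≡ d × _⊆_ O α σ × _⊆_ O α τ

  data Connected (K : Cx O) (d : ℕ) : List A → List A → Set where
    stop : ∀ {σ} → Connected K d σ σ
    step : ∀ {σ ρ τ} → K ∋ ρ → length ρ ≡ suc d → Adjacent d σ ρ →
           Connected K d ρ τ → Connected K d σ τ

  record IsPseudomanifold (K : Cx O) (d : ℕ) : Set where
    field
      maximal : ∀ σ → K ∋ σ → (∀ τ → K ∋ τ → _⊆_ O σ τ → τ ≡ σ) → length σ ≡ suc d
      thin    : ∀ α → K ∋ α → length α ≡ d →
                Σ (List A) λ β₁ → Σ (List A) λ β₂ →
                  β₁ ≢ β₂ × K ∋ β₁ × K ∋ β₂ × length β₁ ≡ suc d × length β₂ ≡ suc d ×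
                  _⊆_ O α β₁ × _⊆_ O α β₂ ×
                  (∀ β → K ∋ β → length β ≡ suc d → _⊆_ O α β → β ≡ β₁ ⊎ β ≡ β₂)
      strongly-connected : ∀ σ τ → K ∋ σ → K ∋ τ → length σ ≡ suc d → length τ ≡ suc d →
                           Connected K d σ τ

  VF : Set
  VF = List (List A × List A)

  record IsVF (K : Cx O) (W : VF) : Set where
    field
      facet : ∀ α β → (α , β) ∈ W → K ∋ α × K ∋ β × _⊆_ O α β × suc (length α) ≡ length β
      unique : ∀ P Q → P ∈ W → Q ∈ W → ∀ x →
               (x ≡ proj₁ P ⊎ x ≡ proj₂ P) → (x ≡ proj₁ Q ⊎ x ≡ proj₂ Q) → P ≡ Q

  -- W-trajectory β₀, α₁, β₁, …, α_r, β_r  (the list holds the pairs (α_i , β_i))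
  data Trajectory (W : VF) : List A → List (List A × List A) → Set where
    done : ∀ {β} → Trajectory W β []
    more : ∀ {β α β' rest} → (α , β') ∈ W → _⊆_ O α β → α ≢ β → β ≢ β' →
           length β' ≡ length β → Trajectory W β' rest → Trajectory W β ((α , β') ∷ rest)

  endpoint : List A → List (List A × List A) → List A
  endpoint β [] = β
  endpoint β ((α , β') ∷ rest) = endpoint β' rest

  IsGradient : Cx O → VF → Set
  IsGradient K W = IsVF K W ×
    (∀ β₀ P rest → K ∋ β₀ → Trajectory W β₀ (P ∷ rest) → endpoint β₀ (P ∷ rest) ≢ β₀)

  Critical : Cx O → VF → List A → Set
  Critical K W σ = K ∋ σ × σ ≢ [] ×
    ((∀ P → P ∈ W → σ ≢ proj₁ P × σ ≢ proj₂ P) ⊎ (length σ ≡ 1 × ([] , σ) ∈ W))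

  IsCombSphere : Cx O → ℕ → Set
  IsCombSphere K d = IsComplex K × IsPseudomanifold K d ×
    Σ VF λ W → IsGradient K W ×
      Σ (List A) λ σ → Σ (List A) λ τ →
        σ ≢ τ × length σ ≡ suc d × length τ ≡ 1 × Critical K W σ × Critical K W τ ×
        (∀ ρ → Critical K W ρ → ρ ≡ σ ⊎ ρ ≡ τ)

  IsOrientation : Cx O → ℕ → Chain O → Set
  IsOrientation K d ξ =
    (∀ σ → K ∋ σ → length σ ≡ suc d → coeff O ξ σ ≡ + 1 ⊎ coeff O ξ σ ≡ - (+ 1)) ×
    (∀ σ → ¬ (K ∋ σ × length σ ≡ suc d) → coeff O ξ σ ≡ + 0) ×
    (∀ τ → coeff O (∂ ξ) τ ≡ + 0)

Join : {O : Ordered} {m : ℕ} → (Fin m → Cx O) → Cx O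
Join {O} {m} Ks = cx λ σ → Sorted O σ × Σ (Fin m → List (Carrier O)) λ τ →
  (∀ i → Ks i ∋ τ i) × (∀ x → (x ∈ σ → Σ (Fin m) λ i → x ∈ τ i) × (∀ i → x ∈ τ i → x ∈ σ))

PairwiseDisjoint : {O : Ordered} {m : ℕ} → (Fin m → Cx O) → Set
PairwiseDisjoint {O} {m} Ks = ∀ i j → i ≢ j → ∀ v → VertexOf (Ks i) v → VertexOf (Ks j) v → ⊥

Bd : {O : Ordered} → Cx O → Cx (ListOrd O)
Bd {O} K = cx λ c → Sorted (ListOrd O) c ×
  (∀ σ → σ ∈ c → K ∋ σ × σ ≢ []) ×
  (∀ σ τ → σ ∈ c → τ ∈ c → _⊆_ O σ τ ⊎ _⊆_ O τ σ)

Bdk : {O : Ordered} (k : ℕ) → Cx O → Cx (Lv k O)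
Bdk zero K = K
Bdk (suc k) K = Bd (Bdk k K)

iter : {A : Set} → (A → A) → ℕ → A → A
iter f zero x = x
iter f (suc n) x = f (iter f n x)

-- the action of g ∈ ℤ_p (g = 0 … p-1, acting as h^g) lifted to Bd^k: g·v_σ = v_{gσ}
actk : {O : Ordered} (h : Carrier O → Carrier O) (k : ℕ) (g : ℕ) → Carrier (Lv k O) → Carrier (Lv k O)
actk h zero g = iter h g
actk {O} h (suc k) g σ = setOf (Lv k O) (L.map (actk h k g) σ)

-- K is a ℤ_p-combinatorial d-sphere for the action of ℤ_p on vertices
-- generated by h (g ∈ ℤ_p acts as h^g)
IsZpCombSphere : {O : Ordered} → ℕ → (Carrier O → Carrier O) → Cx O → ℕ → Set
IsZpCombSphere {O} p h K d = IsCombSphere K d ×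
  (∀ v → iter h p v ≡ v) ×
  (∀ σ → K ∋ σ → K ∋ (setOf O (L.map h σ))) ×
  (∀ g → 1 ≤ g → g < p → ∀ σ → K ∋ σ → σ ≢ [] → setOf O (L.map (iter h g) σ) ≢ σ)

IsSimplicial : {O O' : Ordered} → Cx O → Cx O' → (Carrier O → Carrier O') → Set
IsSimplicial {O} {O'} K K' f = ∀ σ → K ∋ σ → K' ∋ (setOf O' (L.map f σ))

joinDim : {m : ℕ} → (Fin m → ℕ) → ℕ
joinDim {m} ds = sumℕ (L.map (λ i → suc (ds i)) (allFin m)) ℕ.∸ 1

IsDegree : {O : Ordered} (k : ℕ) (S : Cx O) (d : ℕ) (f : Carrier (Lv k O) → Carrier O) → ℤ → Set
IsDegree {O} k S d f m = Σ (Chain (Lv k O)) λ ξ → IsOrientation (Bdk k S) d ξ ×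
  (gk O k (mapC f ξ) ≈C scaleC m ξ)

_≡_[modℤ_] : ℤ → ℤ → ℕ → Set
a ≡ b [modℤ p ] = (+ p) ℤD.∣ (a ℤ.- b)

{-# OPTIONS --safe #-}
-- A gradient field with two critical simplices is an acyclic perfect matching of the faces of a
-- sphere, the empty one included, away from one top simplex; the join of such spheres inherits
-- one from the first factor whose part is not its top simplex. The matching yields a chain
-- contraction of the augmented chain complex onto a single top cycle η, whose coefficients are
-- ±1 because consecutive top simplices share a facet that lies in no others. Composing
-- the contraction with a chain self-map ψ gives a Lefschetz formula in which the alternating sum
-- of traces is 1 plus or minus the degree of ψ; for an equivariant ψ all traces above the
-- empty simplex are sums over free orbits, hence divisible by p, so the degree is determined
-- modulo p. Comparing with ψ = id, of degree 1, gives degree 1 modulo p for every equivariant ψ,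
-- in particular for f composed with the iterated subdivision operator. Subdivision sends η to a
-- generator of the top cycles of Bdᵏ, since it is inverted up to homotopy by a
-- vertex-choosing map, so the combinatorial degree is that of ψ.
--
-- Chains are formal lists of ordered simplices, tested against alternating cochains: this
-- replaces the choice of oriented representatives, and all identities hold before sorting.
module Submission where

open import Defs
open import Level using (0ℓ)
open import Data.Nat as ℕ using (ℕ; zero; suc; _≤_; _<_; z≤n; s≤s; nonTrivial⇒n>1)
import Data.Nat.Properties as ℕP
open import Data.Nat.Primality using (Prime; prime⇒nonTrivial)
import Data.Nat.Divisibility as ℕD
open import Data.Integer as ℤ using (ℤ; +_; -_; _+_; _*_; _-_; ∣_∣)
import Data.Integer.Properties as ℤP
open import Data.Integer.Tactic.RingSolver using (solve-∀)
open import Data.Fin as F using (Fin)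
open import Data.Vec.Functional using (updateAt)
open import Data.Vec.Functional.Properties using (updateAt-updates; updateAt-minimal)
import Data.Fin.Properties as FP
open import Data.Nat.ListAction using (sum)
open import Data.Fin.Induction using (spo-wellFounded) renaming (<-wellFounded to F-<-wellFounded)
open import Data.List using (List; []; _∷_; _++_; length; map; concat)
import Data.List.Properties as LP
open import Data.List.Base using (filter; applyUpTo; lookup; tabulate)
open import Data.List.Membership.Propositional.Properties
  using (∈-filter⁺; ∈-filter⁻; ∈-applyUpTo⁺; ∈-applyUpTo⁻; ∈-map⁺; ∈-map⁻; ∈-concat⁺′; ∈-concat⁻′; ∈-tabulate⁺; ∈-tabulate⁻; ∈-lookup; ∈-∃++; ∈-++⁺ˡ; ∈-++⁺ʳ; ∈-++⁻)
import Data.List.Membership.DecPropositional as DecMembership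
open import Data.List.Membership.Propositional.Properties.WithK using (unique∧set⇒bag)
open import Data.List.Relation.Binary.BagAndSetEquality using (∼bag⇒↭)
open import Data.List.Relation.Binary.Permutation.Propositional as Perm using (_↭_)
import Data.List.Relation.Unary.Unique.Propositional.Properties as UniqueP
open import Data.List.Membership.Propositional using (_∈_; _∉_)
open import Data.List.Relation.Unary.Any as Any using (Any; here; there)
open import Data.List.Relation.Unary.Any.Properties using (lookup-index)
open import Data.List.Relation.Unary.All as All using (All; []; _∷_)
import Data.List.Relation.Unary.All.Properties as AllP
open import Data.List.Relation.Unary.AllPairs using (AllPairs; []; _∷_)
import Data.List.Relation.Unary.AllPairs.Properties as AllPairsP
open import Data.List.Relation.Unary.Linked using ([]; [-]; _∷_)
open import Data.List.Relation.Unary.Linked.Properties using (Linked⇒AllPairs; AllPairs⇒Linked) renaming (filter⁺ to Linked-filter⁺)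
open import Data.List.Relation.Unary.Unique.Propositional using (Unique)
open import Data.Product using (Σ; _×_; _,_; proj₁; proj₂)
open import Data.Sum as Sum using (_⊎_; inj₁; inj₂)
open import Data.Empty using (⊥; ⊥-elim)
open import Data.Unit using (⊤; tt)
open import Data.Maybe using (Maybe; just; nothing)
open import Function using (_∘_; id; mk⇔)
open import Induction.WellFounded using (Acc; acc; WellFounded)
open import Relation.Binary.Construct.Closure.Transitive as Plus using (TransClosure; [_])
open import Relation.Nullary using (_⊎-dec_; ¬_; Dec; yes; no; ¬?; _×-dec_)
open import Relation.Binary using (Rel; IsStrictTotalOrder; Transitive; Tri; tri<; tri≈; tri>)
open import Relation.Binary.PropositionalEquality
  using (_≡_; _≢_; isEquivalence; refl; sym; trans; cong; cong₂; subst; subst₂; module ≡-Reasoning)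

-- The combinatorial degree concerns `gᵏ f` on `Bdᵏ`, where no matching is constructed. Hence the
-- detour through the opposite composite on the join itself, and hence subdivision has to transport
-- only one package of facts: a top cycle with coefficients ±1 of which every top cycle is a
-- multiple. The empty simplex is fixed by the action and forms the one orbit that is not free; its
-- trace 1 is what keeps the Lefschetz congruence from being vacuous. The sign that remains depends
-- on the dimension, and the identity map removes it without a case distinction on `p`. Dimension 0
-- is exceptional. Since `∂` is 0 on vertices, every sign vector is an orientation there, whether or
-- not it is a cycle of the augmented complex, and the integer satisfying the degree equation can
-- depend on the choice. It is still determined modulo `p`, because in that dimension the congruence
-- for the identity says that `p` divides 2.

+-congˡ : ∀ u {v w} → v ≡ w → u + v ≡ u + w
+-congˡ u = cong (λ v → u + v)

-- Formal chains and alternating cochains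

FC : Set → Set
FC X = List (ℤ × X)

⟨_,_⟩ : {X : Set} → (X → ℤ) → FC X → ℤ
⟨ φ , [] ⟩ = + 0
⟨ φ , (a , x) ∷ c ⟩ = a * φ x + ⟨ φ , c ⟩

scale : {X : Set} → ℤ → FC X → FC X
scale a [] = []
scale a ((b , x) ∷ c) = (a * b , x) ∷ scale a c

ext : {X Y : Set} → (X → FC Y) → FC X → FC Y
ext h [] = []
ext h ((a , x) ∷ c) = scale a (h x) ++ ext h c

mapFC : {X Y : Set} → (X → Y) → FC X → FC Y
mapFC f [] = []
mapFC f ((a , x) ∷ c) = (a , f x) ∷ mapFC f c

single : {X : Set} → X → FC X
single x = (+ 1 , x) ∷ []

Supp : {X : Set} → (X → Set) → FC X → Set
Supp P = All (λ t → P (proj₂ t))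

module _ {X : Set} where

  ⟨⟩-++ : (φ : X → ℤ) (c d : FC X) → ⟨ φ , c ++ d ⟩ ≡ ⟨ φ , c ⟩ + ⟨ φ , d ⟩
  ⟨⟩-++ φ [] d = sym (ℤP.+-identityˡ _)
  ⟨⟩-++ φ ((a , x) ∷ c) d = trans (+-congˡ (a * φ x) (⟨⟩-++ φ c d)) (sym (ℤP.+-assoc (a * φ x) _ _))

  ⟨⟩-scale : (φ : X → ℤ) (a : ℤ) (c : FC X) → ⟨ φ , scale a c ⟩ ≡ a * ⟨ φ , c ⟩
  ⟨⟩-scale φ a [] = sym (ℤP.*-zeroʳ a)
  ⟨⟩-scale φ a ((b , x) ∷ c) = trans (+-congˡ (a * b * φ x) (⟨⟩-scale φ a c)) (lem a b (φ x) ⟨ φ , c ⟩)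
    where
    lem : ∀ a b y z → a * b * y + a * z ≡ a * (b * y + z)
    lem = solve-∀

  ⟨⟩-single : (φ : X → ℤ) (x : X) → ⟨ φ , single x ⟩ ≡ φ x
  ⟨⟩-single φ x = trans (ℤP.+-identityʳ _) (ℤP.*-identityˡ _)

  ⟨⟩-congS : {P : X → Set} {φ ψ : X → ℤ} (c : FC X) → Supp P c → (∀ x → P x → φ x ≡ ψ x) →
             ⟨ φ , c ⟩ ≡ ⟨ ψ , c ⟩
  ⟨⟩-congS [] [] e = refl
  ⟨⟩-congS ((a , x) ∷ c) (p ∷ ps) e = cong₂ (λ u v → a * u + v) (e x p) (⟨⟩-congS c ps e)

  ⟨⟩-cong : {φ ψ : X → ℤ} (c : FC X) → (∀ x → φ x ≡ ψ x) → ⟨ φ , c ⟩ ≡ ⟨ ψ , c ⟩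
  ⟨⟩-cong [] e = refl
  ⟨⟩-cong ((a , x) ∷ c) e = cong₂ (λ u v → a * u + v) (e x) (⟨⟩-cong c e)

  ⟨⟩-0 : (c : FC X) → ⟨ (λ _ → + 0) , c ⟩ ≡ + 0
  ⟨⟩-0 [] = refl
  ⟨⟩-0 ((a , x) ∷ c) = trans (cong₂ _+_ (ℤP.*-zeroʳ a) (⟨⟩-0 c)) refl

  ⟨⟩-0S : {P : X → Set} {φ : X → ℤ} (c : FC X) → Supp P c → (∀ x → P x → φ x ≡ + 0) → ⟨ φ , c ⟩ ≡ + 0
  ⟨⟩-0S c s e = trans (⟨⟩-congS c s e) (⟨⟩-0 c)

  ⟨⟩-+ : (φ ψ : X → ℤ) (c : FC X) → ⟨ (λ x → φ x + ψ x) , c ⟩ ≡ ⟨ φ , c ⟩ + ⟨ ψ , c ⟩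
  ⟨⟩-+ φ ψ [] = refl
  ⟨⟩-+ φ ψ ((a , x) ∷ c) = trans (+-congˡ (a * (φ x + ψ x)) (⟨⟩-+ φ ψ c)) (lem a (φ x) (ψ x) _ _)
    where
    lem : ∀ a u v y z → a * (u + v) + (y + z) ≡ (a * u + y) + (a * v + z)
    lem = solve-∀

  ⟨⟩-* : (k : ℤ) (φ : X → ℤ) (c : FC X) → ⟨ (λ x → k * φ x) , c ⟩ ≡ k * ⟨ φ , c ⟩
  ⟨⟩-* k φ [] = sym (ℤP.*-zeroʳ k)
  ⟨⟩-* k φ ((a , x) ∷ c) = trans (+-congˡ (a * (k * φ x)) (⟨⟩-* k φ c)) (lem a k (φ x) _)
    where
    lem : ∀ a k u z → a * (k * u) + k * z ≡ k * (a * u + z)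
    lem = solve-∀

  ⟨⟩-neg : (φ : X → ℤ) (c : FC X) → ⟨ (λ x → - φ x) , c ⟩ ≡ - ⟨ φ , c ⟩
  ⟨⟩-neg φ [] = refl
  ⟨⟩-neg φ ((a , x) ∷ c) = trans (+-congˡ (a * (- φ x)) (⟨⟩-neg φ c)) (lem a (φ x) _)
    where
    lem : ∀ a u z → a * (- u) + - z ≡ - (a * u + z)
    lem = solve-∀

  ⟨⟩-- : (φ ψ : X → ℤ) (c : FC X) → ⟨ (λ x → φ x - ψ x) , c ⟩ ≡ ⟨ φ , c ⟩ - ⟨ ψ , c ⟩
  ⟨⟩-- φ ψ c = trans (⟨⟩-+ φ (λ x → - ψ x) c) (+-congˡ (⟨ φ , c ⟩) (⟨⟩-neg ψ c))

  Supp-scale : {P : X → Set} (a : ℤ) (c : FC X) → Supp P c → Supp P (scale a c)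
  Supp-scale a [] [] = []
  Supp-scale a (x ∷ c) (p ∷ ps) = p ∷ Supp-scale a c ps

module _ {X Y : Set} where

  ⟨⟩-ext : (φ : Y → ℤ) (h : X → FC Y) (c : FC X) → ⟨ φ , ext h c ⟩ ≡ ⟨ (λ x → ⟨ φ , h x ⟩) , c ⟩
  ⟨⟩-ext φ h [] = refl
  ⟨⟩-ext φ h ((a , x) ∷ c) =
    trans (⟨⟩-++ φ (scale a (h x)) (ext h c)) (cong₂ _+_ (⟨⟩-scale φ a (h x)) (⟨⟩-ext φ h c))

  ⟨⟩-mapFC : (φ : Y → ℤ) (f : X → Y) (c : FC X) → ⟨ φ , mapFC f c ⟩ ≡ ⟨ φ ∘ f , c ⟩
  ⟨⟩-mapFC φ f [] = refl
  ⟨⟩-mapFC φ f ((a , x) ∷ c) = +-congˡ (a * φ (f x)) (⟨⟩-mapFC φ f c)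

  Supp-ext : {P : X → Set} {Q : Y → Set} (h : X → FC Y) (c : FC X) → Supp P c →
             (∀ x → P x → Supp Q (h x)) → Supp Q (ext h c)
  Supp-ext h [] [] k = []
  Supp-ext h ((a , x) ∷ c) (p ∷ ps) k = AllP.++⁺ (Supp-scale a (h x) (k x p)) (Supp-ext h c ps k)

  Supp-mapFC : {P : X → Set} {Q : Y → Set} (f : X → Y) (c : FC X) → Supp P c →
               (∀ x → P x → Q (f x)) → Supp Q (mapFC f c)
  Supp-mapFC f [] [] k = []
  Supp-mapFC f ((a , x) ∷ c) (p ∷ ps) k = k x p ∷ Supp-mapFC f c ps k

  ext-congS : {P : X → Set} {h h' : X → FC Y} (c : FC X) → Supp P c → (∀ x → P x → h x ≡ h' x) →
              ext h c ≡ ext h' c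
  ext-congS [] [] e = refl
  ext-congS ((a , x) ∷ c) (p ∷ ps) e = cong₂ (λ u v → scale a u ++ v) (e x p) (ext-congS c ps e)

  ⟨⟩-swap : (θ : X → Y → ℤ) (c : FC X) (d : FC Y) →
            ⟨ (λ x → ⟨ θ x , d ⟩) , c ⟩ ≡ ⟨ (λ y → ⟨ (λ x → θ x y) , c ⟩) , d ⟩
  ⟨⟩-swap θ [] d = sym (⟨⟩-0 d)
  ⟨⟩-swap θ ((a , x) ∷ c) d = sym (trans (⟨⟩-+ (λ y → a * θ x y) _ d)
    (cong₂ _+_ (⟨⟩-* a (θ x) d) (sym (⟨⟩-swap θ c d))))

Supp-map : {X : Set} {P Q : X → Set} {c : FC X} → (∀ x → P x → Q x) → Supp P c → Supp Q c
Supp-map f = All.map (f _)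

module _ {A : Set} where

  cone : A → FC (List A) → FC (List A)
  cone v = mapFC (v ∷_)

  -- A one-vertex list has the empty list as a face with coefficient 1, so this is the augmented
  -- boundary. The second clause is `∂ (x * l) = l - x * ∂ l`, the cone formula on which all later
  -- recursions rest.
  faces : List A → FC (List A)
  faces [] = []
  faces (x ∷ l) = (+ 1 , l) ∷ scale (- (+ 1)) (cone x (faces l))

  δ : (List A → ℤ) → List A → ℤ
  δ Φ l = ⟨ Φ , faces l ⟩

  δ-∷ : (Φ : List A → ℤ) (x : A) (l : List A) → δ Φ (x ∷ l) ≡ Φ l - δ (Φ ∘ (x ∷_)) l
  δ-∷ Φ x l = cong₂ _+_ (ℤP.*-identityˡ (Φ l))
    (trans (⟨⟩-scale Φ (- (+ 1)) (cone x (faces l)))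
      (trans (ℤP.-1*i≡-i _) (cong -_ (⟨⟩-mapFC Φ (x ∷_) (faces l)))))

  δδ : (Φ : List A → ℤ) (l : List A) → δ (δ Φ) l ≡ + 0
  δδ Φ [] = refl
  δδ Φ (x ∷ l) = begin
    δ (δ Φ) (x ∷ l)                                ≡⟨ δ-∷ (δ Φ) x l ⟩
    δ Φ l - δ (δ Φ ∘ (x ∷_)) l                     ≡⟨ cong (λ u → δ Φ l - u) (⟨⟩-cong (faces l) (δ-∷ Φ x)) ⟩
    δ Φ l - δ (λ t → Φ t - δ (Φ ∘ (x ∷_)) t) l     ≡⟨ cong (λ u → δ Φ l - u) (⟨⟩-- Φ (δ (Φ ∘ (x ∷_))) (faces l)) ⟩
    δ Φ l - (δ Φ l - δ (δ (Φ ∘ (x ∷_))) l)         ≡⟨ cong (λ u → δ Φ l - (δ Φ l - u)) (δδ (Φ ∘ (x ∷_)) l) ⟩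
    δ Φ l - (δ Φ l - + 0)                          ≡⟨ lem (δ Φ l) ⟩
    + 0 ∎
    where
    open ≡-Reasoning
    lem : ∀ u → u - (u - + 0) ≡ + 0
    lem = solve-∀

  -- Adjacent transpositions generate all permutations, so such a `Φ` depends only on oriented
  -- simplices. Vanishing on lists with a repeated vertex is included, because ℤ has no 2-torsion.
  record Alt (Φ : List A → ℤ) : Set where
    constructor alt
    field swapped : ∀ xs a b ys → Φ (xs ++ a ∷ b ∷ ys) ≡ - Φ (xs ++ b ∷ a ∷ ys)

  open Alt public

  ≡-neg⇒≡0 : {u : ℤ} → u ≡ - u → u ≡ + 0
  ≡-neg⇒≡0 {+ zero} e = refl
  ≡-neg⇒≡0 {+ suc n} ()
  ≡-neg⇒≡0 {ℤ.negsuc n} ()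

  Alt-dup : ∀ {Φ} → Alt Φ → ∀ a ys → Φ (a ∷ a ∷ ys) ≡ + 0
  Alt-dup A a ys = ≡-neg⇒≡0 (swapped A [] a a ys)

  Alt-∷ : ∀ {Φ} → Alt Φ → ∀ x → Alt (Φ ∘ (x ∷_))
  Alt-∷ A x = alt λ xs → swapped A (x ∷ xs)

  Alt-cong : ∀ {Φ Ψ} → (∀ l → Φ l ≡ Ψ l) → Alt Φ → Alt Ψ
  Alt-cong e A = alt λ xs a b ys → trans (sym (e _)) (trans (swapped A xs a b ys) (cong -_ (e _)))

  Alt-+ : ∀ {Φ Ψ} → Alt Φ → Alt Ψ → Alt (λ l → Φ l + Ψ l)
  Alt-+ {Φ} {Ψ} A B = alt λ xs a b ys → trans (cong₂ _+_ (swapped A xs a b ys) (swapped B xs a b ys))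
    (sym (ℤP.neg-distrib-+ (Φ (xs ++ b ∷ a ∷ ys)) (Ψ (xs ++ b ∷ a ∷ ys))))

  Alt-* : ∀ {Φ} k → Alt Φ → Alt (λ l → k * Φ l)
  Alt-* k A = alt λ xs a b ys → trans (cong (k *_) (swapped A xs a b ys)) (sym (ℤP.neg-distribʳ-* k _))

  Alt-neg : ∀ {Φ} → Alt Φ → Alt (λ l → - Φ l)
  Alt-neg A = alt λ xs a b ys → cong -_ (swapped A xs a b ys)

  -- Faces keeping both swapped vertices change sign by hypothesis. The two faces that drop one of
  -- them trade places, and their positions differ by one.
  Alt-δ : ∀ {Φ} → Alt Φ → Alt (δ Φ)
  Alt-δ {Φ} aΦ = alt (go aΦ)
    where
    open ≡-Reasoning
    lem : ∀ u v w → u - (v - w) ≡ - (v - (u - - w))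
    lem = solve-∀
    lem' : ∀ u v → - u - - v ≡ - (u - v)
    lem' = solve-∀
    two : ∀ (Φ : List A → ℤ) a b ys → δ Φ (a ∷ b ∷ ys) ≡ Φ (b ∷ ys) - (Φ (a ∷ ys) - δ (λ t → Φ (a ∷ b ∷ t)) ys)
    two Φ a b ys = trans (δ-∷ Φ a (b ∷ ys)) (cong (λ u → Φ (b ∷ ys) - u) (δ-∷ (Φ ∘ (a ∷_)) b ys))
    go : ∀ {Φ} → Alt Φ → ∀ xs a b ys → δ Φ (xs ++ a ∷ b ∷ ys) ≡ - δ Φ (xs ++ b ∷ a ∷ ys)
    go {Φ} A [] a b ys = begin
      δ Φ (a ∷ b ∷ ys)                                             ≡⟨ two Φ a b ys ⟩
      Φ (b ∷ ys) - (Φ (a ∷ ys) - δ (λ t → Φ (a ∷ b ∷ t)) ys)       ≡⟨ lem (Φ (b ∷ ys)) (Φ (a ∷ ys)) _ ⟩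
      - (Φ (a ∷ ys) - (Φ (b ∷ ys) - - δ (λ t → Φ (a ∷ b ∷ t)) ys))
        ≡⟨ cong (λ u → - (Φ (a ∷ ys) - (Φ (b ∷ ys) - u)))
             (trans (sym (⟨⟩-neg (λ t → Φ (a ∷ b ∷ t)) (faces ys)))
                    (⟨⟩-cong (faces ys) (λ t → sym (swapped A [] b a t)))) ⟩
      - (Φ (a ∷ ys) - (Φ (b ∷ ys) - δ (λ t → Φ (b ∷ a ∷ t)) ys))   ≡⟨ cong -_ (sym (two Φ b a ys)) ⟩
      - δ Φ (b ∷ a ∷ ys) ∎
    go {Φ} A (x ∷ xs) a b ys = begin
      δ Φ (x ∷ xs ++ a ∷ b ∷ ys)                                       ≡⟨ δ-∷ Φ x (xs ++ a ∷ b ∷ ys) ⟩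
      Φ (xs ++ a ∷ b ∷ ys) - δ (Φ ∘ (x ∷_)) (xs ++ a ∷ b ∷ ys)
        ≡⟨ cong₂ _-_ (swapped A xs a b ys) (go (Alt-∷ A x) xs a b ys) ⟩
      - Φ (xs ++ b ∷ a ∷ ys) - - δ (Φ ∘ (x ∷_)) (xs ++ b ∷ a ∷ ys)     ≡⟨ lem' (Φ (xs ++ b ∷ a ∷ ys)) _ ⟩
      - (Φ (xs ++ b ∷ a ∷ ys) - δ (Φ ∘ (x ∷_)) (xs ++ b ∷ a ∷ ys))
        ≡⟨ cong -_ (sym (δ-∷ Φ x (xs ++ b ∷ a ∷ ys))) ⟩
      - δ Φ (x ∷ xs ++ b ∷ a ∷ ys) ∎

  Alt-shift : ∀ {Φ} → Alt Φ → ∀ as a bs → Φ (as ++ a ∷ bs) ≡ Φ (a ∷ as ++ bs) ⊎ Φ (as ++ a ∷ bs) ≡ - Φ (a ∷ as ++ bs)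
  Alt-shift A [] a bs = inj₁ refl
  Alt-shift A (x ∷ as) a bs with Alt-shift (Alt-∷ A x) as a bs
  ... | inj₁ e = inj₂ (trans e (swapped A [] x a (as ++ bs)))
  ... | inj₂ e = inj₁ (trans e (trans (cong -_ (swapped A [] x a (as ++ bs))) (ℤP.neg-involutive _)))

  FaceOf : List A → List A → Set
  FaceOf l t = (length l ≡ suc (length t)) × (∀ {x} → x ∈ t → x ∈ l)

  faces-face : ∀ l → Supp (FaceOf l) (faces l)
  faces-face [] = []
  faces-face (x ∷ l) = (refl , there) ∷ Supp-scale (- (+ 1)) (cone x (faces l))
    (Supp-mapFC (x ∷_) (faces l) (faces-face l) λ t (e , i) → cong suc e , λ { (here p) → here p ; (there q) → there (i q) })

-- Signs, sorting and oriented simplices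

IsUnit : ℤ → Set
IsUnit e = e ≡ + 1 ⊎ e ≡ - (+ 1)

unit-neg : ∀ {e} → IsUnit e → IsUnit (- e)
unit-neg (inj₁ refl) = inj₂ refl
unit-neg (inj₂ refl) = inj₁ refl

unit-* : ∀ {e f} → IsUnit e → IsUnit f → IsUnit (e * f)
unit-* (inj₁ refl) (inj₁ refl) = inj₁ refl
unit-* (inj₁ refl) (inj₂ refl) = inj₂ refl
unit-* (inj₂ refl) (inj₁ refl) = inj₂ refl
unit-* (inj₂ refl) (inj₂ refl) = inj₁ refl

unit-square : ∀ {e} → IsUnit e → e * e ≡ + 1
unit-square (inj₁ refl) = refl
unit-square (inj₂ refl) = refl

unit-cancel : ∀ {e u v} → IsUnit e → e * u ≡ e * v → u ≡ v
unit-cancel {e} {u} {v} i eq = begin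
  u            ≡⟨ ℤP.*-identityˡ u ⟨
  + 1 * u      ≡⟨ cong (_* u) (unit-square i) ⟨
  e * e * u    ≡⟨ ℤP.*-assoc e e u ⟩
  e * (e * u)  ≡⟨ cong (e *_) eq ⟩
  e * (e * v)  ≡⟨ ℤP.*-assoc e e v ⟨
  e * e * v    ≡⟨ cong (_* v) (unit-square i) ⟩
  + 1 * v      ≡⟨ ℤP.*-identityˡ v ⟩
  v ∎
  where open ≡-Reasoning

module Order (O : Ordered) where
  private
    A = Carrier O
    infix 4 _<ₒ_
    _<ₒ_ = _≺_ O

  ≺-irrefl : ∀ {x} → ¬ (x <ₒ x)
  ≺-irrefl {x} p with tri O x x
  ... | tri< _ n _ = n refl
  ... | tri≈ n _ _ = n p
  ... | tri> _ n _ = n refl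

  ≺-asym : ∀ {x y} → x <ₒ y → ¬ (y <ₒ x)
  ≺-asym {x} {y} p with tri O x y
  ... | tri< _ _ n = n
  ... | tri≈ n _ _ = ⊥-elim (n p)
  ... | tri> n _ _ = ⊥-elim (n p)

  ≺-≢ : ∀ {x y} → x <ₒ y → x ≢ y
  ≺-≢ p refl = ≺-irrefl p

  I-case : ∀ {x y} → Tri (x <ₒ y) (x ≡ y) (y <ₒ x) → ℤ → ℤ → ℤ
  I-case (tri< _ _ _) u v = u
  I-case (tri≈ _ _ _) u v = + 0
  I-case (tri> _ _ _) u v = - v

  -- The transpose of signed insertion: `θ` read at `x` inserted into `t`, with a sign for each
  -- vertex passed and 0 if `x` is met. Working on cochains keeps the `Maybe` of `insC` out of the
  -- identities.
  I : A → (List A → ℤ) → List A → ℤ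
  I x θ [] = θ (x ∷ [])
  I x θ (y ∷ ys) = I-case (tri O x y) (θ (x ∷ y ∷ ys)) (I x (θ ∘ (y ∷_)) ys)

  I-< : ∀ {x y} θ ys → x <ₒ y → I x θ (y ∷ ys) ≡ θ (x ∷ y ∷ ys)
  I-< {x} {y} θ ys p with tri O x y
  ... | tri< _ _ _ = refl
  ... | tri≈ n _ _ = ⊥-elim (n p)
  ... | tri> n _ _ = ⊥-elim (n p)

  I-≈ : ∀ x θ ys → I x θ (x ∷ ys) ≡ + 0
  I-≈ x θ ys with tri O x x
  ... | tri< _ n _ = ⊥-elim (n refl)
  ... | tri≈ _ _ _ = refl
  ... | tri> _ n _ = ⊥-elim (n refl)

  I-> : ∀ {x y} θ ys → y <ₒ x → I x θ (y ∷ ys) ≡ - I x (θ ∘ (y ∷_)) ys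
  I-> {x} {y} θ ys p with tri O x y
  ... | tri< _ _ n = ⊥-elim (n p)
  ... | tri≈ _ _ n = ⊥-elim (n p)
  ... | tri> _ _ _ = refl

  I-cong : ∀ x {θ θ'} → (∀ l → θ l ≡ θ' l) → ∀ t → I x θ t ≡ I x θ' t
  I-cong x e [] = e _
  I-cong x e (y ∷ ys) = cong₂ (I-case (tri O x y)) (e _) (I-cong x (λ l → e (y ∷ l)) ys)

  I-neg : ∀ x θ t → I x (λ l → - θ l) t ≡ - I x θ t
  I-neg x θ [] = refl
  I-neg x θ (y ∷ ys) with tri O x y
  ... | tri< _ _ _ = refl
  ... | tri≈ _ _ _ = refl
  ... | tri> _ _ _ = cong -_ (I-neg x (θ ∘ (y ∷_)) ys)

  I-0 : ∀ x t → I x (λ _ → + 0) t ≡ + 0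
  I-0 x [] = refl
  I-0 x (y ∷ ys) with tri O x y
  ... | tri< _ _ _ = refl
  ... | tri≈ _ _ _ = refl
  ... | tri> _ _ _ = cong -_ (I-0 x ys)

  -- oF θ l is θ evaluated at the oriented simplex of l, with 0 for degenerate l.
  oF : (List A → ℤ) → List A → ℤ
  oF θ [] = θ []
  oF θ (x ∷ l) = oF (I x θ) l

  oF-cong : ∀ {θ θ'} → (∀ l → θ l ≡ θ' l) → ∀ l → oF θ l ≡ oF θ' l
  oF-cong e [] = e []
  oF-cong e (x ∷ l) = oF-cong (I-cong x e) l

  oF-neg : ∀ θ l → oF (λ t → - θ t) l ≡ - oF θ l
  oF-neg θ [] = refl
  oF-neg θ (x ∷ l) = trans (oF-cong (I-neg x θ) l) (oF-neg (I x θ) l)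

  -- Passing a vertex is a transposition and meeting an equal one is a repetition, so each clause of
  -- `I` matches a property of `Alt`.
  I-alt : ∀ {Φ} → Alt Φ → ∀ x t → Φ (x ∷ t) ≡ I x Φ t
  I-alt al x [] = refl
  I-alt {Φ} al x (y ∷ ys) with tri O x y
  ... | tri< _ _ _ = refl
  ... | tri≈ _ refl _ = Alt-dup al x ys
  ... | tri> _ _ _ = trans (swapped al [] x y ys) (cong -_ (I-alt (Alt-∷ al y) x ys))

  oF-alt : ∀ {Φ} → Alt Φ → ∀ l → oF Φ l ≡ Φ l
  oF-alt al [] = refl
  oF-alt al (x ∷ l) = trans (oF-cong (λ t → sym (I-alt al x t)) l) (oF-alt (Alt-∷ al x) l)

  oF-sorted : ∀ θ t → Sorted O t → oF θ t ≡ θ t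
  oF-sorted θ [] _ = refl
  oF-sorted θ (x ∷ []) _ = refl
  oF-sorted θ (x ∷ y ∷ ys) (p ∷ s) = trans (oF-sorted (I x θ) (y ∷ ys) s) (I-< θ ys p)

  χ : List A → List A → ℤ
  χ s t with eqV (ListOrd O) t s
  ... | yes _ = + 1
  ... | no _ = + 0

  χ-refl : ∀ s → χ s s ≡ + 1
  χ-refl s with eqV (ListOrd O) s s
  ... | yes _ = refl
  ... | no n = ⊥-elim (n refl)

  χ-≢ : ∀ {s t} → t ≢ s → χ s t ≡ + 0
  χ-≢ {s} {t} n with eqV (ListOrd O) t s
  ... | yes e = ⊥-elim (n e)
  ... | no _ = refl

  coeffL-χ : ∀ c s → coeffL O c s ≡ ⟨ χ s , c ⟩
  coeffL-χ [] s = refl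
  coeffL-χ ((a , t) ∷ c) s with lexTri (tri O) t s
  ... | tri< _ _ _ = trans (coeffL-χ c s) (sym (trans (cong (λ z → z + ⟨ χ s , c ⟩) (ℤP.*-zeroʳ a)) (ℤP.+-identityˡ _)))
  ... | tri≈ _ _ _ = cong₂ _+_ (sym (ℤP.*-identityʳ a)) (coeffL-χ c s)
  ... | tri> _ _ _ = trans (coeffL-χ c s) (sym (trans (cong (λ z → z + ⟨ χ s , c ⟩) (ℤP.*-zeroʳ a)) (ℤP.+-identityˡ _)))

  sgn-+ : ∀ n m → sgn O (n ℕ.+ m) ≡ sgn O n * sgn O m
  sgn-+ zero m = sym (ℤP.*-identityˡ _)
  sgn-+ (suc n) m = trans (cong -_ (sgn-+ n m)) (ℤP.neg-distribˡ-* (sgn O n) (sgn O m))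

  sgn-unit : ∀ n → IsUnit (sgn O n)
  sgn-unit zero = inj₁ refl
  sgn-unit (suc n) = unit-neg (sgn-unit n)

  -- Ties together three versions of insertion: `insC` with its count of transpositions, `insS` on
  -- sets and `I` on cochains.
  data InsView (x : A) (t : List A) : Set where
    dup : insC O x t ≡ nothing → x ∈ t → (∀ θ → I x θ t ≡ + 0) → InsView x t
    new : ∀ n → insC O x t ≡ just (n , insS O x t) → length (insS O x t) ≡ suc (length t) →
          (∀ θ → I x θ t ≡ sgn O n * θ (insS O x t)) → InsView x t

  insView : ∀ x t → InsView x t
  insView x [] = new 0 refl refl (λ θ → sym (ℤP.*-identityˡ _))
  insView x (y ∷ ys) with insView x ys | tri O x y in eq
  ... | _ | tri< p _ _ = new 0 e₁ (cong length e₂) λ θ → trans (I-< θ ys p)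
                          (trans (cong θ (sym e₂)) (sym (ℤP.*-identityˡ _)))
    where
    e₂ : insS O x (y ∷ ys) ≡ x ∷ y ∷ ys
    e₂ rewrite eq = refl
    e₁ : insC O x (y ∷ ys) ≡ just (0 , insS O x (y ∷ ys))
    e₁ rewrite eq = refl
  ... | _ | tri≈ _ refl _ = dup e₁ (here refl) λ θ → I-≈ x θ ys
    where
    e₁ : insC O x (x ∷ ys) ≡ nothing
    e₁ rewrite eq = refl
  ... | dup e m z | tri> _ _ p = dup e₁ (there m) λ θ → trans (I-> θ ys p) (cong -_ (z _))
    where
    e₁ : insC O x (y ∷ ys) ≡ nothing
    e₁ rewrite eq | e = refl
  ... | new n e len z | tri> _ _ p = new (suc n) e₁ (trans (cong length e₂) (cong suc len)) λ θ →
      trans (I-> θ ys p) (trans (cong -_ (z (θ ∘ (y ∷_))))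
        (trans (ℤP.neg-distribˡ-* (sgn O n) _) (cong (λ l → - sgn O n * θ l) (sym e₂))))
    where
    e₂ : insS O x (y ∷ ys) ≡ y ∷ insS O x ys
    e₂ rewrite eq = refl
    e₁ : insC O x (y ∷ ys) ≡ just (suc n , insS O x (y ∷ ys))
    e₁ rewrite eq | e = refl

  ∈-insS⁻ : ∀ {z} x l → z ∈ insS O x l → z ≡ x ⊎ z ∈ l
  ∈-insS⁻ x [] (here e) = inj₁ e
  ∈-insS⁻ x (y ∷ ys) m with tri O x y
  ∈-insS⁻ x (y ∷ ys) (here e) | tri< _ _ _ = inj₁ e
  ∈-insS⁻ x (y ∷ ys) (there m) | tri< _ _ _ = inj₂ m
  ∈-insS⁻ x (y ∷ ys) m | tri≈ _ _ _ = inj₂ m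
  ∈-insS⁻ x (y ∷ ys) (here e) | tri> _ _ _ = inj₂ (here e)
  ∈-insS⁻ x (y ∷ ys) (there m) | tri> _ _ _ with ∈-insS⁻ x ys m
  ... | inj₁ e = inj₁ e
  ... | inj₂ k = inj₂ (there k)

  ∈-insS⁺-here : ∀ x l → x ∈ insS O x l
  ∈-insS⁺-here x [] = here refl
  ∈-insS⁺-here x (y ∷ ys) with tri O x y
  ... | tri< _ _ _ = here refl
  ... | tri≈ _ e _ = here e
  ... | tri> _ _ _ = there (∈-insS⁺-here x ys)

  ∈-insS⁺-there : ∀ {z} x l → z ∈ l → z ∈ insS O x l
  ∈-insS⁺-there x (y ∷ ys) m with tri O x y
  ... | tri< _ _ _ = there m
  ... | tri≈ _ e _ = m
  ∈-insS⁺-there x (y ∷ ys) (here e) | tri> _ _ _ = here e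
  ∈-insS⁺-there x (y ∷ ys) (there m) | tri> _ _ _ = there (∈-insS⁺-there x ys m)

  ∈-setOf⁻ : ∀ {z} l → z ∈ setOf O l → z ∈ l
  ∈-setOf⁻ (x ∷ l) m with ∈-insS⁻ x (setOf O l) m
  ... | inj₁ e = here e
  ... | inj₂ k = there (∈-setOf⁻ l k)

  ∈-setOf⁺ : ∀ {z} l → z ∈ l → z ∈ setOf O l
  ∈-setOf⁺ (x ∷ l) (here refl) = ∈-insS⁺-here x (setOf O l)
  ∈-setOf⁺ (x ∷ l) (there m) = ∈-insS⁺-there x (setOf O l) (∈-setOf⁺ l m)

  data SortView (l : List A) : Set where
    degenerate : sortC O l ≡ nothing → ¬ Unique l → (∀ θ → oF θ l ≡ + 0) → SortView l
    proper : ∀ n → sortC O l ≡ just (n , setOf O l) → length (setOf O l) ≡ length l →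
             (∀ θ → oF θ l ≡ sgn O n * θ (setOf O l)) → SortView l

  sortView : ∀ l → SortView l
  sortView [] = proper 0 refl refl (λ θ → sym (ℤP.*-identityˡ _))
  sortView (x ∷ l) with sortView l
  ... | degenerate e nu z = degenerate e₁ (λ { (_ ∷ u) → nu u }) λ θ → z (I x θ)
    where
    e₁ : sortC O (x ∷ l) ≡ nothing
    e₁ rewrite e = refl
  ... | proper n e len z with insView x (setOf O l)
  ...   | dup e' m z' = degenerate e₁ (λ { (a ∷ _) → All.lookup a (∈-setOf⁻ l m) refl })
            λ θ → trans (z (I x θ)) (trans (cong (sgn O n *_) (z' θ)) (ℤP.*-zeroʳ (sgn O n)))
    where
    e₁ : sortC O (x ∷ l) ≡ nothing
    e₁ rewrite e | e' = refl
  ...   | new m e' len' z' = proper (n ℕ.+ m) e₁ (trans len' (cong suc len)) λ θ →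
            trans (z (I x θ)) (trans (cong (sgn O n *_) (z' θ)) (trans (sym (ℤP.*-assoc (sgn O n) (sgn O m) _))
              (cong (_* θ (setOf O (x ∷ l))) (sym (sgn-+ n m)))))
    where
    e₁ : sortC O (x ∷ l) ≡ just (n ℕ.+ m , setOf O (x ∷ l))
    e₁ rewrite e | e' = refl

  oriented-oF : ∀ θ l → ⟨ θ , Chain.terms (oriented O l) ⟩ ≡ oF θ l
  oriented-oF θ l with sortView l
  ... | degenerate e _ z rewrite e = sym (z θ)
  ... | proper n e _ z rewrite e = trans (ℤP.+-identityʳ _) (sym (z θ))

  -- The transfer principle behind most later identities. Sorting multiplies both sides by the same
  -- sign, and both vanish on degenerate lists, so one sorted list decides; the equality of lengths
  -- records that `l` was not degenerate.
  altExt : ∀ {Φ Ψ} → Alt Φ → Alt Ψ → ∀ l →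
           (length (setOf O l) ≡ length l → Φ (setOf O l) ≡ Ψ (setOf O l)) → Φ l ≡ Ψ l
  altExt {Φ} {Ψ} a b l h with sortView l
  ... | degenerate _ _ z = trans (sym (oF-alt a l)) (trans (z Φ) (trans (sym (z Ψ)) (oF-alt b l)))
  ... | proper n _ len z = trans (sym (oF-alt a l)) (trans (z Φ) (trans (cong (sgn O n *_) (h len))
          (trans (sym (z Ψ)) (oF-alt b l))))

  Alt-0 : ∀ {Φ} → Alt Φ → ∀ l → (length (setOf O l) ≡ length l → Φ (setOf O l) ≡ + 0) → Φ l ≡ + 0
  Alt-0 a = altExt a (alt λ _ _ _ _ → refl)

  -- The sign is fixed before `Φ`, so that it can be cancelled between the values of different
  -- cochains at `l`.
  unitExt : ∀ l → Unique l → Σ ℤ λ e → IsUnit e × (∀ {Φ} → Alt Φ → Φ l ≡ e * Φ (setOf O l))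
  unitExt l u with sortView l
  ... | degenerate _ n _ = ⊥-elim (n u)
  ... | proper n _ _ z = sgn O n , sgn-unit n , λ {Φ} a → trans (sym (oF-alt a l)) (z Φ)

  length-setOf : ∀ l → Unique l → length (setOf O l) ≡ length l
  length-setOf l u with sortView l
  ... | degenerate _ n _ = ⊥-elim (n u)
  ... | proper _ _ len _ = len

  insS-sorted : ∀ x l → Sorted O l → Sorted O (insS O x l)
  insS-sorted x [] s = [-]
  insS-sorted x (y ∷ ys) s with tri O x y
  ... | tri< p _ _ = p ∷ s
  ... | tri≈ _ _ _ = s
  insS-sorted x (y ∷ []) s | tri> _ _ p = p ∷ [-]
  insS-sorted x (y ∷ z ∷ zs) (q ∷ s) | tri> _ _ p with insS-sorted x (z ∷ zs) s
  ... | r with tri O x z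
  ...   | tri< _ _ _ = p ∷ r
  ...   | tri≈ _ _ _ = q ∷ r
  ...   | tri> _ _ _ = q ∷ r

  setOf-sorted : ∀ l → Sorted O (setOf O l)
  setOf-sorted [] = []
  setOf-sorted (x ∷ l) = insS-sorted x _ (setOf-sorted l)

module Sorting (O : Ordered) (≺-trans : Transitive (_≺_ O)) where
  private
    A = Carrier O
    infix 4 _<ₒ_
    _<ₒ_ = _≺_ O
  open Order O public

  -- Inserting two vertices in either order gives the same list, with one more transposition in one
  -- of the orders. Transitivity fixes the order of `a` and `b` once they lie on opposite sides of
  -- `y`.
  I-anti : ∀ a b θ t → I b (I a θ) t ≡ - I a (I b θ) t
  I-anti a b θ [] = go (tri O a b)
    where
    go : Tri (a <ₒ b) (a ≡ b) (b <ₒ a) → I a θ (b ∷ []) ≡ - I b θ (a ∷ [])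
    go (tri< p _ _) = trans (I-< θ [] p) (sym (trans (cong -_ (I-> θ [] p)) (ℤP.neg-involutive _)))
    go (tri≈ _ refl _) = trans (I-≈ a θ []) (cong -_ (sym (I-≈ a θ [])))
    go (tri> _ _ p) = trans (I-> θ [] p) (cong -_ (sym (I-< θ [] p)))
  I-anti a b θ (y ∷ ys) = go (tri O a y) (tri O b y)
    where
    open ≡-Reasoning
    L = I b (I a θ) (y ∷ ys)
    R = I a (I b θ) (y ∷ ys)
    both : ∀ a b → a <ₒ y → b <ₒ y → a <ₒ b → I a θ (b ∷ y ∷ ys) ≡ - I b θ (a ∷ y ∷ ys)
    both a b pa pb p = trans (I-< θ (y ∷ ys) p)
      (sym (trans (cong -_ (I-> θ (y ∷ ys) p)) (trans (ℤP.neg-involutive _) (I-< (θ ∘ (a ∷_)) ys pb))))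
    mid : ∀ a b → y <ₒ a → b <ₒ y → I b (I a θ) (y ∷ ys) ≡ - I a (I b θ) (y ∷ ys)
    mid a b pa pb = begin
      I b (I a θ) (y ∷ ys)                    ≡⟨ I-< (I a θ) ys pb ⟩
      I a θ (b ∷ y ∷ ys)                      ≡⟨ I-> θ (y ∷ ys) (≺-trans pb pa) ⟩
      - I a (θ ∘ (b ∷_)) (y ∷ ys)             ≡⟨ cong -_ (I-> (θ ∘ (b ∷_)) ys pa) ⟩
      - - I a (λ t → θ (b ∷ y ∷ t)) ys        ≡⟨ cong (λ u → - - u) (I-cong a (λ t → sym (I-< θ t pb)) ys) ⟩
      - - I a (λ t → I b θ (y ∷ t)) ys        ≡⟨ cong -_ (sym (I-> (I b θ) ys pa)) ⟩
      - I a (I b θ) (y ∷ ys) ∎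
    flip : ∀ {u v} → u ≡ - v → v ≡ - u
    flip {u} {v} e = trans (sym (ℤP.neg-involutive v)) (cong -_ (sym e))
    go : Tri (a <ₒ y) (a ≡ y) (y <ₒ a) → Tri (b <ₒ y) (b ≡ y) (y <ₒ b) → L ≡ - R
    go (tri< pa _ _) (tri< pb _ _) = trans (I-< (I a θ) ys pb) (trans (case (tri O a b)) (cong -_ (sym (I-< (I b θ) ys pa))))
      where
      case : Tri (a <ₒ b) (a ≡ b) (b <ₒ a) → I a θ (b ∷ y ∷ ys) ≡ - I b θ (a ∷ y ∷ ys)
      case (tri< p _ _) = both a b pa pb p
      case (tri≈ _ refl _) = trans (I-≈ a θ _) (cong -_ (sym (I-≈ a θ _)))
      case (tri> _ _ p) = flip (both b a pb pa p)
    go (tri≈ _ refl _) (tri< pb _ _) = begin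
      L                                  ≡⟨ I-< (I a θ) ys pb ⟩
      I a θ (b ∷ a ∷ ys)                 ≡⟨ I-> θ (a ∷ ys) pb ⟩
      - I a (θ ∘ (b ∷_)) (a ∷ ys)        ≡⟨ cong -_ (I-≈ a (θ ∘ (b ∷_)) ys) ⟩
      + 0                                ≡⟨ cong -_ (sym (I-≈ a (I b θ) ys)) ⟩
      - R ∎
    go (tri> _ _ pa) (tri< pb _ _) = mid a b pa pb
    go (tri< pa _ _) (tri≈ _ refl _) = begin
      L                                  ≡⟨ I-≈ b (I a θ) ys ⟩
      + 0                                ≡⟨ sym (cong (λ u → - - u) (I-≈ b (θ ∘ (a ∷_)) ys)) ⟩
      - - I b (θ ∘ (a ∷_)) (b ∷ ys)      ≡⟨ cong -_ (sym (I-> θ (b ∷ ys) pa)) ⟩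
      - I b θ (a ∷ b ∷ ys)               ≡⟨ cong -_ (sym (I-< (I b θ) ys pa)) ⟩
      - R ∎
    go (tri≈ _ refl _) (tri≈ _ refl _) = trans (I-≈ a (I a θ) ys) (cong -_ (sym (I-≈ a (I a θ) ys)))
    go (tri> _ _ pa) (tri≈ _ refl _) = trans (I-≈ b (I a θ) ys) (cong -_ (sym (right b (I-≈ b θ) pa)))
      where
      right : ∀ z → (∀ t → I b θ (z ∷ t) ≡ + 0) → z <ₒ a → I a (I b θ) (z ∷ ys) ≡ + 0
      right z e p = trans (I-> (I b θ) ys p) (cong -_ (trans (I-cong a e ys) (I-0 a ys)))
    go (tri< pa _ _) (tri> _ _ pb) = flip (mid b a pb pa)
    go (tri≈ _ refl _) (tri> _ _ pb) = trans (I-> (I a θ) ys pb) (trans (cong -_ (trans (I-cong b (I-≈ a θ) ys) (I-0 b ys)))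
      (cong -_ (sym (I-≈ a (I b θ) ys))))
    go (tri> _ _ pa) (tri> _ _ pb) = begin
      L                                            ≡⟨ I-> (I a θ) ys pb ⟩
      - I b (λ t → I a θ (y ∷ t)) ys               ≡⟨ cong -_ (I-cong b (λ t → I-> θ t pa) ys) ⟩
      - I b (λ t → - I a (θ ∘ (y ∷_)) t) ys        ≡⟨ cong -_ (I-neg b (I a (θ ∘ (y ∷_))) ys) ⟩
      - - I b (I a (θ ∘ (y ∷_))) ys                ≡⟨ cong (λ u → - - u) (I-anti a b (θ ∘ (y ∷_)) ys) ⟩
      - - - I a (I b (θ ∘ (y ∷_))) ys              ≡⟨ cong (λ u → - - u) (sym (I-neg a (I b (θ ∘ (y ∷_))) ys)) ⟩
      - - I a (λ t → - I b (θ ∘ (y ∷_)) t) ys      ≡⟨ cong (λ u → - - u) (I-cong a (λ t → sym (I-> θ t pb)) ys) ⟩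
      - - I a (λ t → I b θ (y ∷ t)) ys             ≡⟨ cong -_ (sym (I-> (I b θ) ys pa)) ⟩
      - R ∎

  Alt-oF : ∀ θ → Alt (oF θ)
  Alt-oF θ = alt (go θ)
    where
    go : ∀ θ xs a b ys → oF θ (xs ++ a ∷ b ∷ ys) ≡ - oF θ (xs ++ b ∷ a ∷ ys)
    go θ [] a b ys = trans (oF-cong (I-anti a b θ) ys) (oF-neg (I a (I b θ)) ys)
    go θ (x ∷ xs) a b ys = go (I x θ) xs a b ys

  -- The dual basis cochain of the oriented simplex `s`: pairing with it reads off the coefficient
  -- of `s` with the orientation signs, even in a chain of unsorted lists.
  κ : List A → List A → ℤ
  κ s = oF (χ s)

  Alt-κ : ∀ s → Alt (κ s)
  Alt-κ s = Alt-oF (χ s)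

  κ-refl : ∀ {s} → Sorted O s → κ s s ≡ + 1
  κ-refl {s} p = trans (oF-sorted (χ s) s p) (χ-refl s)

  κ-≢ : ∀ {s} l → setOf O l ≢ s → κ s l ≡ + 0
  κ-≢ {s} l n with sortView l
  ... | degenerate _ _ z = z (χ s)
  ... | proper m _ _ z = trans (z (χ s)) (trans (cong (sgn O m *_) (χ-≢ n)) (ℤP.*-zeroʳ (sgn O m)))

  sorted-pairs : ∀ {l} → Sorted O l → AllPairs _<ₒ_ l
  sorted-pairs = Linked⇒AllPairs ≺-trans

  sorted-unique : ∀ {l} → Sorted O l → Unique l
  sorted-unique s = go (sorted-pairs s)
    where
    go : ∀ {l} → AllPairs _<ₒ_ l → Unique l
    go [] = []
    go (a ∷ p) = All.map ≺-≢ a ∷ go p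

  sorted-ext : ∀ {s t} → Sorted O s → Sorted O t → (∀ {x} → x ∈ s → x ∈ t) → (∀ {x} → x ∈ t → x ∈ s) → s ≡ t
  sorted-ext s t = go (sorted-pairs s) (sorted-pairs t)
    where
    go : ∀ {s t} → AllPairs _<ₒ_ s → AllPairs _<ₒ_ t → (∀ {x} → x ∈ s → x ∈ t) → (∀ {x} → x ∈ t → x ∈ s) → s ≡ t
    go [] [] f g = refl
    go [] (_ ∷ _) f g with g (here refl)
    ... | ()
    go (_ ∷ _) [] f g with f (here refl)
    ... | ()
    go {x ∷ s} {y ∷ t} (p ∷ ps) (q ∷ qs) f g = cong₂ _∷_ hd (go ps qs f' g')
      where
      hd : x ≡ y
      hd with f (here refl) | g (here refl)
      ... | here e | _ = e
      ... | there m | here e = sym e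
      ... | there m | there m' = ⊥-elim (≺-asym (All.lookup q m) (All.lookup p m'))
      f' : ∀ {z} → z ∈ s → z ∈ t
      f' m with f (there m)
      ... | here e = ⊥-elim (≺-≢ (All.lookup p m) (trans hd (sym e)))
      ... | there k = k
      g' : ∀ {z} → z ∈ t → z ∈ s
      g' m with g (there m)
      ... | here e = ⊥-elim (≺-≢ (All.lookup q m) (trans (sym hd) (sym e)))
      ... | there k = k

  setOf-ext : ∀ {l t} → Sorted O t → (∀ {x} → x ∈ l → x ∈ t) → (∀ {x} → x ∈ t → x ∈ l) → setOf O l ≡ t
  setOf-ext {l} s f g = sorted-ext (setOf-sorted l) s (f ∘ ∈-setOf⁻ l) (∈-setOf⁺ l ∘ g)

  setOf-id : ∀ {l} → Sorted O l → setOf O l ≡ l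
  setOf-id s = setOf-ext s id id

  setOf-≡ : ∀ {l l'} → (∀ {x} → x ∈ l → x ∈ l') → (∀ {x} → x ∈ l' → x ∈ l) → setOf O l ≡ setOf O l'
  setOf-≡ {l} {l'} f g = setOf-ext (setOf-sorted l') (∈-setOf⁺ l' ∘ f) (g ∘ ∈-setOf⁻ l')

  coeffL-κ : ∀ c s → Supp (Sorted O) c → coeffL O c s ≡ ⟨ κ s , c ⟩
  coeffL-κ c s p = trans (coeffL-χ c s) (⟨⟩-congS c p λ t q → sym (oF-sorted (χ s) t q))

map-setOf : (O O' : Ordered) → Transitive (_≺_ O') → (f : Carrier O → Carrier O') (l : List (Carrier O)) →
            setOf O' (map f (setOf O l)) ≡ setOf O' (map f l)
map-setOf O O' tr' f l = Sorting.setOf-≡ O' tr'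
  (λ m → let y , k , e = ∈-map⁻ f m in subst (_∈ map f l) (sym e) (∈-map⁺ f (Order.∈-setOf⁻ O l k)))
  (λ m → let y , k , e = ∈-map⁻ f m in subst (_∈ map f (setOf O l)) (sym e) (∈-map⁺ f (Order.∈-setOf⁺ O l k)))

Lex-trans : (O : Ordered) → Transitive (_≺_ O) → Transitive (Lex (_≺_ O))
Lex-trans O tr []< (here _) = []<
Lex-trans O tr []< (there _) = []<
Lex-trans O tr (here p) (here q) = here (tr p q)
Lex-trans O tr (here p) (there q) = here p
Lex-trans O tr (there p) (here q) = here q
Lex-trans O tr (there p) (there q) = there (Lex-trans O tr p q)

-- `Ordered` stores only trichotomy, so transitivity travels as a separate argument through all
-- levels of subdivision.
Lv-trans : ∀ k {O} → Transitive (_≺_ O) → Transitive (_≺_ (Lv k O))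
Lv-trans zero tr = tr
Lv-trans (suc k) {O} tr = Lex-trans (Lv k O) (Lv-trans k tr)

-- Divisibility, coefficients and traces

ones : {X : Set} → List X → FC X
ones [] = []
ones (x ∷ l) = (+ 1 , x) ∷ ones l

Supp-ones : {X : Set} {P : X → Set} {l : List X} → All P l → Supp P (ones l)
Supp-ones [] = []
Supp-ones (p ∷ ps) = p ∷ Supp-ones ps

Supp-∈ : {X : Set} (l : List X) → Supp (_∈ l) (ones l)
Supp-∈ l = Supp-ones (All.tabulate id)

-- With `n` equal to 0 divisibility becomes vanishing, so congruences and exact equalities can share
-- their lemmas.
record Div (n z : ℤ) : Set where
  constructor div
  field
    quotient : ℤ
    equality : z ≡ n * quotient

Div-+ : ∀ {n u v} → Div n u → Div n v → Div n (u + v)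
Div-+ {n} (div j refl) (div k refl) = div (j + k) (sym (ℤP.*-distribˡ-+ n j k))

Div-* : ∀ {n u} k → Div n u → Div n (k * u)
Div-* {n} k (div j refl) = div (k * j) (lem k n j)
  where
  lem : ∀ k n j → k * (n * j) ≡ n * (k * j)
  lem = solve-∀

Div-neg : ∀ {n u} → Div n u → Div n (- u)
Div-neg {n} (div j refl) = div (- j) (ℤP.neg-distribʳ-* n j)

Div-0 : ∀ {n} → Div n (+ 0)
Div-0 {n} = div (+ 0) (sym (ℤP.*-zeroʳ n))

Div-0⁻ : ∀ {u} → Div (+ 0) u → u ≡ + 0
Div-0⁻ (div k refl) = ℤP.*-zeroˡ k

Div-⟨⟩ : {X : Set} {P : X → Set} {n : ℤ} {φ : X → ℤ} (c : FC X) → Supp P c → (∀ x → P x → Div n (φ x)) →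
         Div n ⟨ φ , c ⟩
Div-⟨⟩ [] [] h = Div-0
Div-⟨⟩ ((a , x) ∷ c) (p ∷ ps) h = Div-+ (Div-* a (h x p)) (Div-⟨⟩ c ps h)

Alt-sum : {X A : Set} {θ : X → List A → ℤ} → (∀ x → Alt (θ x)) → (d : FC X) → Alt (λ l → ⟨ (λ x → θ x l) , d ⟩)
Alt-sum {θ = θ} a d = alt λ xs u v ys →
  trans (⟨⟩-cong d (λ x → swapped (a x) xs u v ys)) (⟨⟩-neg (λ x → θ x (xs ++ v ∷ u ∷ ys)) d)

-- The substitute for `T` being defined on oriented simplices: reordering the input changes the
-- output by the sign, as far as alternating cochains can tell.
AltPres : {A B : Set} → (List A → FC (List B)) → Set
AltPres T = ∀ {Φ} → Alt Φ → Alt (λ l → ⟨ Φ , T l ⟩)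

AltPres-ext : {A B C : Set} {T : List B → FC (List C)} {U : List A → FC (List B)} →
              AltPres T → AltPres U → AltPres (ext T ∘ U)
AltPres-ext {T = T} {U} t u {Φ} a = Alt-cong (λ l → sym (⟨⟩-ext Φ T (U l))) (u (t a))

Alt-map : {A B : Set} (f : A → B) {Φ : List B → ℤ} → Alt Φ → Alt (Φ ∘ map f)
Alt-map f {Φ} a = alt λ xs u v ys → trans (cong Φ (LP.map-++ f xs (u ∷ v ∷ ys)))
  (trans (swapped a (map f xs) (f u) (f v) (map f ys)) (cong (λ l → - Φ l) (sym (LP.map-++ f xs (v ∷ u ∷ ys)))))

module Bases (O : Ordered) (≺-trans : Transitive (_≺_ O)) where
  private
    A = Carrier O
  open Sorting O ≺-trans

  χ-expand : (φ : List A → ℤ) (B : List (List A)) → Unique B → ∀ {t} → t ∈ B →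
             ⟨ (λ s → χ s t * φ s) , ones B ⟩ ≡ φ t
  χ-expand φ (s ∷ B) (n ∷ u) (here refl) = begin
    + 1 * (χ s s * φ s) + ⟨ (λ s' → χ s' s * φ s') , ones B ⟩
      ≡⟨ cong₂ (λ x y → + 1 * (x * φ s) + y) (χ-refl s)
           (⟨⟩-0S (ones B) (Supp-ones n) λ x ne → trans (cong (_* φ x) (χ-≢ ne)) (ℤP.*-zeroˡ (φ x))) ⟩
    + 1 * (+ 1 * φ s) + + 0 ≡⟨ lem (φ s) ⟩
    φ s ∎
    where
    open ≡-Reasoning
    lem : ∀ u → + 1 * (+ 1 * u) + + 0 ≡ u
    lem = solve-∀
  χ-expand φ (s ∷ B) (n ∷ u) {t} (there m) = begin
    + 1 * (χ s t * φ s) + ⟨ (λ s' → χ s' t * φ s') , ones B ⟩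
      ≡⟨ cong₂ (λ x y → + 1 * (x * φ s) + y) (χ-≢ (λ e → All.lookup n m (sym e))) (χ-expand φ B u m) ⟩
    + 1 * (+ 0 * φ s) + φ t ≡⟨ lem (φ s) (φ t) ⟩
    φ t ∎
    where
    open ≡-Reasoning
    lem : ∀ u v → + 1 * (+ 0 * u) + v ≡ v
    lem = solve-∀

  -- Membership is demanded only of nondegenerate lists, because alternating cochains vanish on the
  -- others.
  InB : List (List A) → List A → Set
  InB B l = length (setOf O l) ≡ length l → setOf O l ∈ B

  -- Each `l` in the support can be expanded separately: both sides are alternating in `l`, so the
  -- expansion has to be checked only at members of `B`.
  expand : ∀ {Φ} → Alt Φ → (B : List (List A)) → Unique B → (c : FC (List A)) → Supp (InB B) c →
           ⟨ Φ , c ⟩ ≡ ⟨ (λ s → ⟨ κ s , c ⟩ * Φ s) , ones B ⟩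
  expand {Φ} a B u c sp = begin
    ⟨ Φ , c ⟩ ≡⟨ ⟨⟩-congS c sp (λ l i → altExt a Ψ-alt l λ len → at (setOf O l) (setOf-sorted l) (i len)) ⟩
    ⟨ (λ l → ⟨ (λ s → κ s l * Φ s) , ones B ⟩) , c ⟩ ≡⟨ ⟨⟩-swap (λ l s → κ s l * Φ s) c (ones B) ⟩
    ⟨ (λ s → ⟨ (λ l → κ s l * Φ s) , c ⟩) , ones B ⟩ ≡⟨ ⟨⟩-cong (ones B) (λ s → trans
        (⟨⟩-cong c (λ l → ℤP.*-comm (κ s l) (Φ s))) (trans (⟨⟩-* (Φ s) (κ s) c) (ℤP.*-comm (Φ s) _))) ⟩
    ⟨ (λ s → ⟨ κ s , c ⟩ * Φ s) , ones B ⟩ ∎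
    where
    open ≡-Reasoning
    Ψ-alt : Alt (λ l → ⟨ (λ s → κ s l * Φ s) , ones B ⟩)
    Ψ-alt = Alt-sum (λ s → Alt-cong (λ l → ℤP.*-comm (Φ s) (κ s l)) (Alt-* (Φ s) (Alt-κ s))) (ones B)
    at : ∀ t → Sorted O t → t ∈ B → Φ t ≡ ⟨ (λ s → κ s t * Φ s) , ones B ⟩
    at t p m = sym (trans (⟨⟩-cong (ones B) (λ s → cong (_* Φ s) (oF-sorted (χ s) t p))) (χ-expand Φ B u m))

  tr : List (List A) → (List A → FC (List A)) → ℤ
  tr B T = ⟨ (λ x → ⟨ κ x , T x ⟩) , ones B ⟩

  -- Expanding each composite in the intermediate basis gives the same double sum of products of
  -- matrix entries. The two bases differ because the application pairs adjacent degrees.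
  tr-cyclic : (B B' : List (List A)) → Unique B → Unique B' → (T U : List A → FC (List A)) →
              AltPres T → AltPres U → (∀ x → x ∈ B → Supp (InB B') (U x)) → (∀ y → y ∈ B' → Supp (InB B) (T y)) →
              tr B (ext T ∘ U) ≡ tr B' (ext U ∘ T)
  tr-cyclic B B' u u' T U at au sU sT = begin
    tr B (ext T ∘ U)
      ≡⟨ ⟨⟩-congS (ones B) (Supp-∈ B) (λ x m → trans (⟨⟩-ext (κ x) T (U x))
           (expand (at (Alt-κ x)) B' u' (U x) (sU x m))) ⟩
    ⟨ (λ x → ⟨ (λ y → ⟨ κ y , U x ⟩ * ⟨ κ x , T y ⟩) , ones B' ⟩) , ones B ⟩
      ≡⟨ ⟨⟩-swap (λ x y → ⟨ κ y , U x ⟩ * ⟨ κ x , T y ⟩) (ones B) (ones B') ⟩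
    ⟨ (λ y → ⟨ (λ x → ⟨ κ y , U x ⟩ * ⟨ κ x , T y ⟩) , ones B ⟩) , ones B' ⟩
      ≡⟨ ⟨⟩-congS (ones B') (Supp-∈ B') (λ y m → trans (⟨⟩-cong (ones B) (λ x → ℤP.*-comm ⟨ κ y , U x ⟩ ⟨ κ x , T y ⟩))
           (trans (sym (expand (au (Alt-κ y)) B u (T y) (sT y m))) (sym (⟨⟩-ext (κ y) U (T y))))) ⟩
    tr B' (ext U ∘ T) ∎
    where open ≡-Reasoning

  -- After equal terms are collected, the pairing is a combination of the coefficients of `c`; hence
  -- `φ` can be any function, alternating or not. The set of all lists occurring in `c` serves as
  -- the basis.
  coeffs-determine : ∀ n (φ : List A → ℤ) (c : FC (List A)) → (∀ s → Div n ⟨ χ s , c ⟩) → Div n ⟨ φ , c ⟩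
  coeffs-determine n φ c h = subst (Div n) (sym eq)
    (Div-⟨⟩ (ones B) (Supp-∈ B) λ s _ → subst (Div n) (ℤP.*-comm (φ s) _) (Div-* (φ s) (h s)))
    where
    open ≡-Reasoning
    module LO = Sorting (ListOrd O) (Lex-trans O ≺-trans)
    B = setOf (ListOrd O) (map proj₂ c)
    uB : Unique B
    uB = LO.sorted-unique (LO.setOf-sorted (map proj₂ c))
    sp : Supp (_∈ B) c
    sp = All.map (LO.∈-setOf⁺ (map proj₂ c)) (AllP.map⁻ (All.tabulate id))
    eq : ⟨ φ , c ⟩ ≡ ⟨ (λ s → ⟨ χ s , c ⟩ * φ s) , ones B ⟩
    eq = begin
      ⟨ φ , c ⟩ ≡⟨ ⟨⟩-congS c sp (λ t m → sym (χ-expand φ B uB m)) ⟩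
      ⟨ (λ t → ⟨ (λ s → χ s t * φ s) , ones B ⟩) , c ⟩ ≡⟨ ⟨⟩-swap (λ t s → χ s t * φ s) c (ones B) ⟩
      ⟨ (λ s → ⟨ (λ t → χ s t * φ s) , c ⟩) , ones B ⟩ ≡⟨ ⟨⟩-cong (ones B) (λ s → trans
        (⟨⟩-cong c (λ t → ℤP.*-comm (χ s t) (φ s))) (trans (⟨⟩-* (φ s) (χ s) c) (ℤP.*-comm (φ s) _))) ⟩
      ⟨ (λ s → ⟨ χ s , c ⟩ * φ s) , ones B ⟩ ∎

  ≈⇒⟨⟩ : (φ : List A → ℤ) (c d : FC (List A)) → (∀ s → coeffL O c s ≡ coeffL O d s) → ⟨ φ , c ⟩ ≡ ⟨ φ , d ⟩
  ≈⇒⟨⟩ φ c d h = ℤP.i-j≡0⇒i≡j ⟨ φ , c ⟩ ⟨ φ , d ⟩ (trans (sym (diff φ)) (Div-0⁻ (coeffs-determine (+ 0) φ (c ++ scale (- (+ 1)) d) λ s →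
    subst (Div (+ 0)) (sym (trans (diff (χ s)) (ℤP.i≡j⇒i-j≡0 (trans (sym (coeffL-χ c s)) (trans (h s) (coeffL-χ d s)))))) Div-0)))
    where
    diff : ∀ φ → ⟨ φ , c ++ scale (- (+ 1)) d ⟩ ≡ ⟨ φ , c ⟩ - ⟨ φ , d ⟩
    diff φ = trans (⟨⟩-++ φ c _) (+-congˡ ⟨ φ , c ⟩ (trans (⟨⟩-scale φ (- (+ 1)) d) (ℤP.-1*i≡-i _)))

-- Acyclic-carrier recursion: both the subdivision operator and its homotopy with a
-- vertex-choosing map cone off their values on the boundary.
module Carrier-recursion {A B : Set} (b : FC (List B)) (E : List A → FC (List B)) (sg : ℤ) (apex : List A → B) where

  -- The number is fuel, since recursion through `faces` is not structural. A face is one shorter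
  -- than its list, so `length l` is enough, and by `build-≡` more fuel changes nothing.
  build : ℕ → List A → FC (List B)
  build _ [] = b
  build zero (x ∷ l) = []
  build (suc n) (x ∷ l) = cone (apex (x ∷ l)) (E (x ∷ l) ++ scale sg (ext (build n) (faces (x ∷ l))))

  R : List A → FC (List B)
  R l = build (length l) l

  build-≡ : ∀ n m l → length l ≤ n → length l ≤ m → build n l ≡ build m l
  build-≡ _ _ [] _ _ = refl
  build-≡ (suc n) (suc m) (x ∷ l) (s≤s p) (s≤s q) = cong (λ c → cone (apex (x ∷ l)) (E (x ∷ l) ++ scale sg c))
    (ext-congS (faces (x ∷ l)) (faces-face (x ∷ l)) λ t (e , _) →
      build-≡ n m t (subst (_≤ n) (ℕP.suc-injective e) p) (subst (_≤ m) (ℕP.suc-injective e) q))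

  build-step : ∀ Φ n x l → ⟨ Φ , build (suc n) (x ∷ l) ⟩ ≡
    ⟨ Φ ∘ (apex (x ∷ l) ∷_) , E (x ∷ l) ⟩ + sg * δ (λ t → ⟨ Φ ∘ (apex (x ∷ l) ∷_) , build n t ⟩) (x ∷ l)
  build-step Φ n x l = begin
    ⟨ Φ , build (suc n) (x ∷ l) ⟩ ≡⟨ ⟨⟩-mapFC Φ (v ∷_) D ⟩
    ⟨ Φ ∘ (v ∷_) , E (x ∷ l) ++ scale sg (ext (build n) (faces (x ∷ l))) ⟩ ≡⟨ ⟨⟩-++ (Φ ∘ (v ∷_)) (E (x ∷ l)) _ ⟩
    ⟨ Φ ∘ (v ∷_) , E (x ∷ l) ⟩ + ⟨ Φ ∘ (v ∷_) , scale sg (ext (build n) (faces (x ∷ l))) ⟩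
      ≡⟨ +-congˡ ⟨ Φ ∘ (v ∷_) , E (x ∷ l) ⟩ (trans (⟨⟩-scale (Φ ∘ (v ∷_)) sg (ext (build n) (faces (x ∷ l))))
           (cong (sg *_) (⟨⟩-ext (Φ ∘ (v ∷_)) (build n) (faces (x ∷ l))))) ⟩
    ⟨ Φ ∘ (v ∷_) , E (x ∷ l) ⟩ + sg * δ (λ t → ⟨ Φ ∘ (v ∷_) , build n t ⟩) (x ∷ l) ∎
    where
    open ≡-Reasoning
    v = apex (x ∷ l)
    D = E (x ∷ l) ++ scale sg (ext (build n) (faces (x ∷ l)))

  R-step : ∀ Φ x l → ⟨ Φ , R (x ∷ l) ⟩ ≡
    ⟨ Φ ∘ (apex (x ∷ l) ∷_) , E (x ∷ l) ⟩ + sg * δ (λ t → ⟨ Φ ∘ (apex (x ∷ l) ∷_) , R t ⟩) (x ∷ l)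
  R-step Φ x l = trans (build-step Φ (length l) x l) (cong (λ z → ⟨ Φ ∘ (apex (x ∷ l) ∷_) , E (x ∷ l) ⟩ + sg * z)
    (⟨⟩-congS (faces (x ∷ l)) (faces-face (x ∷ l)) λ t (e , _) → cong (λ c → ⟨ Φ ∘ (apex (x ∷ l) ∷_) , c ⟩)
      (build-≡ (length l) (length t) t (ℕP.≤-reflexive (sym (ℕP.suc-injective e))) ℕP.≤-refl)))

  build-AltPres : AltPres E → (∀ xs a c ys → apex (xs ++ a ∷ c ∷ ys) ≡ apex (xs ++ c ∷ a ∷ ys)) →
                  ∀ n → AltPres (build n)
  build-AltPres aE sym-apex n {Φ} a = alt (go n a)
    where
    lem : ∀ s u v → - u + s * - v ≡ - (u + s * v)
    lem = solve-∀
    apex∷ : ∀ xs a ys → Σ _ λ x → Σ _ λ l → xs ++ a ∷ ys ≡ x ∷ l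
    apex∷ [] a ys = a , ys , refl
    apex∷ (x ∷ xs) a ys = x , xs ++ a ∷ ys , refl
    unfold : ∀ Φ n l → (Σ _ λ x → Σ _ λ l' → l ≡ x ∷ l') → ⟨ Φ , build (suc n) l ⟩ ≡
      ⟨ Φ ∘ (apex l ∷_) , E l ⟩ + sg * δ (λ t → ⟨ Φ ∘ (apex l ∷_) , build n t ⟩) l
    unfold Φ n l (x , l' , refl) = build-step Φ n x l'
    nil : ∀ Φ l → (Σ _ λ x → Σ _ λ l' → l ≡ x ∷ l') → ⟨ Φ , build zero l ⟩ ≡ + 0
    nil Φ l (x , l' , refl) = refl
    go : ∀ n {Φ} → Alt Φ → ∀ xs a c ys →
         ⟨ Φ , build n (xs ++ a ∷ c ∷ ys) ⟩ ≡ - ⟨ Φ , build n (xs ++ c ∷ a ∷ ys) ⟩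
    go zero {Φ} al xs a c ys = trans (nil Φ _ (apex∷ xs a (c ∷ ys))) (cong -_ (sym (nil Φ _ (apex∷ xs c (a ∷ ys)))))
    go (suc n) {Φ} al xs a c ys = begin
      ⟨ Φ , build (suc n) l ⟩ ≡⟨ unfold Φ n l (apex∷ xs a (c ∷ ys)) ⟩
      ⟨ Φ ∘ (apex l ∷_) , E l ⟩ + sg * δ (λ t → ⟨ Φ ∘ (apex l ∷_) , build n t ⟩) l
        ≡⟨ cong (λ v → ⟨ Φ ∘ (v ∷_) , E l ⟩ + sg * δ (λ t → ⟨ Φ ∘ (v ∷_) , build n t ⟩) l) (sym-apex xs a c ys) ⟩
      ⟨ Ψ , E l ⟩ + sg * δ (λ t → ⟨ Ψ , build n t ⟩) l
        ≡⟨ cong₂ (λ u v → u + sg * v) (swapped (aE Ψ-alt) xs a c ys) (swapped (Alt-δ (alt (go n Ψ-alt))) xs a c ys) ⟩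
      - ⟨ Ψ , E l' ⟩ + sg * - δ (λ t → ⟨ Ψ , build n t ⟩) l' ≡⟨ lem sg ⟨ Ψ , E l' ⟩ (δ (λ t → ⟨ Ψ , build n t ⟩) l') ⟩
      - (⟨ Ψ , E l' ⟩ + sg * δ (λ t → ⟨ Ψ , build n t ⟩) l') ≡⟨ cong -_ (sym (unfold Φ n l' (apex∷ xs c (a ∷ ys)))) ⟩
      - ⟨ Φ , build (suc n) l' ⟩ ∎
      where
      open ≡-Reasoning
      l = xs ++ a ∷ c ∷ ys
      l' = xs ++ c ∷ a ∷ ys
      Ψ = Φ ∘ (apex l' ∷_)
      Ψ-alt : Alt Ψ
      Ψ-alt = Alt-∷ al (apex l')

  R-AltPres : AltPres E → (∀ xs a c ys → apex (xs ++ a ∷ c ∷ ys) ≡ apex (xs ++ c ∷ a ∷ ys)) → AltPres R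
  R-AltPres aE sa {Φ} a = alt λ xs u v ys → trans (swapped (build-AltPres aE sa _ a) xs u v ys)
    (cong (λ n → - ⟨ Φ , build n (xs ++ v ∷ u ∷ ys) ⟩) (len xs u v ys))
    where
    len : ∀ (xs : List A) u v ys → length (xs ++ u ∷ v ∷ ys) ≡ length (xs ++ v ∷ u ∷ ys)
    len [] u v ys = refl
    len (x ∷ xs) u v ys = cong suc (len xs u v ys)

  R-Supp : (P : List A → Set) (Q : List A → List B → Set) →
           (∀ {l t} → FaceOf l t → P l → P t) → (P [] → Supp (Q []) b) →
           (∀ x l → P (x ∷ l) → Supp (λ w → Q (x ∷ l) (apex (x ∷ l) ∷ w)) (E (x ∷ l))) →
           (∀ {l t w} → P l → FaceOf l t → Q t w → Q l (apex l ∷ w)) →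
           ∀ l → P l → Supp (Q l) (R l)
  R-Supp P Q face base sE sR l p = go (length l) l p
    where
    go : ∀ n l → P l → Supp (Q l) (build n l)
    go _ [] p = base p
    go zero (x ∷ l) p = []
    go (suc n) (x ∷ l) p = Supp-mapFC (apex (x ∷ l) ∷_) _ (AllP.++⁺ (sE x l p) (Supp-scale sg _
      (Supp-ext (build n) (faces (x ∷ l)) (faces-face (x ∷ l)) λ t f →
        Supp-map (λ w q → sR p f q) (go n t (face f p))))) λ w q → q

-- Acyclic matchings and the contractions they induce

-- One step of a gradient path: `y` is a facet of `x ∪ {v}` through `v`, hence not `x`, and is again
-- the lower member of its pair.
record Descent {A : Set} (mate : List A → Maybe A) (y x : List A) : Set where
  constructor descent
  field
    {v w} : A
    mate-x : mate x ≡ just v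
    mate-y : mate y ≡ just w
    v∈y : v ∈ y
    y⊆ : ∀ {z} → z ∈ y → z ∈ v ∷ x
    same-length : length y ≡ length x

-- A perfect acyclic matching on K ∖ {top}, the empty simplex included; a lower simplex x is
-- matched with x ∪ {mate x}.
record Matching (O : Ordered) (K : List (Carrier O) → Set) : Set where
  private
    A = Carrier O
  field
    K-sorted : ∀ {x} → K x → Sorted O x
    K? : ∀ x → Dec (K x)
    K-down : ∀ {x y} → K x → Sorted O y → (∀ {z} → z ∈ y → z ∈ x) → K y
    K-finite : Σ (List (List A)) λ L → ∀ x → K x → x ∈ L
    top : List A
    K-top : K top
    K-bound : ∀ {x} → K x → length x ≤ length top
    mate : List A → Maybe A
    mate-top : mate top ≡ nothing
    mate-new : ∀ {x v} → mate x ≡ just v → v ∉ x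
    mate-K : ∀ {x v} → mate x ≡ just v → K x × K (setOf O (v ∷ x))
    mate-upper : ∀ {x v} → mate x ≡ just v → mate (setOf O (v ∷ x)) ≡ nothing
    mate-≢top : ∀ {x v} → mate x ≡ just v → setOf O (v ∷ x) ≢ top
    cover : ∀ {x} → K x → mate x ≡ nothing →
            x ≡ top ⊎ Σ A λ v → Σ (List A) λ y → mate y ≡ just v × x ≡ setOf O (v ∷ y)

    ◁-wf : ∀ x → Acc (Descent mate) x

-- The contraction below is computed with fuel; well-foundedness of descent enters as its being
-- eventually constant at each simplex.
Stab : {X : Set} → (ℕ → X) → Set
Stab {X} f = Σ ℕ λ N → Σ X λ a → ∀ n → N ≤ n → f n ≡ a

stab-const : {X : Set} (a : X) → Stab (λ _ → a)
stab-const a = 0 , a , λ _ _ → refl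

stab₂ : {X Y Z : Set} {f : ℕ → X} {g : ℕ → Y} (F : X → Y → Z) → Stab f → Stab g → Stab (λ n → F (f n) (g n))
stab₂ F (N , a , p) (M , b , q) = N ℕ.⊔ M , F a b , λ n le →
  cong₂ F (p n (ℕP.≤-trans (ℕP.m≤m⊔n N M) le)) (q n (ℕP.≤-trans (ℕP.m≤n⊔m N M) le))

stab-suc : {X : Set} {f : ℕ → X} → Stab (f ∘ suc) → Stab f
stab-suc {f = f} (N , a , p) = suc N , a , λ { (suc n) (s≤s le) → p n le }

stab-ext : {X Y : Set} (h : ℕ → X → FC Y) (c : FC X) → Supp (λ x → Stab (λ n → h n x)) c → Stab (λ n → ext (h n) c)
stab-ext h [] [] = stab-const []
stab-ext h ((a , x) ∷ c) (p ∷ ps) = stab₂ (λ u v → scale a u ++ v) p (stab-ext h c ps)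

module Contraction (O : Ordered) (≺-trans : Transitive (_≺_ O)) (K : List (Carrier O) → Set) (M : Matching O K) where
  private
    A = Carrier O
  open Sorting O ≺-trans
  open Bases O ≺-trans
  open Matching M

  K̃ : List A → Set
  K̃ l = K (setOf O l)

  mutual
    -- The recursion is `s x = v x + s (x - ∂ (v x))`. Here `x - ∂ (v x) = v ∂ x` consists of the
    -- next simplices on gradient paths from `x` and of unmated ones, on which `s` is 0.
    s : ℕ → List A → FC (List A)
    s zero x = []
    s (suc n) x = sM n x (mate x)

    sM : ℕ → List A → Maybe A → FC (List A)
    sM n x nothing = []
    sM n x (just v) = (+ 1 , v ∷ x) ∷ ext (s̃ n) (cone v (faces x))

    s̃ : ℕ → List A → FC (List A)
    s̃ n l = ext (s n) (Chain.terms (oriented O l))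

  s-nothing : ∀ n x → mate x ≡ nothing → s n x ≡ []
  s-nothing zero x e = refl
  s-nothing (suc n) x e rewrite e = refl

  s-stab : ∀ x → Acc (Descent mate) x → Stab (λ n → s n x)
  s-stab x (acc rs) = stab-suc (go (mate x) refl)
    where
    go : ∀ m → mate x ≡ m → Stab (λ n → sM n x m)
    go nothing e = stab-const []
    go (just v) e = stab₂ (λ u w → u ∷ w) (stab-const (+ 1 , v ∷ x)) (stab-ext s̃ (cone v (faces x))
      (Supp-mapFC (v ∷_) (faces x) (faces-face x) λ t f → term t f))
      where
      term : ∀ t → FaceOf x t → Stab (λ n → s̃ n (v ∷ t))
      term t (len , sub) with sortView (v ∷ t)
      ... | degenerate e' _ _ rewrite e' = stab-const []
      ... | proper k e' len' _ rewrite e' = stab₂ (λ u w → scale (sgn O k) u ++ w) (below (mate t') refl) (stab-const [])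
        where
        t' = setOf O (v ∷ t)
        below : ∀ m → mate t' ≡ m → Stab (λ n → s n t')
        below nothing e'' = 0 , [] , λ n _ → s-nothing n t' e''
        below (just w) e'' = s-stab t' (rs (descent e e'' (∈-setOf⁺ (v ∷ t) (here refl)) sub' (trans len' (sym len))))
          where
          sub' : ∀ {z} → z ∈ t' → z ∈ v ∷ x
          sub' m with ∈-setOf⁻ (v ∷ t) m
          ... | here q = here q
          ... | there q = there (sub q)

  -- Finiteness of the complex turns stabilisation at each simplex into one amount of fuel good for
  -- all.
  bounded : (L : List (List A)) → Σ ℕ λ N → ∀ {x} → x ∈ L → ∀ n → N ≤ n → s n x ≡ s N x
  bounded [] = 0 , λ ()
  bounded (x ∷ L) with bounded L | s-stab x (◁-wf x)
  ... | N , p | N' , a , q = N ℕ.⊔ N' , λ where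
    (here refl) n le → trans (q n (ℕP.≤-trans (ℕP.m≤n⊔m N N') le)) (sym (q _ (ℕP.m≤n⊔m N N')))
    (there m) n le → trans (p m n (ℕP.≤-trans (ℕP.m≤m⊔n N N') le)) (sym (p m _ (ℕP.m≤m⊔n N N')))

  fuel : ℕ
  fuel = proj₁ (bounded (proj₁ K-finite))

  σ* : (List A → ℤ) → List A → ℤ
  σ* Φ x = ⟨ Φ , s fuel x ⟩

  -- The transpose of the contraction, extended to unsorted lists as an alternating cochain.
  S : (List A → ℤ) → List A → ℤ
  S Φ = oF (σ* Φ)

  s̃-S : ∀ Φ n l → ⟨ Φ , s̃ n l ⟩ ≡ oF (λ t → ⟨ Φ , s n t ⟩) l
  s̃-S Φ n l = trans (⟨⟩-ext Φ (s n) (Chain.terms (oriented O l))) (oriented-oF _ l)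

  S-sorted : ∀ Φ {t} → Sorted O t → S Φ t ≡ σ* Φ t
  S-sorted Φ p = oF-sorted (σ* Φ) _ p

  Alt-S : ∀ Φ → Alt (S Φ)
  Alt-S Φ = Alt-oF (σ* Φ)

  σ*-nothing : ∀ Φ x → mate x ≡ nothing → σ* Φ x ≡ + 0
  σ*-nothing Φ x e rewrite s-nothing fuel x e = refl

  σ*-lower : ∀ Φ {x v} → mate x ≡ just v → σ* Φ x ≡ Φ (v ∷ x) + δ (S Φ ∘ (v ∷_)) x
  σ*-lower Φ {x} {v} e = begin
    ⟨ Φ , s fuel x ⟩ ≡⟨ cong (λ c → ⟨ Φ , c ⟩) (sym (proj₂ (bounded (proj₁ K-finite))
                          (proj₂ K-finite x (proj₁ (mate-K e))) (suc fuel) (ℕP.n≤1+n fuel))) ⟩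
    ⟨ Φ , sM fuel x (mate x) ⟩ ≡⟨ cong (λ m → ⟨ Φ , sM fuel x m ⟩) e ⟩
    + 1 * Φ (v ∷ x) + ⟨ Φ , ext (s̃ fuel) (cone v (faces x)) ⟩
      ≡⟨ cong₂ _+_ (ℤP.*-identityˡ (Φ (v ∷ x))) (trans (⟨⟩-ext Φ (s̃ fuel) (cone v (faces x)))
           (trans (⟨⟩-mapFC (λ l → ⟨ Φ , s̃ fuel l ⟩) (v ∷_) (faces x))
             (⟨⟩-cong (faces x) (λ t → s̃-S Φ fuel (v ∷ t))))) ⟩
    Φ (v ∷ x) + δ (S Φ ∘ (v ∷_)) x ∎
    where open ≡-Reasoning

  -- A cycle because `∂ s` is the identity on the cycle `∂ top`. The correction by `s` never
  -- contains `top`, so the coefficient there remains 1.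
  η : FC (List A)
  η = single top ++ scale (- (+ 1)) (ext (s̃ fuel) (faces top))

  η-eval : ∀ Φ → ⟨ Φ , η ⟩ ≡ Φ top - δ (S Φ) top
  η-eval Φ = trans (⟨⟩-++ Φ (single top) (scale (- (+ 1)) (ext (s̃ fuel) (faces top))))
    (cong₂ _+_ (⟨⟩-single Φ top) (trans (⟨⟩-scale Φ (- (+ 1)) (ext (s̃ fuel) (faces top)))
      (trans (ℤP.-1*i≡-i _) (cong -_ (trans (⟨⟩-ext Φ (s̃ fuel) (faces top)) (⟨⟩-cong (faces top) (s̃-S Φ fuel)))))))

  just≢nothing : ∀ {x v} → mate x ≡ just v → x ≢ top
  just≢nothing e refl with trans (sym e) mate-top
  ... | ()

  mate-unique : ∀ {x v} → mate x ≡ just v → Unique (v ∷ x)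
  mate-unique {x} {v} e = All.tabulate (λ m e' → mate-new e (subst (_∈ x) (sym e') m)) ∷ sorted-unique (K-sorted (proj₁ (mate-K e)))

  mate-length : ∀ {x v} → mate x ≡ just v → suc (length x) ≤ length top
  mate-length {x} {v} e = subst (_≤ length top) (length-setOf (v ∷ x) (mate-unique e)) (K-bound (proj₂ (mate-K e)))

  -- In terms of chains: `∂ s x + s ∂ x + (coefficient of top in x) η = x`.
  H : List A → Set
  H x = ∀ {Φ} → Alt Φ → σ* (δ Φ) x + δ (S Φ) x + χ top x * ⟨ Φ , η ⟩ ≡ Φ x

  H-unmated : ∀ x → K x → mate x ≡ nothing → H x
  H-unmated x k e {Φ} a with cover k e
  ... | inj₁ refl = begin
    σ* (δ Φ) x + δ (S Φ) x + χ x x * ⟨ Φ , η ⟩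
      ≡⟨ cong₂ (λ u v → u + δ (S Φ) x + v) (σ*-nothing (δ Φ) x e) (cong₂ _*_ (χ-refl x) (η-eval Φ)) ⟩
    + 0 + δ (S Φ) x + + 1 * (Φ x - δ (S Φ) x) ≡⟨ lem (δ (S Φ) x) (Φ x) ⟩
    Φ x ∎
    where
    open ≡-Reasoning
    lem : ∀ u v → + 0 + u + + 1 * (v - u) ≡ v
    lem = solve-∀
  ... | inj₂ (v , y , ey , refl) = begin
    σ* (δ Φ) x + δ (S Φ) x + χ top x * ⟨ Φ , η ⟩
      ≡⟨ cong₂ (λ u w → u + δ (S Φ) x + w * ⟨ Φ , η ⟩) (σ*-nothing (δ Φ) x e) (χ-≢ (mate-≢top ey)) ⟩
    + 0 + δ (S Φ) x + + 0 * ⟨ Φ , η ⟩ ≡⟨ lem (δ (S Φ) x) ⟨ Φ , η ⟩ ⟩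
    δ (S Φ) x ≡⟨ unit-cancel (proj₁ (proj₂ ue)) (trans (sym (proj₂ (proj₂ ue) (Alt-δ (Alt-S Φ))))
                   (trans atvy (proj₂ (proj₂ ue) a))) ⟩
    Φ x ∎
    where
    open ≡-Reasoning
    lem : ∀ u v → + 0 + u + + 0 * v ≡ u
    lem = solve-∀
    lem' : ∀ u v → u + v - v ≡ u
    lem' = solve-∀
    ue = unitExt (v ∷ y) (mate-unique ey)
    atvy : δ (S Φ) (v ∷ y) ≡ Φ (v ∷ y)
    atvy = begin
      δ (S Φ) (v ∷ y) ≡⟨ δ-∷ (S Φ) v y ⟩
      S Φ y - δ (S Φ ∘ (v ∷_)) y
        ≡⟨ cong (λ u → u - δ (S Φ ∘ (v ∷_)) y) (trans (S-sorted Φ (K-sorted (proj₁ (mate-K ey)))) (σ*-lower Φ ey)) ⟩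
      Φ (v ∷ y) + δ (S Φ ∘ (v ∷_)) y - δ (S Φ ∘ (v ∷_)) y ≡⟨ lem' (Φ (v ∷ y)) (δ (S Φ ∘ (v ∷_)) y) ⟩
      Φ (v ∷ y) ∎

  H-extend : ∀ {Φ} → Alt Φ → ∀ l → (length (setOf O l) ≡ length l → H (setOf O l)) →
             S (δ Φ) l + δ (S Φ) l + κ top l * ⟨ Φ , η ⟩ ≡ Φ l
  H-extend {Φ} a l h = altExt
    (Alt-+ (Alt-+ (Alt-S (δ Φ)) (Alt-δ (Alt-S Φ))) (Alt-cong (λ t → ℤP.*-comm ⟨ Φ , η ⟩ (κ top t)) (Alt-* ⟨ Φ , η ⟩ (Alt-κ top))))
    a l λ len → trans (cong₂ (λ u v → u + δ (S Φ) (setOf O l) + v * ⟨ Φ , η ⟩)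
      (S-sorted (δ Φ) (setOf-sorted l)) (oF-sorted (χ top) _ (setOf-sorted l))) (h len a)

  -- Below the size of `top` the `η` term is 0, so the inductive step never has to carry it.
  H-short : ∀ {Φ} → Alt Φ → ∀ l → length l < length top → (length (setOf O l) ≡ length l → H (setOf O l)) →
            S (δ Φ) l + δ (S Φ) l ≡ Φ l
  H-short {Φ} a l lt h = trans (sym (trans (+-congˡ (S (δ Φ) l + δ (S Φ) l)
      (cong (_* ⟨ Φ , η ⟩) κ0)) (lem (S (δ Φ) l + δ (S Φ) l) ⟨ Φ , η ⟩))) (H-extend a l h)
    where
    lem : ∀ u v → u + + 0 * v ≡ u
    lem = solve-∀
    κ0 : κ top l ≡ + 0
    κ0 = Alt-0 (Alt-κ top) l λ len → κ-≢ {top} (setOf O l) λ e → ℕP.<-irrefl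
      (trans (sym len) (cong length (trans (sym (setOf-id (setOf-sorted l))) e))) lt

  -- For lower `x`, `∂ s x = ∂ (v x) + ∂ s (v ∂ x)`. Induction applies to the terms of `v ∂ x` and
  -- leaves `s ∂ (v ∂ x)`, which is `s ∂ x` because `v ∂ x = x - ∂ (v x)`.
  H-acc : ∀ x → Acc (Descent mate) x → K x → H x
  H-acc x (acc rs) k = go (mate x) refl
    where
    go : ∀ m → mate x ≡ m → H x
    go nothing e = H-unmated x k e
    go (just v) e {Φ} a = begin
      σ* (δ Φ) x + δ (S Φ) x + χ top x * ⟨ Φ , η ⟩
        ≡⟨ cong₂ (λ u w → u + δ (S Φ) x + w * ⟨ Φ , η ⟩) (σ*-lower (δ Φ) e) (χ-≢ (just≢nothing e)) ⟩
      δ Φ (v ∷ x) + δ (S (δ Φ) ∘ (v ∷_)) x + δ (S Φ) x + + 0 * ⟨ Φ , η ⟩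
        ≡⟨ cong₂ (λ u w → u + w + δ (S Φ) x + + 0 * ⟨ Φ , η ⟩) (δ-∷ Φ v x) inner ⟩
      Φ x - δ (Φ ∘ (v ∷_)) x + (δ (Φ ∘ (v ∷_)) x - δ (δ (S Φ) ∘ (v ∷_)) x) + δ (S Φ) x + + 0 * ⟨ Φ , η ⟩
        ≡⟨ cong (λ u → Φ x - δ (Φ ∘ (v ∷_)) x + (δ (Φ ∘ (v ∷_)) x - u) + δ (S Φ) x + + 0 * ⟨ Φ , η ⟩) outer ⟩
      Φ x - δ (Φ ∘ (v ∷_)) x + (δ (Φ ∘ (v ∷_)) x - δ (S Φ) x) + δ (S Φ) x + + 0 * ⟨ Φ , η ⟩
        ≡⟨ lem (Φ x) (δ (Φ ∘ (v ∷_)) x) (δ (S Φ) x) ⟨ Φ , η ⟩ ⟩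
      Φ x ∎
      where
      open ≡-Reasoning
      lem : ∀ u v w z → u - v + (v - w) + w + + 0 * z ≡ u
      lem = solve-∀
      lem₁ : ∀ u v → u ≡ u + v - v
      lem₁ = solve-∀
      lem₂ : ∀ u v → v ≡ u - (u - v)
      lem₂ = solve-∀
      lem₃ : ∀ u → u - + 0 ≡ u
      lem₃ = solve-∀
      outer : δ (δ (S Φ) ∘ (v ∷_)) x ≡ δ (S Φ) x
      outer = trans (lem₂ (δ (S Φ) x) _) (trans (cong (λ u → δ (S Φ) x - u)
        (trans (sym (δ-∷ (δ (S Φ)) v x)) (δδ (S Φ) (v ∷ x)))) (lem₃ (δ (S Φ) x)))
      term : ∀ t → FaceOf x t → S (δ Φ) (v ∷ t) + δ (S Φ) (v ∷ t) ≡ Φ (v ∷ t)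
      term t (len , sub) = H-short a (v ∷ t) (subst (_< length top) len (mate-length e)) λ len' → at len' (mate t') refl
        where
        t' = setOf O (v ∷ t)
        sub' : ∀ {z} → z ∈ t' → z ∈ v ∷ x
        sub' m with ∈-setOf⁻ (v ∷ t) m
        ... | here q = here q
        ... | there q = there (sub q)
        kt' : K t'
        kt' = K-down (proj₂ (mate-K e)) (setOf-sorted (v ∷ t)) λ m → ∈-setOf⁺ (v ∷ x) (sub' m)
        at : length t' ≡ suc (length t) → ∀ m → mate t' ≡ m → H t'
        at len' nothing e' = H-unmated t' kt' e'
        at len' (just w) e' = H-acc t' (rs (descent e e' (∈-setOf⁺ (v ∷ t) (here refl)) sub' (trans len' (sym len)))) kt'
      inner : δ (S (δ Φ) ∘ (v ∷_)) x ≡ δ (Φ ∘ (v ∷_)) x - δ (δ (S Φ) ∘ (v ∷_)) x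
      inner = trans (⟨⟩-congS (faces x) (faces-face x) λ t f → trans (lem₁ (S (δ Φ) (v ∷ t)) (δ (S Φ) (v ∷ t)))
        (cong (λ u → u - δ (S Φ) (v ∷ t)) (term t f))) (⟨⟩-- (Φ ∘ (v ∷_)) (δ (S Φ) ∘ (v ∷_)) (faces x))

  homotopy : ∀ {Φ} → Alt Φ → ∀ l → K̃ l → S (δ Φ) l + δ (S Φ) l + κ top l * ⟨ Φ , η ⟩ ≡ Φ l
  homotopy a l k = H-extend a l λ _ → H-acc _ (◁-wf _) k

  K̃-face : ∀ {l t} → FaceOf l t → K̃ l → K̃ t
  K̃-face {l} {t} (_ , sub) k = K-down k (setOf-sorted t) λ m → ∈-setOf⁺ l (sub (∈-setOf⁻ t m))

  InK : ℕ → List A → Set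
  InK q l = K̃ l × length l ≡ q

  oriented-Supp : ∀ {q} l → length l ≡ q → Supp (λ t → length t ≡ q) (Chain.terms (oriented O l))
  oriented-Supp l e with sortView l
  ... | degenerate e' _ _ rewrite e' = []
  ... | proper n e' len _ rewrite e' = trans len e ∷ []

  mutual
    s-Supp : ∀ n {q} x → length x ≡ q → Supp (InK (suc q)) (s n x)
    s-Supp zero x e = []
    s-Supp (suc n) x e = sM-Supp n x e (mate x) refl

    sM-Supp : ∀ n {q} x → length x ≡ q → ∀ m → mate x ≡ m → Supp (InK (suc q)) (sM n x m)
    sM-Supp n x e nothing e' = []
    sM-Supp n x e (just v) e' = (proj₂ (mate-K e') , cong suc e) ∷ Supp-ext (s̃ n) _
      (Supp-mapFC (v ∷_) (faces x) (faces-face x) λ t f → trans (sym (proj₁ f)) e) λ l e'' → s̃-Supp n l e''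

    s̃-Supp : ∀ n {q} l → length l ≡ q → Supp (InK (suc q)) (s̃ n l)
    s̃-Supp n l e = Supp-ext (s n) _ (oriented-Supp l e) λ t e' → s-Supp n t e'

  mutual
    -- All terms produced by `s` have the form `v x` for a matched pair, and `top` is not an upper
    -- member of one.
    κtop-s : ∀ n x → ⟨ κ top , s n x ⟩ ≡ + 0
    κtop-s zero x = refl
    κtop-s (suc n) x = κtop-sM n x (mate x) refl

    κtop-sM : ∀ n x m → mate x ≡ m → ⟨ κ top , sM n x m ⟩ ≡ + 0
    κtop-sM n x nothing e = refl
    κtop-sM n x (just v) e = cong₂ (λ u w → + 1 * u + w) (κ-≢ (v ∷ x) (mate-≢top e))
      (trans (⟨⟩-ext (κ top) (s̃ n) c) (trans (⟨⟩-cong c (κtop-s̃ n)) (⟨⟩-0 c)))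
      where
      c = cone v (faces x)

    κtop-s̃ : ∀ n l → ⟨ κ top , s̃ n l ⟩ ≡ + 0
    κtop-s̃ n l = trans (⟨⟩-ext (κ top) (s n) c) (trans (⟨⟩-cong c (κtop-s n)) (⟨⟩-0 c))
      where
      c = Chain.terms (oriented O l)

  homotopy-op : List A → FC (List A)
  homotopy-op = s̃ fuel

  homotopy-op-AltPres : AltPres homotopy-op
  homotopy-op-AltPres {Φ} _ = Alt-cong (λ l → sym (s̃-S Φ fuel l)) (Alt-S Φ)

  κtop-η : ⟨ κ top , η ⟩ ≡ + 1
  κtop-η = trans (η-eval (κ top)) (cong₂ (λ u v → u - v) (κ-refl (K-sorted K-top))
    (trans (⟨⟩-cong (faces top) (λ t → trans (sym (s̃-S (κ top) fuel t)) (κtop-s̃ fuel t))) (⟨⟩-0 (faces top))))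

  K̃-id : ∀ {x} → K x → K̃ x
  K̃-id k = subst K (sym (setOf-id (K-sorted k))) k

  δη : ∀ {Φ} → Alt Φ → ⟨ δ Φ , η ⟩ ≡ + 0
  δη {Φ} a = begin
    ⟨ δ Φ , η ⟩ ≡⟨ η-eval (δ Φ) ⟩
    δ Φ top - δ (S (δ Φ)) top ≡⟨ cong (λ u → δ Φ top - u) (trans
      (⟨⟩-congS (faces top) (faces-face top) λ t f → trans (lem (S (δ Φ) t) (δ (S Φ) t))
        (cong (λ u → u - δ (S Φ) t) (H-short a t (ℕP.≤-reflexive (sym (proj₁ f)))
          λ _ → H-acc _ (◁-wf _) (K̃-face f (K̃-id K-top)))))
      (trans (⟨⟩-- Φ (δ (S Φ)) (faces top)) (cong (λ u → δ Φ top - u) (δδ (S Φ) top)))) ⟩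
    δ Φ top - (δ Φ top - + 0) ≡⟨ lem' (δ Φ top) ⟩
    + 0 ∎
    where
    open ≡-Reasoning
    lem : ∀ u v → u ≡ u + v - v
    lem = solve-∀
    lem' : ∀ u → u - (u - + 0) ≡ + 0
    lem' = solve-∀

  η-Supp : Supp (InK (length top)) η
  η-Supp = (K̃-id K-top , refl) ∷ Supp-scale (- (+ 1)) (ext (s̃ fuel) (faces top)) (go (length top) refl)
    where
    go : ∀ n → length top ≡ n → Supp (InK n) (ext (s̃ fuel) (faces top))
    go n e = Supp-ext (s̃ fuel) (faces top) (faces-face top) λ t f →
      subst (λ q → Supp (InK q) (s̃ fuel t)) (trans (sym (proj₁ f)) e) (s̃-Supp fuel t refl)

  -- Apply the homotopy to `z`: the `∂ s` term vanishes because `s z` would lie above the top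
  -- dimension, and the `s ∂` term because `z` is a cycle.
  top-cycle : (z : FC (List A)) → Supp (InK (length top)) z → (∀ {Φ} → Alt Φ → ⟨ δ Φ , z ⟩ ≡ + 0) →
              ∀ {Φ} → Alt Φ → ⟨ Φ , z ⟩ ≡ ⟨ κ top , z ⟩ * ⟨ Φ , η ⟩
  top-cycle z sp cyc {Φ} a = begin
    ⟨ Φ , z ⟩ ≡⟨ ⟨⟩-congS z sp (λ l (k , e) → sym (trans
        (cong (λ u → u + δ (S Φ) l + κ top l * ⟨ Φ , η ⟩) (above l e)) (homotopy a l k))) ⟩
    ⟨ (λ l → + 0 + δ (S Φ) l + κ top l * ⟨ Φ , η ⟩) , z ⟩ ≡⟨ ⟨⟩-+ (λ l → + 0 + δ (S Φ) l) (λ l → κ top l * ⟨ Φ , η ⟩) z ⟩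
    ⟨ (λ l → + 0 + δ (S Φ) l) , z ⟩ + ⟨ (λ l → κ top l * ⟨ Φ , η ⟩) , z ⟩
      ≡⟨ cong₂ _+_ (trans (⟨⟩-cong z (λ l → ℤP.+-identityˡ _)) (cyc (Alt-S Φ)))
           (trans (⟨⟩-cong z (λ l → ℤP.*-comm (κ top l) ⟨ Φ , η ⟩)) (trans (⟨⟩-* ⟨ Φ , η ⟩ (κ top) z) (ℤP.*-comm ⟨ Φ , η ⟩ _))) ⟩
    + 0 + ⟨ κ top , z ⟩ * ⟨ Φ , η ⟩ ≡⟨ ℤP.+-identityˡ _ ⟩
    ⟨ κ top , z ⟩ * ⟨ Φ , η ⟩ ∎
    where
    open ≡-Reasoning
    above : ∀ l → length l ≡ length top → + 0 ≡ S (δ Φ) l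
    above l e = sym (trans (sym (s̃-S (δ Φ) fuel l)) (⟨⟩-0S (s̃ fuel l) (s̃-Supp fuel l e) λ t (k , e') →
      Alt-0 (Alt-δ a) t λ len → ⊥-elim (ℕP.<-irrefl refl (subst (_≤ length top) (trans len e') (K-bound k)))))

-- Traces and free actions

iter-+ : {A : Set} (f : A → A) (m n : ℕ) (x : A) → iter f (m ℕ.+ n) x ≡ iter f m (iter f n x)
iter-+ f zero n x = refl
iter-+ f (suc m) n x = cong f (iter-+ f m n x)

iter-suc : {A : Set} (f : A → A) (n : ℕ) (x : A) → iter f n (f x) ≡ f (iter f n x)
iter-suc f zero x = refl
iter-suc f (suc n) x = cong f (iter-suc f n x)

module _ {X : Set} (a : X → ℤ) where

  sum-↭ : ∀ {L L'} → L ↭ L' → ⟨ a , ones L ⟩ ≡ ⟨ a , ones L' ⟩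
  sum-↭ Perm.refl = refl
  sum-↭ (Perm.prep x p) = +-congˡ (+ 1 * a x) (sum-↭ p)
  sum-↭ (Perm.swap {xs} {ys} x y p) = trans (+-congˡ (+ 1 * a x) (+-congˡ (+ 1 * a y) (sum-↭ p)))
    (lem (+ 1 * a x) (+ 1 * a y) ⟨ a , ones ys ⟩)
    where
    lem : ∀ u v w → u + (v + w) ≡ v + (u + w)
    lem = solve-∀
  sum-↭ (Perm.trans p q) = trans (sum-↭ p) (sum-↭ q)

  sum-same : ∀ {L L'} → Unique L → Unique L' → (∀ {x} → x ∈ L → x ∈ L') → (∀ {x} → x ∈ L' → x ∈ L) →
             ⟨ a , ones L ⟩ ≡ ⟨ a , ones L' ⟩
  sum-same u u' f g = sum-↭ (∼bag⇒↭ (unique∧set⇒bag u u' (mk⇔ f g)))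

  sum-filter : {P : X → Set} (P? : ∀ x → Dec (P x)) (L : List X) →
               ⟨ a , ones L ⟩ ≡ ⟨ a , ones (filter P? L) ⟩ + ⟨ a , ones (filter (¬? ∘ P?) L) ⟩
  sum-filter P? [] = refl
  sum-filter P? (x ∷ L) with P? x
  ... | yes _ = trans (+-congˡ (+ 1 * a x) (sum-filter P? L))
    (sym (ℤP.+-assoc (+ 1 * a x) ⟨ a , ones (filter P? L) ⟩ ⟨ a , ones (filter (¬? ∘ P?) L) ⟩))
  ... | no _ = trans (+-congˡ (+ 1 * a x) (sum-filter P? L))
    (lem (+ 1 * a x) ⟨ a , ones (filter P? L) ⟩ ⟨ a , ones (filter (¬? ∘ P?) L) ⟩)
    where
    lem : ∀ u v w → u + (v + w) ≡ v + (u + w)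
    lem = solve-∀

  sum-const : ∀ {c} (f : ℕ → X) n → (∀ i → a (f i) ≡ c) → ⟨ a , ones (applyUpTo f n) ⟩ ≡ + n * c
  sum-const {c} f zero e = sym (ℤP.*-zeroˡ c)
  sum-const {c} f (suc n) e = trans (cong₂ (λ u v → + 1 * u + v) (e 0) (sum-const (f ∘ suc) n (e ∘ suc)))
    (trans (sym (ℤP.*-distribʳ-+ c (+ 1) (+ n))) refl)

module FreeOrbits {X : Set} (_≟_ : (x y : X) → Dec (x ≡ y)) (h : X → X) (p' : ℕ) (a : X → ℤ) where
  open DecMembership _≟_ using (_∈?_)
  private
    p = suc p'

  -- Removes the orbit of the first member and recurses on the rest, with `n` bounding the length.
  -- By freeness the orbit has exactly `p` members, and `a` is constant on it.
  orbit-sum : ∀ n B → length B ≤ n → Unique B → (∀ {x} → x ∈ B → h x ∈ B) → (∀ {x} → x ∈ B → iter h p x ≡ x) →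
              (∀ {x} → x ∈ B → ∀ g → 1 ≤ g → g < p → iter h g x ≢ x) → (∀ {x} → x ∈ B → a (h x) ≡ a x) →
              Div (+ p) ⟨ a , ones B ⟩
  orbit-sum n [] _ _ _ _ _ _ = Div-0
  orbit-sum (suc n) B@(x ∷ B₀) (s≤s le) uB closed period free inv =
    subst (Div (+ p)) (sym (sum-filter a (_∈? orb) B)) (Div-+ orb-part rest)
    where
    orb = applyUpTo (λ g → iter h g x) p
    rem = filter (¬? ∘ (_∈? orb)) B
    iter-B : ∀ g → iter h g x ∈ B
    iter-B zero = here refl
    iter-B (suc g) = closed (iter-B g)
    iter-a : ∀ g → a (iter h g x) ≡ a x
    iter-a zero = refl
    iter-a (suc g) = trans (inv (iter-B g)) (iter-a g)
    orb-unique : Unique orb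
    orb-unique = UniqueP.applyUpTo⁺₁ (λ g → iter h g x) p distinct
      where
      distinct : ∀ {i j} → i < j → j < p → iter h i x ≢ iter h j x
      distinct {i} {j} i<j j<p e = free (here refl) (p ℕ.∸ j ℕ.+ i)
        (ℕP.≤-trans (ℕP.m<n⇒0<n∸m j<p) (ℕP.m≤m+n (p ℕ.∸ j) i))
        (ℕP.<-≤-trans (ℕP.+-monoʳ-< (p ℕ.∸ j) i<j) (ℕP.≤-reflexive (ℕP.m∸n+n≡m (ℕP.<⇒≤ j<p))))
        (trans (iter-+ h (p ℕ.∸ j) i x) (trans (cong (iter h (p ℕ.∸ j)) e)
          (trans (sym (iter-+ h (p ℕ.∸ j) j x)) (trans (cong (λ k → iter h k x) (ℕP.m∸n+n≡m (ℕP.<⇒≤ j<p))) (period (here refl))))))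
    orb-part : Div (+ p) ⟨ a , ones (filter (_∈? orb) B) ⟩
    orb-part = div (a x) (trans (sum-same a (UniqueP.filter⁺ (_∈? orb) uB) orb-unique
        (λ m → proj₂ (∈-filter⁻ (_∈? orb) {xs = B} m)) (λ m → ∈-filter⁺ (_∈? orb) (orb-B m) m))
      (sum-const a (λ g → iter h g x) p iter-a))
      where
      orb-B : ∀ {y} → y ∈ orb → y ∈ B
      orb-B m with ∈-applyUpTo⁻ (λ g → iter h g x) m
      ... | g , _ , refl = iter-B g
    -- Needed for the remainder to be closed under `h`: no point outside the orbit may be mapped
    -- into it, since `h` is undone by `p'` further applications.
    back : ∀ {y} → y ∈ B → h y ∈ orb → y ∈ orb
    back {y} yB m with ∈-applyUpTo⁻ (λ g → iter h g x) m
    ... | zero , _ , e = subst (_∈ orb) (sym (trans (sym (period yB)) (trans (sym (iter-suc h p' y)) (cong (iter h p') e))))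
                           (∈-applyUpTo⁺ (λ g → iter h g x) ℕP.≤-refl)
    ... | suc g , lt , e = subst (_∈ orb) (sym eq) (∈-applyUpTo⁺ (λ g → iter h g x) (ℕP.<-trans (ℕP.n<1+n g) lt))
      where
      open ≡-Reasoning
      eq : y ≡ iter h g x
      eq = begin
        y                          ≡⟨ period yB ⟨
        iter h p y                 ≡⟨ iter-suc h p' y ⟨
        iter h p' (h y)            ≡⟨ cong (iter h p') e ⟩
        iter h p' (iter h (suc g) x) ≡⟨ iter-+ h p' (suc g) x ⟨
        iter h (p' ℕ.+ suc g) x    ≡⟨ cong (λ k → iter h k x) (trans (ℕP.+-suc p' g) (ℕP.+-comm p g)) ⟩
        iter h (g ℕ.+ p) x         ≡⟨ iter-+ h g p x ⟩
        iter h g (iter h p x)      ≡⟨ cong (iter h g) (period (here refl)) ⟩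
        iter h g x ∎
    rem-B : ∀ {y} → y ∈ rem → y ∈ B × y ∉ orb
    rem-B = ∈-filter⁻ (¬? ∘ (_∈? orb)) {xs = B}
    rest : Div (+ p) ⟨ a , ones rem ⟩
    rest = orbit-sum n rem
      (ℕP.≤-pred (ℕP.≤-trans (LP.filter-notAll (¬? ∘ (_∈? orb)) B (here λ no' → no' (here refl))) (s≤s le)))
      (UniqueP.filter⁺ (¬? ∘ (_∈? orb)) uB)
      (λ m → ∈-filter⁺ (¬? ∘ (_∈? orb)) (closed (proj₁ (rem-B m))) (λ k → proj₂ (rem-B m) (back (proj₁ (rem-B m)) k)))
      (λ m → period (proj₁ (rem-B m))) (λ m → free (proj₁ (rem-B m))) (λ m → inv (proj₁ (rem-B m)))

module Lefschetz (O : Ordered) (≺-trans : Transitive (_≺_ O)) (K : List (Carrier O) → Set) (M : Matching O K) where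
  private
    A = Carrier O
    module LO = Sorting (ListOrd O) (Lex-trans O ≺-trans)
  open Sorting O ≺-trans
  open Bases O ≺-trans
  open Matching M
  open Contraction O ≺-trans K M

  simplex? : ∀ q x → Dec (K x × length x ≡ q)
  simplex? q x = K? x ×-dec (length x ℕ.≟ q)

  -- Indexed by the number of vertices, so that `basis 0` consists of the empty simplex; sorting
  -- removes repetitions from the list that witnesses finiteness.
  basis : ℕ → List (List A)
  basis q = setOf (ListOrd O) (filter (simplex? q) (proj₁ K-finite))

  basis-unique : ∀ q → Unique (basis q)
  basis-unique q = LO.sorted-unique (LO.setOf-sorted (filter (simplex? q) (proj₁ K-finite)))

  ∈-basis⁺ : ∀ {q x} → K x → length x ≡ q → x ∈ basis q
  ∈-basis⁺ {q} {x} k e = LO.∈-setOf⁺ _ (∈-filter⁺ (simplex? q) (proj₂ K-finite x k) (k , e))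

  ∈-basis⁻ : ∀ {q x} → x ∈ basis q → K x × length x ≡ q
  ∈-basis⁻ {q} m = proj₂ (∈-filter⁻ (simplex? q) {xs = proj₁ K-finite} (LO.∈-setOf⁻ _ m))

  InK-InB : ∀ {q l} → InK q l → InB (basis q) l
  InK-InB (k , e) len = ∈-basis⁺ k (trans len e)

  -- The field `augmented` makes the trace on the empty simplex equal to 1, the one contribution
  -- that free orbits cannot absorb.
  record SelfMap (ψ : List A → FC (List A)) : Set where
    field
      altPres : AltPres ψ
      chain-map : ∀ Φ l → ⟨ δ Φ , ψ l ⟩ ≡ δ (λ t → ⟨ Φ , ψ t ⟩) l
      preserves : ∀ {q} l → InK q l → Supp (InK q) (ψ l)
      augmented : ∀ Φ → ⟨ Φ , ψ [] ⟩ ≡ Φ []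

  faces-Supp : ∀ {q} l → InK (suc q) l → Supp (InK q) (faces l)
  faces-Supp l (k , e) = Supp-map (λ t f → K̃-face f k , ℕP.suc-injective (trans (sym (proj₁ f)) e)) (faces-face l)

  module Trace (ψ : List A → FC (List A)) (Ψ : SelfMap ψ) where
    open SelfMap Ψ
    open ≡-Reasoning

    ψs̃ : List A → FC (List A)
    ψs̃ = ext ψ ∘ homotopy-op

    -- The trace of `ψ s ∂`. By cyclicity it is also the trace of `∂ ψ s` one degree lower, so the
    -- traces of `ψ` telescope.
    t : ℕ → ℤ
    t q = tr (basis q) (ext ψs̃ ∘ faces)

    N = length top

    basis-InK : ∀ {q x} → x ∈ basis q → InK q x
    basis-InK m with ∈-basis⁻ m
    ... | k , e = K̃-id k , e

    ψs̃-Supp : ∀ {q} l → length l ≡ q → Supp (InK (suc q)) (ψs̃ l)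
    ψs̃-Supp l e = Supp-ext ψ (homotopy-op l) (s̃-Supp fuel l e) preserves

    ψs̃-AltPres : AltPres ψs̃
    ψs̃-AltPres = AltPres-ext {T = ψ} {U = homotopy-op} altPres homotopy-op-AltPres

    -- The homotopy composed with `ψ`, where `∂` has been moved across `ψ` by the chain map
    -- property.
    local : ∀ q x → x ∈ basis q → ⟨ κ x , ψ x ⟩ ≡
      ⟨ κ x , ext faces (ψs̃ x) ⟩ + ⟨ κ x , ext ψs̃ (faces x) ⟩ + χ top x * ⟨ κ x , ext ψ η ⟩
    local q x m = trans (sym (homotopy (altPres (Alt-κ x)) x (proj₁ (basis-InK m)))) (cong₂ _+_ (cong₂ _+_ e₁ e₂) e₃)
      where
      Θ = λ l → ⟨ κ x , ψ l ⟩
      kx = proj₁ (∈-basis⁻ m)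
      e₁ : S (δ Θ) x ≡ ⟨ κ x , ext faces (ψs̃ x) ⟩
      e₁ = begin
        S (δ Θ) x ≡⟨ sym (s̃-S (δ Θ) fuel x) ⟩
        ⟨ δ Θ , homotopy-op x ⟩ ≡⟨ ⟨⟩-cong (homotopy-op x) (λ l → sym (chain-map (κ x) l)) ⟩
        ⟨ (λ l → ⟨ δ (κ x) , ψ l ⟩) , homotopy-op x ⟩ ≡⟨ sym (⟨⟩-ext (δ (κ x)) ψ (homotopy-op x)) ⟩
        ⟨ δ (κ x) , ψs̃ x ⟩ ≡⟨ sym (⟨⟩-ext (κ x) faces (ψs̃ x)) ⟩
        ⟨ κ x , ext faces (ψs̃ x) ⟩ ∎
      e₂ : δ (S Θ) x ≡ ⟨ κ x , ext ψs̃ (faces x) ⟩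
      e₂ = sym (trans (⟨⟩-ext (κ x) ψs̃ (faces x)) (⟨⟩-cong (faces x) λ l →
        trans (⟨⟩-ext (κ x) ψ (homotopy-op l)) (s̃-S Θ fuel l)))
      e₃ : κ top x * ⟨ Θ , η ⟩ ≡ χ top x * ⟨ κ x , ext ψ η ⟩
      e₃ = cong₂ _*_ (oF-sorted (χ top) x (K-sorted kx)) (sym (⟨⟩-ext (κ x) ψ η))

    defect : ℕ → ℤ
    defect q = ⟨ (λ x → χ top x * ⟨ κ x , ext ψ η ⟩) , ones (basis q) ⟩

    trace-split : ∀ q → tr (basis q) ψ ≡ t (suc q) + t q + defect q
    trace-split q = begin
      tr (basis q) ψ ≡⟨ ⟨⟩-congS (ones (basis q)) (Supp-∈ (basis q)) (local q) ⟩
      ⟨ (λ x → ⟨ κ x , ext faces (ψs̃ x) ⟩ + ⟨ κ x , ext ψs̃ (faces x) ⟩ + χ top x * ⟨ κ x , ext ψ η ⟩) , ones (basis q) ⟩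
        ≡⟨ ⟨⟩-+ (λ x → ⟨ κ x , ext faces (ψs̃ x) ⟩ + ⟨ κ x , ext ψs̃ (faces x) ⟩) (λ x → χ top x * ⟨ κ x , ext ψ η ⟩) (ones (basis q)) ⟩
      ⟨ (λ x → ⟨ κ x , ext faces (ψs̃ x) ⟩ + ⟨ κ x , ext ψs̃ (faces x) ⟩) , ones (basis q) ⟩ + defect q
        ≡⟨ cong (λ u → u + defect q) (⟨⟩-+ (λ x → ⟨ κ x , ext faces (ψs̃ x) ⟩) (λ x → ⟨ κ x , ext ψs̃ (faces x) ⟩) (ones (basis q))) ⟩
      tr (basis q) (ext faces ∘ ψs̃) + t q + defect q
        ≡⟨ cong (λ u → u + t q + defect q) (tr-cyclic (basis q) (basis (suc q)) (basis-unique q) (basis-unique (suc q))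
             faces ψs̃ (λ {Φ} a → Alt-δ a) ψs̃-AltPres
             (λ x m → Supp-map (λ l → InK-InB {l = l}) (ψs̃-Supp x (proj₂ (∈-basis⁻ m))))
             (λ y m → Supp-map (λ l → InK-InB {l = l}) (faces-Supp y (basis-InK m)))) ⟩
      t (suc q) + t q + defect q ∎

    t-zero : t 0 ≡ + 0
    t-zero = ⟨⟩-0S (ones (basis 0)) (Supp-∈ (basis 0)) λ x m → go x (proj₂ (∈-basis⁻ m))
      where
      go : ∀ x → length x ≡ 0 → ⟨ κ x , ext ψs̃ (faces x) ⟩ ≡ + 0
      go [] _ = refl

    t-above : t (suc N) ≡ + 0
    t-above = ⟨⟩-0S (ones (basis (suc N))) (Supp-∈ (basis (suc N))) λ x m →
      ⊥-elim (ℕP.<-irrefl refl (subst (_≤ N) (proj₂ (∈-basis⁻ m)) (K-bound (proj₁ (∈-basis⁻ m)))))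

    defect-top : defect N ≡ ⟨ κ top , ext ψ η ⟩
    defect-top = trans (⟨⟩-cong (ones (basis N)) (λ x → cong (_* ⟨ κ x , ext ψ η ⟩) (χ-sym top x)))
      (χ-expand (λ x → ⟨ κ x , ext ψ η ⟩) (basis N) (basis-unique N) (∈-basis⁺ K-top refl))
      where
      χ-sym : ∀ x y → χ x y ≡ χ y x
      χ-sym x y with eqV (ListOrd O) x y
      ... | yes refl = χ-refl x
      ... | no n = χ-≢ (n ∘ sym)

    defect-else : ∀ q → q ≢ N → defect q ≡ + 0
    defect-else q n = ⟨⟩-0S (ones (basis q)) (Supp-∈ (basis q)) λ x m →
      trans (cong (_* ⟨ κ x , ext ψ η ⟩) (χ-≢ {top} {x} λ e → n (trans (sym (proj₂ (∈-basis⁻ m))) (cong length e)))) (ℤP.*-zeroˡ ⟨ κ x , ext ψ η ⟩)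

    trace-0 : tr (basis 0) ψ ≡ + 1
    trace-0 = trans (sum-same (λ x → ⟨ κ x , ψ x ⟩) (basis-unique 0) ([] ∷ [])
        (λ m → nil (proj₂ (∈-basis⁻ m))) (λ { (here refl) → ∈-basis⁺ (K-down K-top [] λ ()) refl }))
      (cong (λ u → + 1 * u + + 0) (augmented (κ [])))
      where
      nil : ∀ {x : List A} → length x ≡ 0 → x ∈ [] ∷ []
      nil {[]} _ = here refl

    -- The alternating sum in telescoped form: modulo `P`, `t (q + 1) = - t q` for `1 ≤ q < N`,
    -- starting from `t 1 = 1`, while in the top degree `t N` and the degree of `ψ` add up to 0.
    lefschetz : ∀ {P} → top ≢ [] → (∀ q → 1 ≤ q → Div P (tr (basis q) ψ)) → Div P (⟨ κ top , ext ψ η ⟩ - sgn O N)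
    lefschetz {P} top≢ traces = subst (Div P) (lem (t N) ⟨ κ top , ext ψ η ⟩ (sgn O N))
      (Div-+ (subst (Div P) at-N (traces N N≥1)) (Div-neg (climb N N≥1 ℕP.≤-refl)))
      where
      lem : ∀ u m s → + 0 + u + m + - (u + s) ≡ m - s
      lem = solve-∀
      lem' : ∀ u v s → u + v + + 0 + - (v + s) ≡ u + - s
      lem' = solve-∀
      N≥1 : 1 ≤ N
      N≥1 = go top top≢
        where
        go : ∀ l → l ≢ [] → 1 ≤ length l
        go [] n = ⊥-elim (n refl)
        go (x ∷ l) _ = s≤s z≤n
      at-N : tr (basis N) ψ ≡ + 0 + t N + ⟨ κ top , ext ψ η ⟩
      at-N = trans (trace-split N) (cong₂ (λ u v → u + t N + v) t-above defect-top)
      t-one : t 1 ≡ + 1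
      t-one = begin
        t 1                      ≡⟨ lem₁ (t 1) ⟩
        t 1 + + 0 + + 0          ≡⟨ cong₂ (λ u v → t 1 + u + v) (sym t-zero) (sym (defect-else 0 λ e → ℕP.<-irrefl e N≥1)) ⟩
        t 1 + t 0 + defect 0     ≡⟨ sym (trace-split 0) ⟩
        tr (basis 0) ψ           ≡⟨ trace-0 ⟩
        + 1 ∎
        where
        lem₁ : ∀ u → u ≡ u + + 0 + + 0
        lem₁ = solve-∀
      climb : ∀ q → 1 ≤ q → q ≤ N → Div P (t q + sgn O q)
      climb (suc zero) _ _ = subst (λ u → Div P (u + - (+ 1))) (sym t-one) Div-0
      climb (suc (suc q)) _ le = subst (Div P) (lem' (t (suc (suc q))) (t (suc q)) (sgn O (suc q)))
        (Div-+ (subst (Div P) (trans (trace-split (suc q)) (cong (λ u → t (suc (suc q)) + t (suc q) + u)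
            (defect-else (suc q) λ e → ℕP.<-irrefl e le))) (traces (suc q) (s≤s z≤n)))
          (Div-neg (climb (suc q) (s≤s z≤n) (ℕP.<⇒≤ le))))

  open Trace public using (lefschetz)

module FreeAction (O : Ordered) (≺-trans : Transitive (_≺_ O)) (K : List (Carrier O) → Set) (M : Matching O K)
  (h : Carrier O → Carrier O) (p' : ℕ) (h-period : ∀ v → iter h (suc p') v ≡ v)
  (h-simplicial : ∀ {x} → K x → K (setOf O (map h x)))
  (h-free : ∀ g → 1 ≤ g → g < suc p' → ∀ {x} → K x → x ≢ [] → setOf O (map (iter h g) x) ≢ x) where
  private
    A = Carrier O
    p = suc p'
  open Sorting O ≺-trans
  open Bases O ≺-trans
  open Matching M
  open Contraction O ≺-trans K M
  open Lefschetz O ≺-trans K M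

  h-injective : ∀ {u v} → h u ≡ h v → u ≡ v
  h-injective {u} {v} e = trans (sym (h-period u)) (trans (sym (iter-suc h p' u))
    (trans (cong (iter h p') e) (trans (iter-suc h p' v) (h-period v))))

  act : List A → List A
  act x = setOf O (map h x)

  act-iter : ∀ n {x} → Sorted O x → iter act n x ≡ setOf O (map (iter h n) x)
  act-iter zero {x} s = sym (trans (cong (setOf O) (LP.map-id x)) (setOf-id s))
  act-iter (suc n) {x} s = trans (cong act (act-iter n s)) (trans (map-setOf O O ≺-trans h (map (iter h n) x))
    (cong (setOf O) (sym (LP.map-∘ x))))

  act-period : ∀ {x} → Sorted O x → iter act p x ≡ x
  act-period {x} s = trans (act-iter p s) (trans (cong (setOf O) (trans (LP.map-cong h-period x) (LP.map-id x))) (setOf-id s))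

  act-injective : ∀ {x y} → Sorted O x → Sorted O y → act x ≡ act y → x ≡ y
  act-injective {x} {y} s s' e = trans (sym (act-period s)) (trans (sym (iter-suc act p' x))
    (trans (cong (iter act p') e) (trans (iter-suc act p' y) (act-period s'))))

  map-unique : ∀ {x} → K x → Unique (map h x)
  map-unique k = UniqueP.map⁺ h-injective (sorted-unique (K-sorted k))

  act-length : ∀ {x} → K x → length (act x) ≡ length x
  act-length {x} k = trans (length-setOf (map h x) (map-unique k)) (LP.length-map h x)

  Equivariant : (List A → FC (List A)) → Set
  Equivariant ψ = ∀ Φ l → K̃ l → ⟨ Φ , ψ (map h l) ⟩ ≡ ⟨ Φ ∘ map h , ψ l ⟩

  module _ (ψ : List A → FC (List A)) (Ψ : SelfMap ψ) (eq : Equivariant ψ) where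
    open SelfMap Ψ

    -- Sorting `map h x` costs the same sign in the argument of `ψ` and in the dual cochain, so the
    -- two cancel.
    diagonal-invariant : ∀ {x} → K x → ⟨ κ (act x) , ψ (act x) ⟩ ≡ ⟨ κ x , ψ x ⟩
    diagonal-invariant {x} k = unit-cancel e-unit (begin
      e * ⟨ κ (act x) , ψ (act x) ⟩ ≡⟨ sym (e-ext (altPres (Alt-κ (act x)))) ⟩
      ⟨ κ (act x) , ψ (map h x) ⟩ ≡⟨ eq (κ (act x)) x (K̃-id k) ⟩
      ⟨ κ (act x) ∘ map h , ψ x ⟩ ≡⟨ ⟨⟩-congS (ψ x) (preserves x (K̃-id k , refl)) transport ⟩
      ⟨ (λ l → e * κ x l) , ψ x ⟩ ≡⟨ ⟨⟩-* e (κ x) (ψ x) ⟩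
      e * ⟨ κ x , ψ x ⟩ ∎)
      where
      open ≡-Reasoning
      ue = unitExt (map h x) (map-unique k)
      e = proj₁ ue
      e-unit = proj₁ (proj₂ ue)
      e-ext : ∀ {Φ} → Alt Φ → Φ (map h x) ≡ e * Φ (act x)
      e-ext = proj₂ (proj₂ ue)
      transport : ∀ l → InK (length x) l → κ (act x) (map h l) ≡ e * κ x l
      transport l (kl , _) = altExt (Alt-map h (Alt-κ (act x))) (Alt-* e (Alt-κ x)) l λ _ → at (setOf O l) kl
        where
        at : ∀ t → K t → κ (act x) (map h t) ≡ e * κ x t
        at t kt with eqV (ListOrd O) t x
        ... | yes refl = trans (e-ext (Alt-κ (act t))) (cong (e *_)
                (trans (κ-refl (setOf-sorted (map h t))) (sym (κ-refl (K-sorted kt)))))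
        ... | no n = trans (κ-≢ (map h t) (n ∘ act-injective (K-sorted kt) (K-sorted k)))
                (sym (trans (cong (e *_) (κ-≢ t (n ∘ trans (sym (setOf-id (K-sorted kt)))))) (ℤP.*-zeroʳ e)))

    trace-divisible : ∀ q → 1 ≤ q → Div (+ p) (tr (basis q) ψ)
    trace-divisible q q≥1 = orbit-sum (length (basis q)) (basis q) ℕP.≤-refl (basis-unique q)
      (λ m → ∈-basis⁺ (h-simplicial (proj₁ (∈-basis⁻ m))) (trans (act-length (proj₁ (∈-basis⁻ m))) (proj₂ (∈-basis⁻ m))))
      (λ m → act-period (K-sorted (proj₁ (∈-basis⁻ m))))
      (λ {x} m g g≥1 g<p e → h-free g g≥1 g<p (proj₁ (∈-basis⁻ m)) (λ e' → ℕP.<-irrefl (trans (cong length (sym e')) (proj₂ (∈-basis⁻ m))) q≥1)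
        (trans (sym (act-iter g (K-sorted (proj₁ (∈-basis⁻ m))))) e))
      (λ m → diagonal-invariant (proj₁ (∈-basis⁻ m)))
      where
      open FreeOrbits (eqV (ListOrd O)) act p' (λ x → ⟨ κ x , ψ x ⟩)

    degree≡sgn : top ≢ [] → Div (+ p) (⟨ κ top , ext ψ η ⟩ - sgn O (length top))
    degree≡sgn ne = lefschetz ψ Ψ ne trace-divisible

  identity-SelfMap : SelfMap single
  identity-SelfMap = record
    { altPres = λ {Φ} a → Alt-cong (λ l → sym (⟨⟩-single Φ l)) a
    ; chain-map = λ Φ l → trans (⟨⟩-single (δ Φ) l) (⟨⟩-cong (faces l) (λ t → sym (⟨⟩-single Φ t)))
    ; preserves = λ l i → i ∷ []
    ; augmented = λ Φ → ⟨⟩-single Φ []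
    }

  -- The identity is equivariant and has degree 1. This removes the sign from the Lefschetz
  -- congruence; when `top` is a single vertex it says that `p` divides 2.
  sphere-parity : top ≢ [] → Div (+ p) (+ 1 - sgn O (length top))
  sphere-parity ne = subst (λ u → Div (+ p) (u - sgn O (length top)))
    (trans (⟨⟩-ext (κ top) single η) (trans (⟨⟩-cong η (⟨⟩-single (κ top))) κtop-η))
    (degree≡sgn single identity-SelfMap (λ Φ l _ → trans (⟨⟩-single Φ (map h l)) (sym (⟨⟩-single (Φ ∘ map h) l))) ne)

  degree≡1 : (ψ : List A → FC (List A)) → SelfMap ψ → Equivariant ψ → top ≢ [] → Div (+ p) (⟨ κ top , ext ψ η ⟩ - + 1)
  degree≡1 ψ Ψ eq ne = subst (Div (+ p)) (lem ⟨ κ top , ext ψ η ⟩ (sgn O (length top)))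
    (Div-+ (degree≡sgn ψ Ψ eq ne) (Div-neg (sphere-parity ne)))
    where
    lem : ∀ u s → u - s + - (+ 1 - s) ≡ u - + 1
    lem = solve-∀

-- Matchings of spheres and joins

∈⇒≢[] : {X : Set} {x : X} {l : List X} → x ∈ l → l ≢ []
∈⇒≢[] () refl

module SubsetLength {X : Set} (_≟_ : (x y : X) → Dec (x ≡ y)) where
  open DecMembership _≟_ using (_∈?_)

  length-⊆ : ∀ {xs ys : List X} → Unique xs → (∀ {x} → x ∈ xs → x ∈ ys) → length xs ≤ length ys
  length-⊆ [] f = z≤n
  length-⊆ {x ∷ xs} (n ∷ u) f with ∈-∃++ (f (here refl))
  ... | as , bs , refl = ℕP.≤-trans (s≤s (length-⊆ u f')) (ℕP.≤-reflexive (sym (LP.length-++-sucʳ as x bs)))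
    where
    drop : ∀ as {z} → x ≢ z → z ∈ as ++ x ∷ bs → z ∈ as ++ bs
    drop [] ne (here e) = ⊥-elim (ne (sym e))
    drop [] ne (there m) = m
    drop (a ∷ as) ne (here e) = here e
    drop (a ∷ as) ne (there m) = there (drop as ne m)
    f' : ∀ {z} → z ∈ xs → z ∈ as ++ bs
    f' m = drop as (All.lookup n m) (f (there m))

  ⊆-full : ∀ {xs ys : List X} → Unique xs → (∀ {x} → x ∈ xs → x ∈ ys) → length ys ≤ length xs →
           ∀ {y} → y ∈ ys → y ∈ xs
  ⊆-full {xs} {ys} u f le {y} m with y ∈? xs
  ... | yes k = k
  ... | no n = ⊥-elim (ℕP.<-irrefl refl (ℕP.≤-trans (length-⊆ u' f') le))
    where
    u' : Unique (y ∷ xs)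
    u' = All.tabulate (λ k e → n (subst (_∈ xs) (sym e) k)) ∷ u
    f' : ∀ {z} → z ∈ y ∷ xs → z ∈ ys
    f' (here refl) = m
    f' (there k) = f k

module FacetVertex (O : Ordered) (≺-trans : Transitive (_≺_ O)) where
  private
    A = Carrier O
  open Sorting O ≺-trans
  open SubsetLength (eqV O) public
  open DecMembership (eqV O) using (_∈?_)

  sorted-⊆-≡ : ∀ {s t} → Sorted O s → Sorted O t → (∀ {x} → x ∈ s → x ∈ t) → length t ≤ length s → s ≡ t
  sorted-⊆-≡ p q f le = sorted-ext p q f (⊆-full (sorted-unique p) f le)

  new-vertex : List A → List A → Maybe A
  new-vertex α [] = nothing
  new-vertex α (v ∷ β) with v ∈? α
  ... | yes _ = new-vertex α β
  ... | no _ = just v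

  new-vertex-just : ∀ {v} α β → new-vertex α β ≡ just v → v ∈ β × v ∉ α
  new-vertex-just α (u ∷ β) e with u ∈? α
  ... | yes _ = let m , n = new-vertex-just α β e in there m , n
  new-vertex-just α (u ∷ β) refl | no n = here refl , n

  new-vertex-nothing : ∀ α β → new-vertex α β ≡ nothing → ∀ {v} → v ∈ β → v ∈ α
  new-vertex-nothing α (u ∷ β) e m with u ∈? α
  new-vertex-nothing α (u ∷ β) e (here refl) | yes k = k
  new-vertex-nothing α (u ∷ β) e (there m) | yes k = new-vertex-nothing α β e m

  facet-vertex : ∀ {α β v} → Sorted O α → Sorted O β → (∀ {x} → x ∈ α → x ∈ β) → suc (length α) ≡ length β →
                 v ∈ β → v ∉ α → setOf O (v ∷ α) ≡ β
  facet-vertex {α} {β} {v} p q f e m n = setOf-ext q g (⊆-full u g (ℕP.≤-reflexive (sym e)))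
    where
    u : Unique (v ∷ α)
    u = All.tabulate (λ k e' → n (subst (_∈ α) (sym e') k)) ∷ sorted-unique p
    g : ∀ {z} → z ∈ v ∷ α → z ∈ β
    g (here refl) = m
    g (there k) = f k

-- `W'` is to be `W`, possibly with one more pair matching the empty simplex. The premise `old`
-- confines the difference to that pair, so acyclicity can be read off from `W`.
module SphereMatching (O : Ordered) (≺-trans : Transitive (_≺_ O)) (K : Cx O) (d : ℕ) (isC : IsComplex K)
  (isP : IsPseudomanifold K d) (W : VF {O}) (gradient : IsGradient K W) (W' : VF {O}) (vf' : IsVF K W')
  (old : ∀ {P} → P ∈ W' → proj₁ P ≢ [] → P ∈ W)
  (top : List (Carrier O)) (K-top : K ∋ top) (top-length : length top ≡ suc d)
  (top-unpaired : ∀ {P} → P ∈ W' → top ≢ proj₁ P × top ≢ proj₂ P)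
  (paired : ∀ x → K ∋ x → x ≡ top ⊎ Any (λ P → x ≡ proj₁ P ⊎ x ≡ proj₂ P) W') where
  private
    A = Carrier O
  open Sorting O ≺-trans
  open FacetVertex O ≺-trans
  open IsComplex isC
  open IsPseudomanifold isP
  open IsVF vf'
  open DecMembership (eqV O) using (_∈?_)

  _≟ₛ_ : (x y : List A) → Dec (x ≡ y)
  _≟ₛ_ = eqV (ListOrd O)

  -- Membership in `K` is an arbitrary predicate; it becomes decidable because the pairs and `top`
  -- exhaust `K` and form a finite list.
  K? : ∀ x → Dec (K ∋ x)
  K? x with x ≟ₛ top | Any.any? (λ P → (x ≟ₛ proj₁ P) ⊎-dec (x ≟ₛ proj₂ P)) W'
  ... | yes refl | _ = yes K-top
  ... | no _ | yes a = yes (from a id)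
    where
    from : ∀ {L} → Any (λ P → x ≡ proj₁ P ⊎ x ≡ proj₂ P) L → (∀ {P} → P ∈ L → P ∈ W') → K ∋ x
    from (here (inj₁ refl)) f = proj₁ (facet _ _ (f (here refl)))
    from (here (inj₂ refl)) f = proj₁ (proj₂ (facet _ _ (f (here refl))))
    from (there a) f = from a (f ∘ there)
  ... | no n | no n' = no λ k → case (paired x k)
    where
    case : x ≡ top ⊎ _ → ⊥
    case (inj₁ e) = n e
    case (inj₂ a) = n' a

  find-mate : VF {O} → List A → Maybe A
  find-mate [] x = nothing
  find-mate ((α , β) ∷ L) x with x ≟ₛ α
  ... | yes _ = new-vertex α β
  ... | no _ = find-mate L x

  mate : List A → Maybe A
  mate = find-mate W'

  mate-pair : ∀ L → (∀ {P} → P ∈ L → P ∈ W') → ∀ {x v} → find-mate L x ≡ just v →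
              Σ (List A) λ β → (x , β) ∈ W' × v ∈ β × v ∉ x
  mate-pair ((α , β) ∷ L) f {x} e with x ≟ₛ α
  ... | yes refl = β , f (here refl) , new-vertex-just α β e
  ... | no _ = mate-pair L (f ∘ there) e

  pair-mate : ∀ L → (∀ {P} → P ∈ L → P ∈ W') → ∀ {x β} → (x , β) ∈ L → Σ A λ v → find-mate L x ≡ just v
  pair-mate ((α , β) ∷ L) f {x} m with x ≟ₛ α
  ... | yes refl = go (new-vertex α β) refl
    where
    go : ∀ r → new-vertex α β ≡ r → Σ A λ v → new-vertex α β ≡ just v
    go (just v) e = v , e
    go nothing e with facet α β (f (here refl))
    ... | kα , kβ , _ , len = ⊥-elim (ℕP.<-irrefl refl (subst (_≤ length α) (sym len)
            (length-⊆ (sorted-unique (sorted β kβ)) (new-vertex-nothing α β e))))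
  pair-mate ((α , β) ∷ L) f (here refl) | no n = ⊥-elim (n refl)
  pair-mate ((α , β) ∷ L) f (there m) | no n = pair-mate L (f ∘ there) m

  mate-spec : ∀ {x v} → mate x ≡ just v → (x , setOf O (v ∷ x)) ∈ W' × v ∉ x
  mate-spec {x} {v} e with mate-pair W' id e
  ... | β , m , v∈ , v∉ with facet x β m
  ...   | kα , kβ , sub , len = subst (λ b → (x , b) ∈ W')
            (sym (facet-vertex (sorted x kα) (sorted β kβ) (sub _) len v∈ v∉)) m , v∉

  longest : Σ ℕ λ B → ∀ x → K ∋ x → length x ≤ B
  longest = go (proj₁ finite) , λ x k → bound (proj₁ finite) (proj₂ finite x k)
    where
    go : List (List A) → ℕ
    go [] = 0
    go (x ∷ L) = length x ℕ.⊔ go L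
    bound : ∀ L {x} → x ∈ L → length x ≤ go L
    bound (y ∷ L) (here refl) = ℕP.m≤m⊔n (length y) (go L)
    bound (y ∷ L) (there m) = ℕP.≤-trans (bound L m) (ℕP.m≤n⊔m (length y) (go L))

  -- Climbs from `x` to a maximal simplex, whose size the pseudomanifold condition prescribes; `n`
  -- bounds how far `x` can still grow.
  K-bound' : ∀ n x → K ∋ x → proj₁ longest ≤ n ℕ.+ length x → length x ≤ suc d
  K-bound' n x k le with Any.any? (λ τ → K? τ ×-dec (All.all? (_∈? τ) x ×-dec ¬? (τ ≟ₛ x))) (proj₁ finite)
  ... | no none = ℕP.≤-reflexive (maximal x k λ τ kτ sub → stable τ kτ sub (τ ≟ₛ x))
    where
    stable : ∀ τ → K ∋ τ → (∀ z → z ∈ x → z ∈ τ) → Dec (τ ≡ x) → τ ≡ x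
    stable τ kτ sub (yes e) = e
    stable τ kτ sub (no ne) = ⊥-elim (none (Any.map (λ { refl → kτ , All.tabulate (sub _) , ne }) (proj₂ finite τ kτ)))
  ... | yes a with Any.satisfied a
  ...   | τ , kτ , sub , ne = larger n le
    where
    longer : length x < length τ
    longer = ℕP.≰⇒> λ le' → ne (sym (sorted-⊆-≡ (sorted x k) (sorted τ kτ) (All.lookup sub) le'))
    larger : ∀ n → proj₁ longest ≤ n ℕ.+ length x → length x ≤ suc d
    larger zero le' = ⊥-elim (ℕP.<-irrefl refl (ℕP.≤-trans longer (ℕP.≤-trans (proj₂ longest τ kτ) le')))
    larger (suc n) le' = ℕP.≤-trans (ℕP.<⇒≤ longer) (K-bound' n τ kτ (ℕP.≤-trans le'
      (ℕP.≤-trans (ℕP.≤-reflexive (sym (ℕP.+-suc n (length x)))) (ℕP.+-monoʳ-≤ n longer))))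

  K-bound : ∀ {x} → K ∋ x → length x ≤ length top
  K-bound {x} k = subst (length x ≤_) (sym top-length) (K-bound' (proj₁ longest) x k (ℕP.m≤m+n _ (length x)))

  -- A relation between positions in `W` rather than pairs, so that finiteness of `Fin` yields
  -- well-foundedness.
  Step : Fin (length W) → Fin (length W) → Set
  Step i j = let α , β' = lookup W j ; β = proj₂ (lookup W i) in
    _⊆_ O α β × α ≢ β × β ≢ β' × length β' ≡ length β

  trajectory : ∀ {i j} → TransClosure Step i j → Σ _ λ P → Σ _ λ rest →
               Trajectory {O} W (proj₂ (lookup W i)) (P ∷ rest) × endpoint {O} (proj₂ (lookup W i)) (P ∷ rest) ≡ proj₂ (lookup W j)
  trajectory {i} {j} [ a , b , c , e ] = lookup W j , [] , more (∈-lookup {xs = W} j) a b c e done , refl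
  trajectory {i} {j} (Plus._∷_ {y = k} (a , b , c , e) st) with trajectory st
  ... | P , rest , t , end = lookup W k , P ∷ rest , more (∈-lookup {xs = W} k) a b c e t , end

  -- A cycle of steps would be a nontrivial closed trajectory, so the transitive closure is a strict
  -- order on a finite set.
  step-wf : WellFounded (λ j i → TransClosure Step i j)
  step-wf = spo-wellFounded record
    { isEquivalence = isEquivalence
    ; irrefl = λ { {i} refl st → let P , rest , t , end = trajectory st in
        proj₂ gradient _ P rest (proj₁ (proj₂ (IsVF.facet (proj₁ gradient) _ _ (∈-lookup {xs = W} i)))) t end }
    ; trans = λ p q → q Plus.++ p
    ; <-resp-≈ = (λ { refl p → p }) , (λ { refl p → p })
    }

  index-of : ∀ {P} → P ∈ W → Σ (Fin (length W)) λ i → lookup W i ≡ P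
  index-of m = Any.index m , sym (lookup-index m)

  -- As `v ∈ y` and `x` has the same size, neither is empty and both pairs belong to `W`. Their
  -- upper members differ: otherwise uniqueness would give `x = y`, although `v ∉ x`.
  descent-step : ∀ {x y} → Descent mate y x → ∀ i → proj₁ (lookup W i) ≡ x →
                 Σ (Fin (length W)) λ j → proj₁ (lookup W j) ≡ y × Step i j
  descent-step {x} {y} (descent {v} {w} ex ey v∈y y⊆ len) i refl = j , cong proj₁ ej ,
      subst₂ (λ P Q → _⊆_ O (proj₁ Q) (proj₂ P) × proj₁ Q ≢ proj₂ P × proj₂ P ≢ proj₂ Q × length (proj₂ Q) ≡ length (proj₂ P))
        (sym (proj₂ xi)) (sym ej)
        ( (λ z m → ∈-setOf⁺ (v ∷ x) (y⊆ m))
        , (λ e → ℕP.1+n≢n (trans (proj₂ (proj₂ (proj₂ fx))) (trans (cong length (sym e)) len)))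
        , (λ e → proj₂ mx (subst (v ∈_) (cong proj₁ (sym (unique _ _ (proj₁ mx) (proj₁ my) (setOf O (v ∷ x)) (inj₂ refl) (inj₂ e)))) v∈y))
        , trans (sym (proj₂ (proj₂ (proj₂ fy)))) (trans (cong suc len) (proj₂ (proj₂ (proj₂ fx)))) )
    where
    mx = mate-spec ex
    my = mate-spec ey
    fx = facet _ _ (proj₁ mx)
    fy = facet _ _ (proj₁ my)
    y≢[] = ∈⇒≢[] v∈y
    x≢[] : x ≢ []
    x≢[] e = y≢[] (nil (trans len (cong length e)))
      where
      nil : ∀ {l : List A} → length l ≡ 0 → l ≡ []
      nil {[]} _ = refl
    ij = index-of (old (proj₁ my) y≢[])
    j = proj₁ ij
    ej = proj₂ ij
    old-vf = proj₁ gradient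
    xi : x ≡ x × lookup W i ≡ (x , setOf O (v ∷ x))
    xi = refl , IsVF.unique old-vf _ _ (∈-lookup {xs = W} i) (old (proj₁ mx) x≢[]) x (inj₁ refl) (inj₁ refl)

  acc-index : ∀ i → Acc (λ j i → TransClosure Step i j) i → ∀ x → proj₁ (lookup W i) ≡ x → Acc (Descent mate) x
  acc-index i (acc rs) x e = acc λ {y} ds → let j , ej , st = descent-step ds i e in acc-index j (rs [ st ]) y ej

  mate-wf : ∀ x → Acc (Descent mate) x
  mate-wf x = acc λ {y} ds → start y ds
    where
    start : ∀ y → Descent mate y x → Acc (Descent mate) y
    start y (descent ex ey v∈y y⊆ len) = acc-index (proj₁ ij) (step-wf (proj₁ ij)) y (cong proj₁ (proj₂ ij))
      where
      y≢[] = ∈⇒≢[] v∈y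
      ij = index-of (old (proj₁ (mate-spec ey)) y≢[])

  matching : Matching O (K ∋_)
  matching = record
    { K-sorted = λ {x} → sorted x
    ; K? = K?
    ; K-down = λ {x} {y} k s f → closed x y k s λ _ → f
    ; K-finite = finite
    ; top = top
    ; K-top = K-top
    ; K-bound = K-bound
    ; mate = mate
    ; mate-top = mate-nothing (mate top) refl
    ; mate-new = λ e → proj₂ (mate-spec e)
    ; mate-K = λ e → let k , k' , _ = facet _ _ (proj₁ (mate-spec e)) in k , k'
    ; mate-upper = λ {x} {v} e → upper x v e (mate (setOf O (v ∷ x))) refl
    ; mate-≢top = λ e e' → proj₂ (top-unpaired (proj₁ (mate-spec e))) (sym e')
    ; cover = cover
    ; ◁-wf = mate-wf
    }
    where
    mate-nothing : ∀ r → mate top ≡ r → mate top ≡ nothing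
    mate-nothing nothing e = e
    mate-nothing (just v) e = ⊥-elim (proj₁ (top-unpaired (proj₁ (mate-spec e))) refl)
    upper : ∀ x v → mate x ≡ just v → ∀ r → mate (setOf O (v ∷ x)) ≡ r → mate (setOf O (v ∷ x)) ≡ nothing
    upper x v e nothing e' = e'
    upper x v e (just w) e' = ⊥-elim (proj₂ (mate-spec e) (subst (v ∈_)
      (sym (cong proj₁ (unique _ _ (proj₁ (mate-spec e)) (proj₁ (mate-spec e')) (setOf O (v ∷ x)) (inj₂ refl) (inj₁ refl))))
      (∈-setOf⁺ (v ∷ x) (here refl))))
    cover : ∀ {x} → K ∋ x → mate x ≡ nothing → x ≡ top ⊎ Σ A λ v → Σ (List A) λ y → mate y ≡ just v × x ≡ setOf O (v ∷ y)
    cover {x} k e with paired x k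
    ... | inj₁ t = inj₁ t
    ... | inj₂ a with find-∈ a
      where
      find-∈ : ∀ {L : VF {O}} → Any (λ P → x ≡ proj₁ P ⊎ x ≡ proj₂ P) L → Σ _ λ P → P ∈ L × (x ≡ proj₁ P ⊎ x ≡ proj₂ P)
      find-∈ (here p) = _ , here refl , p
      find-∈ (there a) = let P , m , p = find-∈ a in P , there m , p
    ...   | (α , β) , m , inj₁ refl with pair-mate W' id m
    ...     | v , e' = ⊥-elim (just≢ (trans (sym e') e))
      where
      just≢ : just v ≢ nothing
      just≢ ()
    cover {x} k e | inj₂ a | (α , β) , m , inj₂ refl with pair-mate W' id m
    ...     | v , e' = inj₂ (v , α , e' , cong proj₂ (unique _ _ m (proj₁ (mate-spec e')) α (inj₁ refl) (inj₁ refl)))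

-- The empty simplex has to be matched too. If `W` leaves it free, it is paired with the critical
-- vertex. If `W` pairs it with a vertex, that vertex counts as critical, and the other critical
-- simplex becomes the top.
sphere-matching : (O : Ordered) (≺-trans : Transitive (_≺_ O)) (K : Cx O) (d : ℕ) → IsCombSphere K d →
                  Σ (Matching O (K ∋_)) λ M → length (Matching.top M) ≡ suc d
sphere-matching O ≺-trans K d
  (isC , isP , W , gradient@(vf , _) , σ , τ , σ≢τ , σ-length , τ-length , critical-σ , critical-τ , only) =
  case (Any.any? (λ P → proj₁ P ≟ₛ []) W)
  where
  Vert = Carrier O
  _≟ₛ_ : (x y : List Vert) → Dec (x ≡ y)
  _≟ₛ_ = eqV (ListOrd O)
  open IsVF vf
  open IsComplex isC

  InPair : List Vert → List Vert × List Vert → Set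
  InPair x P = x ≡ proj₁ P ⊎ x ≡ proj₂ P

  inPair? : ∀ x → Dec (Any (InPair x) W)
  inPair? x = Any.any? (λ P → (x ≟ₛ proj₁ P) ⊎-dec (x ≟ₛ proj₂ P)) W

  unpaired⇒critical : ∀ x → K ∋ x → x ≢ [] → ¬ Any (InPair x) W → x ≡ σ ⊎ x ≡ τ
  unpaired⇒critical x k ne n = only x (k , ne , inj₁ λ P m →
    (λ e → n (Any.map (λ { refl → inj₁ e }) m)) , (λ e → n (Any.map (λ { refl → inj₂ e }) m)))

  Result : Set
  Result = Σ (Matching O (K ∋_)) λ M → length (Matching.top M) ≡ suc d

  with-empty : ∀ s t → s ≢ t → length s ≡ suc d → Critical K W s → (∀ x → x ≡ σ ⊎ x ≡ τ → x ≡ s ⊎ x ≡ t) →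
               ([] , t) ∈ W → Result
  with-empty s t s≢t s-length (ks , s≢[] , crit) relabel m = SphereMatching.matching O ≺-trans K d isC isP W gradient W vf
    (λ m' _ → m') s ks s-length (unpaired crit) paired , s-length
    where
    unpaired : (∀ P → P ∈ W → s ≢ proj₁ P × s ≢ proj₂ P) ⊎ (length s ≡ 1 × ([] , s) ∈ W) →
               ∀ {P} → P ∈ W → s ≢ proj₁ P × s ≢ proj₂ P
    unpaired (inj₁ f) = f _
    unpaired (inj₂ (_ , m')) = ⊥-elim (s≢t (cong proj₂ (unique _ _ m' m [] (inj₁ refl) (inj₁ refl))))
    paired : ∀ x → K ∋ x → x ≡ s ⊎ Any (InPair x) W
    paired x k with x ≟ₛ [] | inPair? x
    ... | yes refl | _ = inj₂ (Any.map (λ { refl → inj₁ refl }) m)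
    ... | no _ | yes a = inj₂ a
    ... | no ne | no n with relabel x (unpaired⇒critical x k ne n)
    ...   | inj₁ e = inj₁ e
    ...   | inj₂ refl = inj₂ (Any.map (λ { refl → inj₂ refl }) m)

  without-empty : ¬ Any (λ P → proj₁ P ≡ []) W → Result
  without-empty none = SphereMatching.matching O ≺-trans K d isC isP W gradient W' vf'
    old σ (proj₁ critical-σ) σ-length σ-unpaired paired , σ-length
    where
    W' = ([] , τ) ∷ W
    unpaired : ∀ {s} → Critical K W s → ∀ {P} → P ∈ W → s ≢ proj₁ P × s ≢ proj₂ P
    unpaired (_ , _ , inj₁ f) = f _
    unpaired (_ , _ , inj₂ (_ , m)) = ⊥-elim (none (Any.map (λ { refl → refl }) m))
    K-empty : K ∋ []
    K-empty = closed _ [] (proj₂ nonempty) [] λ _ ()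
    not-empty : ∀ {P} → P ∈ W → ∀ {x} → InPair x P → x ≢ []
    not-empty m (inj₁ refl) e = none (Any.map (λ { refl → e }) m)
    not-empty {α , β} m (inj₂ refl) refl with proj₂ (proj₂ (proj₂ (facet α β m)))
    ... | ()
    fresh : ∀ {P} → P ∈ W → ∀ x → InPair x ([] , τ) → InPair x P → ⊥
    fresh m x (inj₁ e) q = not-empty m q e
    fresh m x (inj₂ refl) (inj₁ e) = proj₁ (unpaired critical-τ m) e
    fresh m x (inj₂ refl) (inj₂ e) = proj₂ (unpaired critical-τ m) e
    vf' : IsVF K W'
    vf' = record
      { facet = λ { α β (here refl) → K-empty , proj₁ critical-τ , (λ _ ()) , sym τ-length
                  ; α β (there m) → facet α β m }
      ; unique = λ { P Q (here refl) (here refl) x p q → refl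
                   ; P Q (here refl) (there m) x p q → ⊥-elim (fresh m x p q)
                   ; P Q (there m) (here refl) x p q → ⊥-elim (fresh m x q p)
                   ; P Q (there m) (there m') x p q → unique P Q m m' x p q }
      }
    old : ∀ {P} → P ∈ W' → proj₁ P ≢ [] → P ∈ W
    old (here refl) ne = ⊥-elim (ne refl)
    old (there m) ne = m
    σ-unpaired : ∀ {P} → P ∈ W' → σ ≢ proj₁ P × σ ≢ proj₂ P
    σ-unpaired (here refl) = proj₁ (proj₂ critical-σ) , σ≢τ
    σ-unpaired (there m) = unpaired critical-σ m
    paired : ∀ x → K ∋ x → x ≡ σ ⊎ Any (InPair x) W'
    paired x k with x ≟ₛ [] | inPair? x
    ... | yes refl | _ = inj₂ (here (inj₁ refl))
    ... | no _ | yes a = inj₂ (there a)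
    ... | no ne | no n with unpaired⇒critical x k ne n
    ...   | inj₁ e = inj₁ e
    ...   | inj₂ refl = inj₂ (here (inj₂ refl))

  get : ∀ {L : VF {O}} → Any (λ P → proj₁ P ≡ []) L → Σ _ λ ρ → ([] , ρ) ∈ L
  get (here {x = _ , ρ} refl) = ρ , here refl
  get (there a) = let ρ , m = get a in ρ , there m

  case : Dec (Any (λ P → proj₁ P ≡ []) W) → Result
  case (no none) = without-empty none
  case (yes a) with get a
  ... | ρ , m with facet [] ρ m
  ...   | _ , kρ , _ , len with only ρ (kρ , (λ { refl → ⊥-elim (ℕP.1+n≢0 len) }) , inj₂ (sym len , m))
  -- Here `σ` is itself a vertex, so `d` is 0 and `τ` can serve as the top simplex.
  ...     | inj₁ refl = with-empty τ ρ (σ≢τ ∘ sym) (trans τ-length (trans len σ-length)) critical-τ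
              (λ { x (inj₁ e) → inj₂ e ; x (inj₂ e) → inj₁ e }) m
  ...     | inj₂ refl = with-empty σ ρ σ≢τ σ-length critical-σ (λ _ → id) m

-- The acyclic matching on a join

length-concat-tabulate : {X : Set} {n : ℕ} (f : Fin n → List X) →
                         length (concat (tabulate f)) ≡ sum (tabulate (length ∘ f))
length-concat-tabulate {n = zero} f = refl
length-concat-tabulate {n = suc n} f = trans (LP.length-++ (f F.zero))
  (cong (length (f F.zero) ℕ.+_) (length-concat-tabulate (f ∘ F.suc)))

sum-≤ : ∀ {n} (f g : Fin n → ℕ) → (∀ i → f i ≤ g i) → sum (tabulate f) ≤ sum (tabulate g)
sum-≤ {zero} f g le = z≤n
sum-≤ {suc n} f g le = ℕP.+-mono-≤ (le F.zero) (sum-≤ (f ∘ F.suc) (g ∘ F.suc) (le ∘ F.suc))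

sum-tight : ∀ {n} (f g : Fin n → ℕ) → (∀ i → f i ≤ g i) → sum (tabulate f) ≡ sum (tabulate g) → ∀ i → g i ≤ f i
sum-tight {suc n} f g le e F.zero = ℕP.+-cancelʳ-≤ (sum (tabulate (f ∘ F.suc))) (g F.zero) (f F.zero)
  (ℕP.≤-trans (ℕP.+-monoʳ-≤ (g F.zero) (sum-≤ (f ∘ F.suc) (g ∘ F.suc) (le ∘ F.suc))) (ℕP.≤-reflexive (sym e)))
sum-tight {suc n} f g le e (F.suc i) = sum-tight (f ∘ F.suc) (g ∘ F.suc) (le ∘ F.suc)
  (ℕP.≤-antisym (sum-≤ (f ∘ F.suc) (g ∘ F.suc) (le ∘ F.suc))
    (ℕP.+-cancelˡ-≤ (f F.zero) _ _ (ℕP.≤-trans (ℕP.+-monoˡ-≤ _ (le F.zero)) (ℕP.≤-reflexive (sym e))))) i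

FirstFailure : ∀ {n} → (Fin n → Set) → Fin n → Set
FirstFailure P i = ¬ P i × (∀ j → j F.< i → P j)

first-failure : ∀ {n} (P : Fin n → Set) → (∀ i → Dec (P i)) → (Σ (Fin n) (FirstFailure P)) ⊎ (∀ i → P i)
first-failure {zero} P P? = inj₂ λ ()
first-failure {suc n} P P? with P? F.zero | first-failure (P ∘ F.suc) (P? ∘ F.suc)
... | no n₀ | _ = inj₁ (F.zero , n₀ , λ _ ())
... | yes p | inj₁ (i , ni , le) = inj₁ (F.suc i , ni , λ { F.zero _ → p ; (F.suc j) (s≤s lt) → le j lt })
... | yes p | inj₂ all = inj₂ λ { F.zero → p ; (F.suc i) → all i }

first-failure-unique : ∀ {n} {P : Fin n → Set} {i j} → FirstFailure P i → FirstFailure P j → i ≡ j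
first-failure-unique {i = i} {j} (ni , li) (nj , lj) with FP.<-cmp i j
... | tri< lt _ _ = ⊥-elim (ni (lj i lt))
... | tri≈ _ e _ = e
... | tri> _ _ lt = ⊥-elim (nj (li j lt))

sublists : {X : Set} → List X → List (List X)
sublists [] = [] ∷ []
sublists (v ∷ vs) = sublists vs ++ map (v ∷_) (sublists vs)

module Sublists (O : Ordered) (≺-trans : Transitive (_≺_ O)) where
  private
    A = Carrier O
  open Sorting O ≺-trans

  ∈-sublists : ∀ {x vs} → Sorted O x → Sorted O vs → (∀ {z} → z ∈ x → z ∈ vs) → x ∈ sublists vs
  ∈-sublists p q f = go (sorted-pairs p) (sorted-pairs q) f
    where
    go : ∀ {x vs} → AllPairs (_≺_ O) x → AllPairs (_≺_ O) vs → (∀ {z} → z ∈ x → z ∈ vs) → x ∈ sublists vs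
    go {[]} {[]} _ _ f = here refl
    go {u ∷ x} {[]} _ _ f with f (here refl)
    ... | ()
    go {[]} {v ∷ vs} p (_ ∷ q) f = ∈-++⁺ˡ (go [] q λ ())
    go {u ∷ x} {v ∷ vs} (pu ∷ p) (qv ∷ q) f with eqV O u v
    ... | yes refl = ∈-++⁺ʳ (sublists vs) (∈-map⁺ (v ∷_) (go p q f'))
      where
      f' : ∀ {z} → z ∈ x → z ∈ vs
      f' m with f (there m)
      ... | here refl = ⊥-elim (≺-irrefl (All.lookup pu m))
      ... | there k = k
    ... | no ne = ∈-++⁺ˡ (go (pu ∷ p) q f')
      where
      u∈ : u ∈ vs
      u∈ with f (here refl)
      ... | here e = ⊥-elim (ne e)
      ... | there k = k
      f' : ∀ {z} → z ∈ u ∷ x → z ∈ vs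
      f' (here refl) = u∈
      f' (there m) with f (there m)
      ... | here refl = ⊥-elim (≺-asym (All.lookup qv u∈) (All.lookup pu m))
      ... | there k = k

module JoinMatching (O : Ordered) (≺-trans : Transitive (_≺_ O)) {m : ℕ} (Ss : Fin m → Cx O)
  (Ms : (i : Fin m) → Matching O (Ss i ∋_)) (disjoint : PairwiseDisjoint Ss) where
  private
    A = Carrier O
    module Mi (i : Fin m) = Matching (Ms i)
  open Sorting O ≺-trans
  open FacetVertex O ≺-trans
  open Sublists O ≺-trans

  J∋ : List A → Set
  J∋ = Join Ss ∋_

  vertex? : ∀ i v → Dec (Ss i ∋ (v ∷ []))
  vertex? i v = Mi.K? i (v ∷ [])

  part : Fin m → List A → List A
  part i = filter (vertex? i)

  tops : Fin m → List A
  tops i = Mi.top i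

  vertex-of : ∀ {i x v} → Ss i ∋ x → v ∈ x → Ss i ∋ (v ∷ [])
  vertex-of {i} k m = Mi.K-down i k [-] λ { (here refl) → m }

  vertex-index : ∀ {i j v} → Ss i ∋ (v ∷ []) → Ss j ∋ (v ∷ []) → i ≡ j
  vertex-index {i} {j} {v} k l with i FP.≟ j
  ... | yes e = e
  ... | no n = ⊥-elim (disjoint i j n v (v ∷ [] , k , here refl) (v ∷ [] , l , here refl))

  part-sorted : ∀ i {x} → Sorted O x → Sorted O (part i x)
  part-sorted i = Linked-filter⁺ (vertex? i) ≺-trans

  ∈-part⁺ : ∀ {i x z} → z ∈ x → Ss i ∋ (z ∷ []) → z ∈ part i x
  ∈-part⁺ {i} = ∈-filter⁺ (vertex? i)

  ∈-part⁻ : ∀ {i x z} → z ∈ part i x → z ∈ x × Ss i ∋ (z ∷ [])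
  ∈-part⁻ {i} {x} = ∈-filter⁻ (vertex? i) {xs = x}

  join-parts : ∀ {x} → J∋ x → (∀ i → Ss i ∋ part i x) × (∀ {z} → z ∈ x → Σ (Fin m) λ i → Ss i ∋ (z ∷ []))
  join-parts {x} (s , τ , k , cov) = (λ i → subst (Ss i ∋_) (sym (part≡ i)) (k i)) ,
    λ {z} z∈ → let i , zi = proj₁ (cov z) z∈ in i , vertex-of (k i) zi
    where
    part≡ : ∀ i → part i x ≡ τ i
    part≡ i = sorted-ext (part-sorted i s) (Mi.K-sorted i (k i)) to λ {z} z∈ → ∈-part⁺ (proj₂ (cov z) i z∈) (vertex-of (k i) z∈)
      where
      to : ∀ {z} → z ∈ part i x → z ∈ τ i
      to {z} z∈ with ∈-part⁻ {i} {x} z∈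
      ... | zx , zi with proj₁ (cov z) zx
      ...   | j , zj = subst (λ j → z ∈ τ j) (vertex-index (vertex-of (k j) zj) zi) zj

  parts-join : ∀ {x} → Sorted O x → (∀ i → Ss i ∋ part i x) → (∀ {z} → z ∈ x → Σ (Fin m) λ i → Ss i ∋ (z ∷ [])) → J∋ x
  parts-join {x} s k cov = s , (λ i → part i x) , k ,
    λ z → (λ z∈ → let i , zi = cov z∈ in i , ∈-part⁺ z∈ zi) , λ i z∈ → proj₁ (∈-part⁻ {i} {x} z∈)

  parts-≡ : ∀ {x y} → J∋ x → J∋ y → (∀ i → part i x ≡ part i y) → x ≡ y
  parts-≡ {x} {y} kx ky e = sorted-ext (proj₁ kx) (proj₁ ky)
    (λ z∈ → let i , zi = proj₂ (join-parts kx) z∈ in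
       proj₁ (∈-part⁻ {i} {y} (subst (_ ∈_) (e i) (∈-part⁺ z∈ zi))))
    (λ z∈ → let i , zi = proj₂ (join-parts ky) z∈ in
       proj₁ (∈-part⁻ {i} {x} (subst (_ ∈_) (sym (e i)) (∈-part⁺ z∈ zi))))

  J : (Fin m → List A) → List A
  J τ = setOf O (concat (tabulate τ))

  ∈-J⁺ : ∀ τ i {z} → z ∈ τ i → z ∈ J τ
  ∈-J⁺ τ i z∈ = ∈-setOf⁺ (concat (tabulate τ)) (∈-concat⁺′ z∈ (∈-tabulate⁺ {f = τ} i))

  ∈-J⁻ : ∀ τ {z} → z ∈ J τ → Σ (Fin m) λ i → z ∈ τ i
  ∈-J⁻ τ {z} z∈ with ∈-concat⁻′ (tabulate τ) (∈-setOf⁻ (concat (tabulate τ)) z∈)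
  ... | l , z∈l , l∈ with ∈-tabulate⁻ {f = τ} l∈
  ...   | i , refl = i , z∈l

  J-join : ∀ τ → (∀ i → Ss i ∋ τ i) → J∋ (J τ)
  J-join τ k = setOf-sorted (concat (tabulate τ)) , τ , k , λ z → ∈-J⁻ τ , λ i → ∈-J⁺ τ i

  part-J : ∀ τ → (∀ i → Ss i ∋ τ i) → ∀ i → part i (J τ) ≡ τ i
  part-J τ k i = sorted-ext (part-sorted i (setOf-sorted (concat (tabulate τ)))) (Mi.K-sorted i (k i)) to
    λ z∈ → ∈-part⁺ (∈-J⁺ τ i z∈) (vertex-of (k i) z∈)
    where
    to : ∀ {z} → z ∈ part i (J τ) → z ∈ τ i
    to {z} z∈ with ∈-part⁻ {i} {J τ} z∈
    ... | zJ , zi with ∈-J⁻ τ zJ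
    ...   | j , zj = subst (λ j → z ∈ τ j) (vertex-index (vertex-of (k j) zj) zi) zj

  J-parts : ∀ {x} → J∋ x → J (λ i → part i x) ≡ x
  J-parts k = parts-≡ (J-join _ (proj₁ (join-parts k))) k (part-J _ (proj₁ (join-parts k)))

  length-J : ∀ τ → (∀ i → Ss i ∋ τ i) → length (J τ) ≡ sum (tabulate (length ∘ τ))
  length-J τ k = trans (length-setOf (concat (tabulate τ)) unique-concat) (length-concat-tabulate τ)
    where
    unique-concat : Unique (concat (tabulate τ))
    unique-concat = UniqueP.concat⁺ (AllP.tabulate⁺ λ i → sorted-unique (Mi.K-sorted i (k i)))
      (AllPairsP.tabulate⁺ λ {i} {j} n {z} (zi , zj) → n (vertex-index (vertex-of (k i) zi) (vertex-of (k j) zj)))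

  length-parts : ∀ {x} → J∋ x → length x ≡ sum (tabulate (λ i → length (part i x)))
  length-parts k = trans (cong length (sym (J-parts k))) (length-J _ (proj₁ (join-parts k)))

  J? : ∀ x → Dec (J∋ x)
  J? x with eqV (ListOrd O) (setOf O x) x | FP.all? (λ i → Mi.K? i (part i x)) | All.all? (λ z → FP.any? λ i → vertex? i z) x
  ... | yes e | yes k | yes c = yes (parts-join (subst (Sorted O) e (setOf-sorted x)) k (All.lookup c))
  ... | no n | _ | _ = no λ j → n (setOf-id (proj₁ j))
  ... | yes _ | no n | _ = no λ j → n (proj₁ (join-parts j))
  ... | yes _ | yes _ | no n = no λ j → n (All.tabulate (proj₂ (join-parts j)))

  J-down : ∀ {x y} → J∋ x → Sorted O y → (∀ {z} → z ∈ y → z ∈ x) → J∋ y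
  J-down {x} {y} k s f = parts-join s
    (λ i → Mi.K-down i (proj₁ (join-parts k) i) (part-sorted i s) λ z∈ → let zy , zi = ∈-part⁻ {i} {y} z∈ in ∈-part⁺ (f zy) zi)
    (λ z∈ → proj₂ (join-parts k) (f z∈))

  J-finite : Σ (List (List A)) λ L → ∀ x → J∋ x → x ∈ L
  J-finite = sublists Vs , λ x k → ∈-sublists (proj₁ k) (setOf-sorted (concat (tabulate verts))) λ z∈ →
      let i , zi = proj₂ (join-parts k) z∈ in
      ∈-setOf⁺ (concat (tabulate verts)) (∈-concat⁺′ (∈-concat⁺′ (here refl) (proj₂ (Mi.K-finite i) _ zi)) (∈-tabulate⁺ {f = verts} i))
    where
    verts : Fin m → List A
    verts i = concat (proj₁ (Mi.K-finite i))
    Vs = setOf O (concat (tabulate verts))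

  topped : ∀ x i → Set
  topped x i = part i x ≡ tops i

  topped? : ∀ x i → Dec (topped x i)
  topped? x i = eqV (ListOrd O) (part i x) (tops i)

  top : List A
  top = J tops

  tops-K : ∀ i → Ss i ∋ tops i
  tops-K i = Mi.K-top i

  top-J : J∋ top
  top-J = J-join tops tops-K

  bound : ∀ {x} → J∋ x → length x ≤ length top
  bound {x} k = subst₂ _≤_ (sym (length-parts k)) (sym (length-J tops tops-K))
    (sum-≤ (λ i → length (part i x)) (length ∘ tops) λ i → Mi.K-bound i (proj₁ (join-parts k) i))

  mate-cases : ∀ x → (Σ (Fin m) (FirstFailure (topped x))) ⊎ (∀ i → topped x i) → Maybe A
  mate-cases x (inj₁ (i , _)) = Mi.mate i (part i x)
  mate-cases x (inj₂ _) = nothing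

  mate : List A → Maybe A
  mate x with J? x
  ... | no _ = nothing
  ... | yes _ = mate-cases x (first-failure (topped x) (topped? x))

  mate-at : ∀ {x i} → J∋ x → FirstFailure (topped x) i → mate x ≡ Mi.mate i (part i x)
  mate-at {x} {i} k f with J? x
  ... | no n = ⊥-elim (n k)
  ... | yes _ with first-failure (topped x) (topped? x)
  ...   | inj₂ all = ⊥-elim (proj₁ f (all i))
  ...   | inj₁ (j , g) with first-failure-unique f g
  ...     | refl = refl

  record Lower (x : List A) (v : A) : Set where
    field
      simplex : J∋ x
      index : Fin m
      failure : FirstFailure (topped x) index
      mate-part : Mi.mate index (part index x) ≡ just v

  lower : ∀ {x v} → mate x ≡ just v → Lower x v
  lower {x} e with J? x
  ... | yes k with first-failure (topped x) (topped? x)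
  ...   | inj₁ (i , f) = record { simplex = k ; index = i ; failure = f ; mate-part = e }

  module _ {x v} (low : Lower x v) where
    open Lower low renaming (index to i)

    v-vertex : Ss i ∋ (v ∷ [])
    v-vertex = vertex-of (proj₂ (Mi.mate-K i mate-part)) (∈-setOf⁺ (v ∷ part i x) (here refl))

    v∉x : v ∉ x
    v∉x v∈ = Mi.mate-new i mate-part (∈-part⁺ v∈ v-vertex)

    up : List A
    up = setOf O (v ∷ x)

    part-up-same : part i up ≡ setOf O (v ∷ part i x)
    part-up-same = sorted-ext (part-sorted i (setOf-sorted (v ∷ x))) (setOf-sorted (v ∷ part i x)) to from
      where
      to : ∀ {z} → z ∈ part i up → z ∈ setOf O (v ∷ part i x)
      to z∈ with ∈-part⁻ {i} {up} z∈
      ... | zu , zi with ∈-setOf⁻ (v ∷ x) zu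
      ...   | here e = ∈-setOf⁺ (v ∷ part i x) (here e)
      ...   | there zx = ∈-setOf⁺ (v ∷ part i x) (there (∈-part⁺ zx zi))
      from : ∀ {z} → z ∈ setOf O (v ∷ part i x) → z ∈ part i up
      from z∈ with ∈-setOf⁻ (v ∷ part i x) z∈
      ... | here refl = ∈-part⁺ (∈-setOf⁺ (v ∷ x) (here refl)) v-vertex
      ... | there zp = let zx , zi = ∈-part⁻ {i} {x} zp in ∈-part⁺ (∈-setOf⁺ (v ∷ x) (there zx)) zi

    part-up-other : ∀ {j} → j ≢ i → part j up ≡ part j x
    part-up-other {j} n = sorted-ext (part-sorted j (setOf-sorted (v ∷ x))) (part-sorted j (proj₁ simplex)) to
      λ z∈ → let zx , zj = ∈-part⁻ {j} {x} z∈ in ∈-part⁺ (∈-setOf⁺ (v ∷ x) (there zx)) zj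
      where
      to : ∀ {z} → z ∈ part j up → z ∈ part j x
      to z∈ with ∈-part⁻ {j} {up} z∈
      ... | zu , zj with ∈-setOf⁻ (v ∷ x) zu
      ...   | here refl = ⊥-elim (n (vertex-index zj v-vertex))
      ...   | there zx = ∈-part⁺ zx zj

    up-J : J∋ up
    up-J = parts-join (setOf-sorted (v ∷ x)) parts cov
      where
      parts : ∀ j → Ss j ∋ part j up
      parts j with j FP.≟ i
      ... | yes refl = subst (Ss i ∋_) (sym part-up-same) (proj₂ (Mi.mate-K i mate-part))
      ... | no n = subst (Ss j ∋_) (sym (part-up-other n)) (proj₁ (join-parts simplex) j)
      cov : ∀ {z} → z ∈ up → Σ (Fin m) λ j → Ss j ∋ (z ∷ [])
      cov z∈ with ∈-setOf⁻ (v ∷ x) z∈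
      ... | here refl = i , v-vertex
      ... | there zx = proj₂ (join-parts simplex) zx

    up-≢tops : part i up ≢ tops i
    up-≢tops e = Mi.mate-≢top i mate-part (trans (sym part-up-same) e)

    -- Adding `v` does not complete factor `i`, because an upper simplex is never the top of its
    -- factor; so both members of a pair select the same factor.
    up-failure : FirstFailure (topped up) i
    up-failure = up-≢tops , λ j lt → trans (part-up-other (λ e → FP.<-irrefl e lt)) (proj₂ failure j lt)

    up-unmated : mate up ≡ nothing
    up-unmated = trans (mate-at up-J up-failure) (trans (cong (Mi.mate i) part-up-same) (Mi.mate-upper i mate-part))

  -- If the selected factor moved forward, the factor selected by `x` would be complete in `y`,
  -- hence in `x ∪ {v}`, and its upper partner would be its top simplex.
  descent-index : ∀ {x y v w} (lx : Lower x v) (ly : Lower y w) → (∀ {z} → z ∈ y → z ∈ v ∷ x) →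
                  ¬ (Lower.index lx F.< Lower.index ly)
  descent-index {x} {y} {v} {w} lx ly y⊆ lt = Mi.mate-≢top i (Lower.mate-part lx)
    (sym (sorted-⊆-≡ (Mi.K-sorted i (tops-K i)) (setOf-sorted (v ∷ part i x)) sub
      (Mi.K-bound i (proj₂ (Mi.mate-K i (Lower.mate-part lx))))))
    where
    i = Lower.index lx
    sub : ∀ {z} → z ∈ tops i → z ∈ setOf O (v ∷ part i x)
    sub z∈ with ∈-part⁻ {i} {y} (subst (_ ∈_) (sym (proj₂ (Lower.failure ly) i lt)) z∈)
    ... | zy , zi with y⊆ zy
    ...   | here e = ∈-setOf⁺ (v ∷ part i x) (here e)
    ...   | there zx = ∈-setOf⁺ (v ∷ part i x) (there (∈-part⁺ zx zi))

  -- The sizes of `x` and `y` agree in total, and no part of `y` exceeds that of `x`: outside factor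
  -- `i` it is a subset, and inside a larger part would be the upper partner, which has no mate. So
  -- all sizes agree.
  descent-part : ∀ {x y} (d : Descent mate y x) (lx : Lower x (Descent.v d)) (ly : Lower y (Descent.w d)) →
                 Lower.index lx ≡ Lower.index ly →
                 Descent (Mi.mate (Lower.index lx)) (part (Lower.index lx) y) (part (Lower.index lx) x)
  descent-part {x} {y} (descent {v} {w} ex ey v∈y y⊆ len) lx ly refl =
    descent (Lower.mate-part lx) (Lower.mate-part ly) (∈-part⁺ v∈y (v-vertex lx)) y-part⊆
      (ℕP.≤-antisym (part-≤ i) (sum-tight (λ j → length (part j y)) (λ j → length (part j x)) part-≤
        (trans (sym (length-parts (Lower.simplex ly))) (trans len (length-parts (Lower.simplex lx)))) i))
    where
    i = Lower.index lx
    y-part⊆ : ∀ {z} → z ∈ part i y → z ∈ v ∷ part i x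
    y-part⊆ z∈ with ∈-part⁻ {i} {y} z∈
    ... | zy , zi with y⊆ zy
    ...   | here e = here e
    ...   | there zx = there (∈-part⁺ zx zi)
    part-≤ : ∀ j → length (part j y) ≤ length (part j x)
    part-≤ j with j FP.≟ i
    ... | no n = length-⊆ (sorted-unique (part-sorted j (proj₁ (Lower.simplex ly)))) sub
      where
      sub : ∀ {z} → z ∈ part j y → z ∈ part j x
      sub z∈ with ∈-part⁻ {j} {y} z∈
      ... | zy , zj with y⊆ zy
      ...   | here refl = ⊥-elim (n (vertex-index zj (v-vertex lx)))
      ...   | there zx = ∈-part⁺ zx zj
    ... | yes refl = ℕP.≮⇒≥ λ lt → no-upper (sym (sorted-⊆-≡ (part-sorted i (proj₁ (Lower.simplex ly)))
            (setOf-sorted (v ∷ part i x)) (∈-setOf⁺ (v ∷ part i x) ∘ y-part⊆)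
            (ℕP.≤-trans (ℕP.≤-reflexive (length-setOf (v ∷ part i x) v∷-unique)) lt)))
      where
      v∷-unique : Unique (v ∷ part i x)
      v∷-unique = All.tabulate (λ m e → Mi.mate-new i (Lower.mate-part lx) (subst (_∈ part i x) (sym e) m)) ∷
        sorted-unique (part-sorted i (proj₁ (Lower.simplex lx)))
      no-upper : setOf O (v ∷ part i x) ≢ part i y
      no-upper e with trans (sym (Lower.mate-part ly)) (trans (cong (Mi.mate i) (sym e)) (Mi.mate-upper i (Lower.mate-part lx)))
      ... | ()

  -- The inner half of a lexicographic induction: a descent either moves the selected factor back or
  -- is a descent within that factor.
  lower-acc-in : ∀ i → (∀ {j} → j F.< i → ∀ {y w} (ly : Lower y w) → Lower.index ly ≡ j → Acc (Descent mate) y) →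
                 ∀ a → Acc (Descent (Mi.mate i)) a → ∀ {x v} (lx : Lower x v) → Lower.index lx ≡ i →
                 part i x ≡ a → Acc (Descent mate) x
  lower-acc-in i earlier a (acc ra) {x} {v} lx refl refl =
    acc λ {y} d → next y d (lower (Descent.mate-x d)) (lower (Descent.mate-y d))
    where
    next : ∀ y (d : Descent mate y x) → Lower x (Descent.v d) → (ly : Lower y (Descent.w d)) → Acc (Descent mate) y
    next y d lx' ly with first-failure-unique (Lower.failure lx) (Lower.failure lx')
    ... | refl with FP.<-cmp (Lower.index ly) i
    ...   | tri< lt _ _ = earlier lt ly refl
    ...   | tri≈ _ e _ = lower-acc-in i earlier (part i y) (ra (descent-part d lx' ly (sym e))) ly e refl
    ...   | tri> _ _ gt = ⊥-elim (descent-index lx' ly (Descent.y⊆ d) gt)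

  lower-acc : ∀ i → Acc F._<_ i → ∀ {x v} (lx : Lower x v) → Lower.index lx ≡ i → Acc (Descent mate) x
  lower-acc i (acc rs) lx e = lower-acc-in i (λ lt → lower-acc _ (rs lt)) _ (Mi.◁-wf i _) lx e refl

  mate-wf : ∀ x → Acc (Descent mate) x
  mate-wf x = acc λ {y} d → let ly = lower (Descent.mate-y d) in lower-acc (Lower.index ly) (F-<-wellFounded _) ly refl

  top-unmated : mate top ≡ nothing
  top-unmated = go (mate top) refl
    where
    go : ∀ r → mate top ≡ r → mate top ≡ nothing
    go nothing e = e
    go (just v) e = let l = lower {top} {v} e in ⊥-elim (proj₁ (Lower.failure l) (part-J tops tops-K (Lower.index l)))

  -- If some factor is incomplete, the first such part is unmated there and so arises by adding a
  -- vertex `v`. Dropping `v` from `x` leaves the same factor selected, since a matched part is not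
  -- the top.
  mate-cover : ∀ {x} → J∋ x → mate x ≡ nothing → x ≡ top ⊎ Σ A λ v → Σ (List A) λ y → mate y ≡ just v × x ≡ setOf O (v ∷ y)
  mate-cover {x} k e with first-failure (topped x) (topped? x)
  ... | inj₂ all = inj₁ (parts-≡ k top-J λ i → trans (all i) (sym (part-J tops tops-K i)))
  ... | inj₁ (i , f) with Mi.cover i (proj₁ (join-parts k) i) (trans (sym (mate-at k f)) e)
  ...   | inj₁ t = ⊥-elim (proj₁ f t)
  ...   | inj₂ (v , yᵢ , eᵢ , partx) = inj₂ (v , y , trans (mate-at y-J y-failure) (trans (cong (Mi.mate i) party) eᵢ) ,
            sorted-ext (proj₁ k) (setOf-sorted (v ∷ y)) to from)
    where
    ne? : ∀ z → Dec (z ≢ v)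
    ne? z = ¬? (eqV O z v)
    y = filter ne? x
    y⊆x : ∀ {z} → z ∈ y → z ∈ x
    y⊆x z∈ = proj₁ (∈-filter⁻ ne? {xs = x} z∈)
    v∈part : v ∈ part i x
    v∈part = subst (v ∈_) (sym partx) (∈-setOf⁺ (v ∷ yᵢ) (here refl))
    y-sorted : Sorted O y
    y-sorted = Linked-filter⁺ ne? ≺-trans (proj₁ k)
    y-J : J∋ y
    y-J = J-down k y-sorted y⊆x
    party : part i y ≡ yᵢ
    party = sorted-ext (part-sorted i y-sorted) (Mi.K-sorted i (proj₁ (Mi.mate-K i eᵢ))) p q
      where
      p : ∀ {z} → z ∈ part i y → z ∈ yᵢ
      p z∈ with ∈-part⁻ {i} {y} z∈
      ... | zy , zi with ∈-setOf⁻ (v ∷ yᵢ) (subst (_ ∈_) partx (∈-part⁺ (y⊆x zy) zi))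
      ...   | here refl = ⊥-elim (proj₂ (∈-filter⁻ ne? {xs = x} zy) refl)
      ...   | there m' = m'
      q : ∀ {z} → z ∈ yᵢ → z ∈ part i y
      q {z} z∈ with ∈-part⁻ {i} {x} (subst (z ∈_) (sym partx) (∈-setOf⁺ (v ∷ yᵢ) (there z∈)))
      ... | zx , zi = ∈-part⁺ (∈-filter⁺ ne? zx λ { refl → Mi.mate-new i eᵢ z∈ }) zi
    partj : ∀ {j} → j ≢ i → part j y ≡ part j x
    partj {j} n = sorted-ext (part-sorted j y-sorted) (part-sorted j (proj₁ k))
      (λ z∈ → let zy , zj = ∈-part⁻ {j} {y} z∈ in ∈-part⁺ (y⊆x zy) zj)
      (λ z∈ → let zx , zj = ∈-part⁻ {j} {x} z∈ in
        ∈-part⁺ (∈-filter⁺ ne? zx λ { refl → n (vertex-index zj (proj₂ (∈-part⁻ {i} {x} v∈part))) }) zj)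
    y-failure : FirstFailure (topped y) i
    y-failure = (λ t → unmated (trans (sym party) t)) , λ j lt → trans (partj (λ e' → FP.<-irrefl e' lt)) (proj₂ f j lt)
      where
      unmated : yᵢ ≢ tops i
      unmated refl with trans (sym eᵢ) (Mi.mate-top i)
      ... | ()
    to : ∀ {z} → z ∈ x → z ∈ setOf O (v ∷ y)
    to {z} z∈ with eqV O z v
    ... | yes refl = ∈-setOf⁺ (v ∷ y) (here refl)
    ... | no n = ∈-setOf⁺ (v ∷ y) (there (∈-filter⁺ ne? z∈ n))
    from : ∀ {z} → z ∈ setOf O (v ∷ y) → z ∈ x
    from z∈ with ∈-setOf⁻ (v ∷ y) z∈
    ... | here refl = proj₁ (∈-part⁻ {i} {x} v∈part)
    ... | there zy = y⊆x zy

  join-matching : Matching O J∋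
  join-matching = record
    { K-sorted = proj₁
    ; K? = J?
    ; K-down = J-down
    ; K-finite = J-finite
    ; top = top
    ; K-top = top-J
    ; K-bound = bound
    ; mate = mate
    ; mate-top = top-unmated
    ; mate-new = λ {x} {v} e → v∉x (lower {x} {v} e)
    ; mate-K = λ {x} {v} e → Lower.simplex (lower {x} {v} e) , up-J (lower {x} {v} e)
    ; mate-upper = λ {x} {v} e → up-unmated (lower {x} {v} e)
    ; mate-≢top = λ {x} {v} e e' → let l = lower {x} {v} e in
        up-≢tops l (trans (cong (part (Lower.index l)) e') (part-J tops tops-K (Lower.index l)))
    ; cover = mate-cover
    ; ◁-wf = mate-wf
    }

-- Unit coefficients of the top cycle

module Facets (O : Ordered) (≺-trans : Transitive (_≺_ O)) where
  private
    A = Carrier O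
  open Sorting O ≺-trans
  open FacetVertex O ≺-trans

  missing-vertex : ∀ {α β} → Sorted O β → suc (length α) ≡ length β → Σ A λ v → v ∈ β × v ∉ α
  missing-vertex {α} {β} q e = go (new-vertex α β) refl
    where
    go : ∀ r → new-vertex α β ≡ r → Σ A λ v → v ∈ β × v ∉ α
    go (just v) e' = v , new-vertex-just α β e'
    go nothing e' = ⊥-elim (ℕP.<-irrefl refl (subst (_≤ length α) (sym e)
      (length-⊆ (sorted-unique q) (new-vertex-nothing α β e'))))

  δκ-nonface : ∀ {α} l → ¬ (∀ {z} → z ∈ α → z ∈ l) → δ (κ α) l ≡ + 0
  δκ-nonface {α} l n = ⟨⟩-0S (faces l) (faces-face l) λ t (_ , sub) →
    κ-≢ {α} t λ e → n λ m → sub (∈-setOf⁻ t (subst (_ ∈_) (sym e) m))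

  -- Evaluate at `v ∷ α`, with `v` the vertex missing from `α`: deleting `v` gives `α`, and every
  -- other face still contains `v`. Sorting then changes only the sign.
  δκ-facet : ∀ {α β} → Sorted O α → Sorted O β → (∀ {z} → z ∈ α → z ∈ β) → suc (length α) ≡ length β →
             IsUnit (δ (κ α) β)
  δκ-facet {α} {β} p q f e with missing-vertex q e
  ... | v , v∈ , v∉ = subst IsUnit (unit-cancel (proj₁ (proj₂ ue)) (begin
      s * s                    ≡⟨ unit-square (proj₁ (proj₂ ue)) ⟩
      + 1                      ≡⟨ sym at-v∷α ⟩
      δ (κ α) (v ∷ α)          ≡⟨ proj₂ (proj₂ ue) (Alt-δ (Alt-κ α)) ⟩
      s * δ (κ α) (setOf O (v ∷ α)) ≡⟨ cong (λ b → s * δ (κ α) b) (facet-vertex p q f e v∈ v∉) ⟩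
      s * δ (κ α) β ∎)) (proj₁ (proj₂ ue))
    where
    open ≡-Reasoning
    ue = unitExt (v ∷ α) (All.tabulate (λ k e' → v∉ (subst (_∈ α) (sym e') k)) ∷ sorted-unique p)
    s = proj₁ ue
    at-v∷α : δ (κ α) (v ∷ α) ≡ + 1
    at-v∷α = trans (δ-∷ (κ α) v α) (cong₂ _-_ (κ-refl p) (⟨⟩-0S (faces α) (faces-face α) λ t _ →
      κ-≢ {α} (v ∷ t) λ e' → v∉ (subst (v ∈_) e' (∈-setOf⁺ (v ∷ t) (here refl)))))

  -- The coefficient of `∂ z` at `α` involves only the two top simplices through `α`, each with
  -- incidence ±1. Since it vanishes, their coefficients agree up to sign.
  unit-across : (K : List A → Set) (N : ℕ) (z : FC (List A)) → Supp (λ l → K (setOf O l) × length l ≡ N) z →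
    (∀ {Φ} → Alt Φ → ⟨ δ Φ , z ⟩ ≡ + 0) → ∀ {α β₁ β₂} → Sorted O α → Sorted O β₁ → Sorted O β₂ → β₁ ≢ β₂ →
    (∀ {v} → v ∈ α → v ∈ β₁) → (∀ {v} → v ∈ α → v ∈ β₂) → suc (length α) ≡ length β₁ → suc (length α) ≡ length β₂ →
    (∀ {β} → K β → length β ≡ N → (∀ {v} → v ∈ α → v ∈ β) → β ≡ β₁ ⊎ β ≡ β₂) →
    IsUnit ⟨ κ β₁ , z ⟩ → IsUnit ⟨ κ β₂ , z ⟩
  unit-across K N z sp cyc {α} {β₁} {β₂} s s₁ s₂ ne f₁ f₂ e₁ e₂ only u =
    subst IsUnit (solve-for a₂-unit balance) (unit-neg (unit-* a₂-unit (unit-* a₁-unit u)))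
    where
    open ≡-Reasoning
    a₁ = δ (κ α) β₁
    a₂ = δ (κ α) β₂
    a₁-unit = δκ-facet s s₁ f₁ e₁
    a₂-unit = δκ-facet s s₂ f₂ e₂
    at : ∀ t → K t → length t ≡ N → Sorted O t → δ (κ α) t ≡ a₁ * κ β₁ t + a₂ * κ β₂ t
    at t k len st with eqV (ListOrd O) t β₁ | eqV (ListOrd O) t β₂
    ... | yes refl | yes refl = ⊥-elim (ne refl)
    ... | yes refl | no n = sym (trans (cong₂ (λ x y → a₁ * x + a₂ * y) (κ-refl st) (κ-≢ t (n ∘ trans (sym (setOf-id st)))))
            (lem a₁ a₂))
      where
      lem : ∀ x y → x * + 1 + y * + 0 ≡ x
      lem = solve-∀
    ... | no n | yes refl = sym (trans (cong₂ (λ x y → a₁ * x + a₂ * y) (κ-≢ t (n ∘ trans (sym (setOf-id st)))) (κ-refl st))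
            (lem a₁ a₂))
      where
      lem : ∀ x y → x * + 0 + y * + 1 ≡ y
      lem = solve-∀
    ... | no n₁ | no n₂ = trans (δκ-nonface t λ sub → case (only k len sub))
            (sym (trans (cong₂ (λ x y → a₁ * x + a₂ * y) (κ-≢ t (n₁ ∘ trans (sym (setOf-id st)))) (κ-≢ t (n₂ ∘ trans (sym (setOf-id st)))))
              (lem a₁ a₂)))
      where
      case : t ≡ β₁ ⊎ t ≡ β₂ → ⊥
      case (inj₁ e) = n₁ e
      case (inj₂ e) = n₂ e
      lem : ∀ x y → x * + 0 + y * + 0 ≡ + 0
      lem = solve-∀
    balance : a₁ * ⟨ κ β₁ , z ⟩ + a₂ * ⟨ κ β₂ , z ⟩ ≡ + 0
    balance = begin
      a₁ * ⟨ κ β₁ , z ⟩ + a₂ * ⟨ κ β₂ , z ⟩ ≡⟨ sym (cong₂ _+_ (⟨⟩-* a₁ (κ β₁) z) (⟨⟩-* a₂ (κ β₂) z)) ⟩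
      ⟨ (λ l → a₁ * κ β₁ l) , z ⟩ + ⟨ (λ l → a₂ * κ β₂ l) , z ⟩ ≡⟨ sym (⟨⟩-+ (λ l → a₁ * κ β₁ l) (λ l → a₂ * κ β₂ l) z) ⟩
      ⟨ (λ l → a₁ * κ β₁ l + a₂ * κ β₂ l) , z ⟩ ≡⟨ ⟨⟩-congS z sp (λ l (k , len) → sym (altExt (Alt-δ (Alt-κ α))
          (Alt-+ (Alt-* a₁ (Alt-κ β₁)) (Alt-* a₂ (Alt-κ β₂))) l λ len' → at (setOf O l) k (trans len' len) (setOf-sorted l))) ⟩
      ⟨ δ (κ α) , z ⟩ ≡⟨ cyc (Alt-κ α) ⟩
      + 0 ∎
    solve-for : ∀ {a x y} → IsUnit a → x + a * y ≡ + 0 → - (a * x) ≡ y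
    solve-for {a} {x} {y} ua e = begin
      - (a * x) ≡⟨ lem a x y ⟩
      - (a * (x + a * y)) + a * a * y ≡⟨ cong₂ (λ u v → - (a * u) + v * y) e (unit-square ua) ⟩
      - (a * + 0) + + 1 * y ≡⟨ lem' a y ⟩
      y ∎
      where
      lem : ∀ a x y → - (a * x) ≡ - (a * (x + a * y)) + a * a * y
      lem = solve-∀
      lem' : ∀ a y → - (a * + 0) + + 1 * y ≡ y
      lem' = solve-∀

-- Exchanges one coordinate at a time. Families are functions, and pointwise equal ones are not
-- identified, so `P` has to respect pointwise equality.
coordinatewise : {X : Set} → ∀ n (Q : Fin n → X → Set) (P : (Fin n → X) → Set) →
  (∀ {τ τ'} → (∀ i → τ i ≡ τ' i) → P τ → P τ') →
  (∀ τ j a → (∀ i → Q i (τ i)) → Q j a → P τ → P (updateAt τ j (λ _ → a))) →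
  ∀ τ τ' → (∀ i → Q i (τ i)) → (∀ i → Q i (τ' i)) → P τ → P τ'
coordinatewise zero Q P resp change τ τ' q q' p = resp (λ ()) p
coordinatewise {X} (suc n) Q P resp change τ τ' q q' p =
  resp (λ { F.zero → refl ; (F.suc i) → refl })
    (coordinatewise n (Q ∘ F.suc) (λ ρ → P (τ' F.zero ◂ ρ))
      (λ e → resp λ { F.zero → refl ; (F.suc i) → e i })
      (λ ρ j a r s → resp (λ { F.zero → refl ; (F.suc i) → refl }) ∘
        change (τ' F.zero ◂ ρ) (F.suc j) a (λ { F.zero → q' F.zero ; (F.suc i) → r i }) s)
      (τ ∘ F.suc) (τ' ∘ F.suc) (q ∘ F.suc) (q' ∘ F.suc)
      (resp (λ { F.zero → refl ; (F.suc i) → refl }) (change τ F.zero (τ' F.zero) q (q' F.zero) p)))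
  where
  _◂_ : X → (Fin n → X) → Fin (suc n) → X
  (a ◂ ρ) F.zero = a
  (a ◂ ρ) (F.suc i) = ρ i

sum-update : ∀ {n} (f g : Fin n → ℕ) j → suc (f j) ≡ g j → (∀ i → i ≢ j → f i ≡ g i) →
             suc (sum (tabulate f)) ≡ sum (tabulate g)
sum-update {suc n} f g F.zero e h = cong₂ ℕ._+_ e (cong sum (LP.tabulate-cong λ i → h (F.suc i) λ ()))
sum-update {suc n} f g (F.suc j) e h = trans (sym (ℕP.+-suc (f F.zero) (sum (tabulate (f ∘ F.suc)))))
  (cong₂ ℕ._+_ (h F.zero λ ()) (sum-update (f ∘ F.suc) (g ∘ F.suc) j e λ i ne → h (F.suc i) (ne ∘ FP.suc-injective)))

module JoinUnits (O : Ordered) (≺-trans : Transitive (_≺_ O)) {m : ℕ} (Ss : Fin m → Cx O)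
  (Ms : (i : Fin m) → Matching O (Ss i ∋_)) (disjoint : PairwiseDisjoint Ss) (ds : Fin m → ℕ)
  (top-length : ∀ i → length (Matching.top (Ms i)) ≡ suc (ds i)) (isP : ∀ i → IsPseudomanifold (Ss i) (ds i)) where
  private
    A = Carrier O
    module Mi (i : Fin m) = Matching (Ms i)
    module Pi (i : Fin m) = IsPseudomanifold (isP i)
  open Sorting O ≺-trans
  open FacetVertex O ≺-trans
  open Facets O ≺-trans
  open JoinMatching O ≺-trans Ss Ms disjoint
  open Contraction O ≺-trans J∋ join-matching

  Top : ∀ i → List A → Set
  Top i a = Ss i ∋ a × length a ≡ suc (ds i)

  J-cong : ∀ {τ τ'} → (∀ i → τ i ≡ τ' i) → J τ ≡ J τ'
  J-cong e = cong (setOf O ∘ concat) (LP.tabulate-cong e)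

  _[_≔_] : (Fin m → List A) → Fin m → List A → Fin m → List A
  τ [ j ≔ a ] = updateAt τ j (λ _ → a)

  update-elim : ∀ (P : Fin m → List A → Set) {τ j a} → P j a → (∀ i → i ≢ j → P i (τ i)) → ∀ i → P i ((τ [ j ≔ a ]) i)
  update-elim P {τ} {j} {a} p q i with i FP.≟ j
  ... | yes refl = subst (P i) (sym (updateAt-updates i τ)) p
  ... | no n = subst (P i) (sym (updateAt-minimal i j τ n)) (q i n)

  full : ∀ {x} → J∋ x → length x ≡ length top → ∀ i → length (part i x) ≡ suc (ds i)
  full {x} k e i = trans (ℕP.≤-antisym (Mi.K-bound i (proj₁ (join-parts k) i))
    (sum-tight (λ i → length (part i x)) (length ∘ tops) (λ i → Mi.K-bound i (proj₁ (join-parts k) i))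
      (trans (sym (length-parts k)) (trans e (length-J tops tops-K))) i)) (top-length i)

  module _ (τ : Fin m → List A) (Top-τ : ∀ i → Top i (τ i)) (j : Fin m) {α : List A} (α-K : Ss j ∋ α)
    (α-length : length α ≡ ds j) where

    J-K : ∀ {b} → Ss j ∋ b → ∀ i → Ss i ∋ (τ [ j ≔ b ]) i
    J-K k = update-elim (λ i a → Ss i ∋ a) k λ i _ → proj₁ (Top-τ i)

    J-⊆ : ∀ {b} → (∀ {z} → z ∈ α → z ∈ b) → ∀ {z} → z ∈ J (τ [ j ≔ α ]) → z ∈ J (τ [ j ≔ b ])
    J-⊆ {b} f {z} z∈ = let i , zi = ∈-J⁻ (τ [ j ≔ α ]) z∈ in ∈-J⁺ (τ [ j ≔ b ]) i (mono i zi)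
      where
      mono : ∀ i → z ∈ (τ [ j ≔ α ]) i → z ∈ (τ [ j ≔ b ]) i
      mono i zi with i FP.≟ j
      ... | yes refl = subst (z ∈_) (sym (updateAt-updates i τ)) (f (subst (z ∈_) (updateAt-updates i τ) zi))
      ... | no n = subst (z ∈_) (sym (updateAt-minimal i j τ n)) (subst (z ∈_) (updateAt-minimal i j τ n) zi)

    J-facet : ∀ {b} → Top j b → suc (length (J (τ [ j ≔ α ]))) ≡ length (J (τ [ j ≔ b ]))
    J-facet {b} (kb , lb) = trans (cong suc (length-J _ (J-K α-K)))
      (trans (sum-update (length ∘ (τ [ j ≔ α ])) (length ∘ (τ [ j ≔ b ])) j
        (trans (cong (suc ∘ length) (updateAt-updates j τ)) (trans (cong suc α-length)
          (trans (sym lb) (cong length (sym (updateAt-updates j τ))))))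
        λ i n → trans (cong length (updateAt-minimal i j τ n)) (cong length (sym (updateAt-minimal i j τ n))))
      (sym (length-J _ (J-K kb))))

    -- Each part of a top simplex of the join has top size. Outside factor `j` the part is therefore
    -- already determined, and in factor `j` the premise `only` leaves two choices.
    J-cofaces : ∀ {b₁ b₂ x} → Ss j ∋ b₁ → Ss j ∋ b₂ →
      (∀ β → Ss j ∋ β → length β ≡ suc (ds j) → _⊆_ O α β → β ≡ b₁ ⊎ β ≡ b₂) →
      J∋ x → length x ≡ length top → (∀ {z} → z ∈ J (τ [ j ≔ α ]) → z ∈ x) → x ≡ J (τ [ j ≔ b₁ ]) ⊎ x ≡ J (τ [ j ≔ b₂ ])
    J-cofaces {b₁} {b₂} {x} k₁ k₂ only k e f = case (only (part j x) (proj₁ (join-parts k) j) (full k e j) λ z z∈ →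
        ∈-part⁺ (f (∈-J⁺ (τ [ j ≔ α ]) j (subst (z ∈_) (sym (updateAt-updates j τ)) z∈))) (vertex-of α-K z∈))
      where
      others : ∀ i → i ≢ j → part i x ≡ τ i
      others i n = sym (sorted-⊆-≡ (Mi.K-sorted i (proj₁ (Top-τ i))) (part-sorted i (proj₁ k))
        (λ {z} z∈ → ∈-part⁺ (f (∈-J⁺ (τ [ j ≔ α ]) i (subst (z ∈_) (sym (updateAt-minimal i j τ n)) z∈)))
          (vertex-of (proj₁ (Top-τ i)) z∈))
        (ℕP.≤-reflexive (trans (full k e i) (sym (proj₂ (Top-τ i))))))
      rebuild : ∀ {b} → Ss j ∋ b → part j x ≡ b → x ≡ J (τ [ j ≔ b ])
      rebuild kb eb = parts-≡ k (J-join _ (J-K kb)) λ i →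
        trans (update-elim (λ i a → part i x ≡ a) eb others i) (sym (part-J _ (J-K kb) i))
      case : part j x ≡ b₁ ⊎ part j x ≡ b₂ → x ≡ J (τ [ j ≔ b₁ ]) ⊎ x ≡ J (τ [ j ≔ b₂ ])
      case (inj₁ e₁) = inj₁ (rebuild k₁ e₁)
      case (inj₂ e₂) = inj₂ (rebuild k₂ e₂)

    flip-unit : ∀ {b₁ b₂} → b₁ ≢ b₂ → Top j b₁ → Top j b₂ → _⊆_ O α b₁ → _⊆_ O α b₂ →
      (∀ β → Ss j ∋ β → length β ≡ suc (ds j) → _⊆_ O α β → β ≡ b₁ ⊎ β ≡ b₂) →
      IsUnit ⟨ κ (J (τ [ j ≔ b₁ ])) , η ⟩ → IsUnit ⟨ κ (J (τ [ j ≔ b₂ ])) , η ⟩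
    flip-unit {b₁} {b₂} ne t₁ t₂ f₁ f₂ only = unit-across J∋ (length top) η η-Supp δη
      (setOf-sorted (concat (tabulate (τ [ j ≔ α ])))) (setOf-sorted (concat (tabulate (τ [ j ≔ b₁ ]))))
      (setOf-sorted (concat (tabulate (τ [ j ≔ b₂ ]))))
      (λ e → ne (trans (at (proj₁ t₁)) (trans (cong (part j) e) (sym (at (proj₁ t₂))))))
      (J-⊆ (f₁ _)) (J-⊆ (f₂ _)) (J-facet t₁) (J-facet t₂) (J-cofaces (proj₁ t₁) (proj₁ t₂) only)
      where
      at : ∀ {b} → Ss j ∋ b → b ≡ part j (J (τ [ j ≔ b ]))
      at kb = sym (trans (part-J _ (J-K kb) j) (updateAt-updates j τ))

  adjacent-unit : ∀ τ (Top-τ : ∀ i → Top i (τ i)) j {a b} → Top j a → Top j b → Adjacent {O} (ds j) a b →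
    IsUnit ⟨ κ (J (τ [ j ≔ a ])) , η ⟩ → IsUnit ⟨ κ (J (τ [ j ≔ b ])) , η ⟩
  adjacent-unit τ Top-τ j {a} {b} (ka , la) (kb , lb) (α , sα , lα , αa , αb) u
    with Pi.thin j α kα lα
    where kα = Mi.K-down j ka sα (αa _)
  ... | b₁ , b₂ , ne , k₁ , k₂ , l₁ , l₂ , f₁ , f₂ , only with only a ka la αa | only b kb lb αb
  ...   | inj₁ refl | inj₁ refl = u
  ...   | inj₂ refl | inj₂ refl = u
  ...   | inj₁ refl | inj₂ refl = flip-unit τ Top-τ j (Mi.K-down j ka sα (αa _)) lα ne (k₁ , l₁) (k₂ , l₂) f₁ f₂ only u
  ...   | inj₂ refl | inj₁ refl = flip-unit τ Top-τ j (Mi.K-down j ka sα (αa _)) lα (ne ∘ sym) (k₂ , l₂) (k₁ , l₁) f₂ f₁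
            (λ β k l f → Sum.swap (only β k l f)) u

  connected-unit : ∀ τ (Top-τ : ∀ i → Top i (τ i)) j {a b} → Top j a → Connected (Ss j) (ds j) a b →
    IsUnit ⟨ κ (J (τ [ j ≔ a ])) , η ⟩ → IsUnit ⟨ κ (J (τ [ j ≔ b ])) , η ⟩
  connected-unit τ Top-τ j t stop u = u
  connected-unit τ Top-τ j t (step k l adj c) u =
    connected-unit τ Top-τ j (k , l) c (adjacent-unit τ Top-τ j t (k , l) adj u)

  -- Starts at the top simplex of the matching, where the coefficient is 1, and exchanges one factor
  -- at a time along a chain of adjacent top simplices in that factor, the others staying fixed.
  η-unit : ∀ {x} → J∋ x → length x ≡ length top → IsUnit ⟨ κ x , η ⟩
  η-unit {x} k e = subst (λ x → IsUnit ⟨ κ x , η ⟩) (J-parts k)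
    (coordinatewise m Top (λ τ → IsUnit ⟨ κ (J τ) , η ⟩)
      (λ e → subst (λ x → IsUnit ⟨ κ x , η ⟩) (J-cong e))
      (λ τ j a T Ta u → connected-unit τ T j (T j) (Pi.strongly-connected j (τ j) a (proj₁ (T j)) (proj₁ Ta) (proj₂ (T j)) (proj₂ Ta))
        (subst (λ x → IsUnit ⟨ κ x , η ⟩) (J-cong (λ i → sym (update-elim (λ i a → a ≡ τ i) {τ} {j} refl (λ _ _ → refl) i))) u))
      tops (λ i → part i x) (λ i → Mi.K-top i , top-length i) (λ i → proj₁ (join-parts k) i , full k e i)
      (inj₁ κtop-η))

-- Barycentric subdivision

-- The invariant carried through subdivision in place of a matching. `N` counts the vertices of a
-- top simplex.
record Fundamental (O : Ordered) (≺-trans : Transitive (_≺_ O)) (K : Cx O) (N : ℕ) : Set where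
  private
    A = Carrier O
  open Sorting O ≺-trans
  Simplex : List A → Set
  Simplex l = K ∋ setOf O l × length l ≡ N
  field
    K-sorted : ∀ {x} → K ∋ x → Sorted O x
    K? : ∀ x → Dec (K ∋ x)
    K-down : ∀ {x y} → K ∋ x → Sorted O y → (∀ {z} → z ∈ y → z ∈ x) → K ∋ y
    K-bound : ∀ {x} → K ∋ x → length x ≤ N
    facet : List A
    facet-K : K ∋ facet
    facet-length : length facet ≡ N
    cycle : FC (List A)
    cycle-Supp : Supp Simplex cycle
    cycle-closed : ∀ {Φ} → Alt Φ → ⟨ δ Φ , cycle ⟩ ≡ + 0
    cycle-unit : ∀ {x} → K ∋ x → length x ≡ N → IsUnit ⟨ κ x , cycle ⟩
    generates : ∀ c → Supp Simplex c → (∀ {Φ} → Alt Φ → ⟨ δ Φ , c ⟩ ≡ + 0) →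
                Σ ℤ λ n → ∀ {Φ} → Alt Φ → ⟨ Φ , c ⟩ ≡ n * ⟨ Φ , cycle ⟩

δ-map : {A B : Set} (f : A → B) (Φ : List B → ℤ) (l : List A) → δ Φ (map f l) ≡ δ (Φ ∘ map f) l
δ-map f Φ [] = refl
δ-map f Φ (x ∷ l) = trans (δ-∷ Φ (f x) (map f l)) (trans (cong (λ u → Φ (map f l) - u) (δ-map f (Φ ∘ (f x ∷_)) l))
  (sym (δ-∷ (Φ ∘ map f) x l)))

⟨δ-cone⟩ : {B : Set} (Φ : List B → ℤ) (v : B) (c : FC (List B)) →
           ⟨ δ Φ ∘ (v ∷_) , c ⟩ ≡ ⟨ Φ , c ⟩ - ⟨ δ (Φ ∘ (v ∷_)) , c ⟩
⟨δ-cone⟩ Φ v c = trans (⟨⟩-cong c (δ-∷ Φ v)) (⟨⟩-- Φ (δ (Φ ∘ (v ∷_))) c)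

∈-swap : {X : Set} (xs : List X) (a b : X) (ys : List X) {z : X} → z ∈ xs ++ a ∷ b ∷ ys → z ∈ xs ++ b ∷ a ∷ ys
∈-swap [] a b ys (here e) = there (here e)
∈-swap [] a b ys (there (here e)) = here e
∈-swap [] a b ys (there (there m)) = there (there m)
∈-swap (x ∷ xs) a b ys (here e) = here e
∈-swap (x ∷ xs) a b ys (there m) = there (∈-swap xs a b ys m)

map-unique-on : {X Y : Set} (f : X → Y) (l : List X) → (∀ {x y} → x ∈ l → y ∈ l → f x ≡ f y → x ≡ y) →
                Unique l → Unique (map f l)
map-unique-on f [] h [] = []
map-unique-on f (x ∷ l) h (n ∷ u) = All.tabulate (λ m e → let y , y∈ , e' = ∈-map⁻ f m in
    All.lookup n y∈ (h (here refl) (there y∈) (trans e e')))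
  ∷ map-unique-on f l (λ p q → h (there p) (there q)) u

module Subdivision (O : Ordered) (≺-trans : Transitive (_≺_ O)) where
  private
    A = Carrier O
    L = ListOrd O
    module L = Sorting L (Lex-trans O ≺-trans)
  open Sorting O ≺-trans
  open FacetVertex O ≺-trans
  private
    module RG = Carrier-recursion {A} {List A} (single []) (λ _ → []) (+ 1) (setOf O)

  -- Unlike `gS`, this is augmented: it sends the empty list to itself, so that the cone formula
  -- already covers vertices.
  G : List A → FC (List (List A))
  G = RG.R

  G-step : ∀ Φ x l → ⟨ Φ , G (x ∷ l) ⟩ ≡ δ (λ t → ⟨ Φ ∘ (setOf O (x ∷ l) ∷_) , G t ⟩) (x ∷ l)
  G-step Φ x l = trans (RG.R-step Φ x l) (trans (ℤP.+-identityˡ _) (ℤP.*-identityˡ _))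

  -- `∂ (v * G ∂ l) = G ∂ l - v * ∂ G ∂ l`, and the last term is `v * G ∂ ∂ l` by induction, hence
  -- 0.
  G-chain-map : ∀ Φ l → ⟨ δ Φ , G l ⟩ ≡ δ (λ t → ⟨ Φ , G t ⟩) l
  G-chain-map Φ l = go (length l) Φ l ℕP.≤-refl
    where
    go : ∀ n Φ l → length l ≤ n → ⟨ δ Φ , G l ⟩ ≡ δ (λ t → ⟨ Φ , G t ⟩) l
    go _ Φ [] _ = refl
    go (suc n) Φ (x ∷ l) (s≤s le) = begin
      ⟨ δ Φ , G (x ∷ l) ⟩ ≡⟨ G-step (δ Φ) x l ⟩
      δ (λ t → ⟨ δ Φ ∘ (v ∷_) , G t ⟩) (x ∷ l)
        ≡⟨ ⟨⟩-congS (faces (x ∷ l)) (faces-face (x ∷ l)) (λ t (e , _) → trans (⟨δ-cone⟩ Φ v (G t))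
             (cong (λ u → ⟨ Φ , G t ⟩ - u) (go n (Φ ∘ (v ∷_)) t (subst (_≤ n) (ℕP.suc-injective e) le)))) ⟩
      ⟨ (λ t → ⟨ Φ , G t ⟩ - δ Ψ t) , faces (x ∷ l) ⟩ ≡⟨ ⟨⟩-- (λ t → ⟨ Φ , G t ⟩) (δ Ψ) (faces (x ∷ l)) ⟩
      δ (λ t → ⟨ Φ , G t ⟩) (x ∷ l) - δ (δ Ψ) (x ∷ l) ≡⟨ cong (λ u → δ (λ t → ⟨ Φ , G t ⟩) (x ∷ l) - u) (δδ Ψ (x ∷ l)) ⟩
      δ (λ t → ⟨ Φ , G t ⟩) (x ∷ l) - + 0 ≡⟨ ℤP.+-identityʳ _ ⟩
      δ (λ t → ⟨ Φ , G t ⟩) (x ∷ l) ∎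
      where
      open ≡-Reasoning
      v = setOf O (x ∷ l)
      Ψ = λ t → ⟨ Φ ∘ (v ∷_) , G t ⟩

  G-AltPres : AltPres G
  G-AltPres = RG.R-AltPres (λ _ → alt λ _ _ _ _ → refl) λ xs a b ys → setOf-≡ (∈-swap xs a b ys) (∈-swap xs b a ys)

  -- The flag of an ordering of the vertices: the vertex sets of its nonempty final segments, the
  -- largest first.
  flag : List A → List (List A)
  flag [] = []
  flag (v ∷ l) = setOf O (v ∷ l) ∷ flag l

  length-flag : ∀ l → length (flag l) ≡ length l
  length-flag [] = refl
  length-flag (v ∷ l) = cong suc (length-flag l)

  flag-⊆ : ∀ {l σ} → σ ∈ flag l → ∀ {z} → z ∈ σ → z ∈ l
  flag-⊆ {v ∷ l} (here refl) z∈ = ∈-setOf⁻ (v ∷ l) z∈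
  flag-⊆ {v ∷ l} (there m) z∈ = there (flag-⊆ m z∈)

  flag-unique : ∀ {l} → Unique l → Unique (flag l)
  flag-unique [] = []
  flag-unique {v ∷ l} (n ∷ u) = All.tabulate (λ m e → All.lookup n (flag-⊆ m (subst (v ∈_) e (∈-setOf⁺ (v ∷ l) (here refl)))) refl)
    ∷ flag-unique u

  -- Expanding G (v ∷ l), only the face l opposite to v can produce the flag, since every
  -- other cone summand contains a proper face through v.
  flag-coefficient : ∀ {l} → Unique l → ∀ {Φ} → Alt Φ → (∀ {u σ} → σ ∈ u → σ ∉ flag l → Φ u ≡ + 0) →
                     ⟨ Φ , G l ⟩ ≡ Φ (flag l)
  flag-coefficient {[]} [] {Φ} a h = ⟨⟩-single Φ []
  flag-coefficient {v ∷ l} (n ∷ u) {Φ} a h = begin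
    ⟨ Φ , G (v ∷ l) ⟩ ≡⟨ G-step Φ v l ⟩
    δ Ψ (v ∷ l) ≡⟨ δ-∷ Ψ v l ⟩
    Ψ l - δ (Ψ ∘ (v ∷_)) l ≡⟨ cong₂ _-_ (flag-coefficient u (Alt-∷ a s) h') (⟨⟩-0S (faces l) (faces-face l) other) ⟩
    Φ (s ∷ flag l) - + 0 ≡⟨ ℤP.+-identityʳ _ ⟩
    Φ (s ∷ flag l) ∎
    where
    open ≡-Reasoning
    s = setOf O (v ∷ l)
    Ψ = λ t → ⟨ Φ ∘ (s ∷_) , G t ⟩
    Alt-dup-∈ : ∀ {Φ : List (List A) → ℤ} → Alt Φ → ∀ {a u} → a ∈ u → Φ (a ∷ u) ≡ + 0
    Alt-dup-∈ {Φ} aΦ {b} m with ∈-∃++ m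
    ... | as , bs , refl with Alt-shift (Alt-∷ aΦ b) as b bs
    ...   | inj₁ e = trans e (Alt-dup aΦ b (as ++ bs))
    ...   | inj₂ e = trans e (cong -_ (Alt-dup aΦ b (as ++ bs)))
    h' : ∀ {u σ} → σ ∈ u → σ ∉ flag l → Φ (s ∷ u) ≡ + 0
    h' {u} {σ} m n' with eqV L σ s
    ... | yes refl = Alt-dup-∈ a m
    ... | no ne = h (there m) λ { (here e) → ne e ; (there k) → n' k }
    other : ∀ t → FaceOf l t → Ψ (v ∷ t) ≡ + 0
    other t (len , sub) = trans (G-step (Φ ∘ (s ∷_)) v t) (zero-on (faces (v ∷ t)) λ r →
        zero-on {φ = λ w → Φ (s ∷ b ∷ w)} (G r) λ w → h {s ∷ b ∷ w} {b} (there (here refl)) b∉)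
      where
      b = setOf O (v ∷ t)
      zero-on : ∀ {X : Set} {φ : X → ℤ} (c : FC X) → (∀ x → φ x ≡ + 0) → ⟨ φ , c ⟩ ≡ + 0
      zero-on c e = trans (⟨⟩-cong c e) (⟨⟩-0 c)
      b∉ : b ∉ flag (v ∷ l)
      b∉ (here e) = ℕP.<-irrefl refl (subst (_≤ length (v ∷ t)) (trans (length-setOf (v ∷ l) (n ∷ u)) (cong suc len))
        (length-⊆ (sorted-unique (setOf-sorted (v ∷ l))) λ m → ∈-setOf⁻ (v ∷ t) (subst (_ ∈_) (sym e) m)))
      b∉ (there m) = All.lookup n (flag-⊆ m (∈-setOf⁺ (v ∷ t) (here refl))) refl

module SubdividedComplex (O : Ordered) (≺-trans : Transitive (_≺_ O)) (K : Cx O) (N' : ℕ)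
  (F : Fundamental O ≺-trans K (suc N')) where
  private
    A = Carrier O
    L = ListOrd O
    N = suc N'
    module L = Sorting L (Lex-trans O ≺-trans)
    module LF = FacetVertex L (Lex-trans O ≺-trans)
  open Sorting O ≺-trans
  open FacetVertex O ≺-trans
  open Facets O ≺-trans using (missing-vertex)
  open Subdivision O ≺-trans
  open DecMembership (eqV O) using (_∈?_)
  open Fundamental F

  -- The condition of `Bd K` without sortedness, since cones produce unsorted lists.
  Flag : List (List A) → Set
  Flag c = (∀ σ → σ ∈ c → K ∋ σ × σ ≢ []) × (∀ σ τ → σ ∈ c → τ ∈ c → _⊆_ O σ τ ⊎ _⊆_ O τ σ)

  Flag-⊆ : ∀ {c c'} → Flag c → (∀ {σ} → σ ∈ c' → σ ∈ c) → Flag c'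
  Flag-⊆ (k , t) f = (λ σ m → k σ (f m)) , λ σ τ m m' → t σ τ (f m) (f m')

  Flag⇒Bd : ∀ {c} → Flag c → Bd K ∋ setOf L c
  Flag⇒Bd {c} fl = L.setOf-sorted c , Flag-⊆ fl (L.∈-setOf⁻ c)

  Bd⇒Flag : ∀ {c} → Bd K ∋ setOf L c → Flag c
  Bd⇒Flag {c} (_ , fl) = Flag-⊆ fl (L.∈-setOf⁺ c)

  Flag? : ∀ c → Dec (Flag c)
  Flag? c with All.all? (λ σ → K? σ ×-dec ¬? (eqV L σ [])) c
             | All.all? (λ σ → All.all? (λ τ → All.all? (_∈? τ) σ ⊎-dec All.all? (_∈? σ) τ) c) c
  ... | yes k | yes t = yes ((λ σ m → All.lookup k m) , λ σ τ m m' → case (All.lookup (All.lookup t m) m'))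
    where
    case : ∀ {σ τ} → All (_∈ τ) σ ⊎ All (_∈ σ) τ → _⊆_ O σ τ ⊎ _⊆_ O τ σ
    case (inj₁ p) = inj₁ λ _ → All.lookup p
    case (inj₂ p) = inj₂ λ _ → All.lookup p
  ... | no n | _ = no λ (k , _) → n (All.tabulate (k _))
  ... | yes _ | no n = no λ (_ , t) → n (All.tabulate λ m → All.tabulate λ m' → case (t _ _ m m'))
    where
    case : ∀ {σ τ} → _⊆_ O σ τ ⊎ _⊆_ O τ σ → All (_∈ τ) σ ⊎ All (_∈ σ) τ
    case (inj₁ p) = inj₁ (All.tabulate (p _))
    case (inj₂ p) = inj₂ (All.tabulate (p _))

  Bd? : ∀ c → Dec (Bd K ∋ c)
  Bd? c with eqV (ListOrd L) (setOf L c) c | Flag? c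
  ... | yes e | yes fl = yes (subst (Sorted L) e (L.setOf-sorted c) , fl)
  ... | no n | _ = no λ (s , _) → n (L.setOf-id s)
  ... | yes _ | no n = no λ (_ , fl) → n fl

  flag-Flag : ∀ l → K ∋ setOf O l → Flag (flag l)
  flag-Flag l k = (λ σ m → K-down k (sorted l m) (λ z∈ → ∈-setOf⁺ l (flag-⊆ {l} m z∈)) , nonempty l m) , nested l
    where
    sorted : ∀ l {σ} → σ ∈ flag l → Sorted O σ
    sorted (v ∷ l) (here refl) = setOf-sorted (v ∷ l)
    sorted (v ∷ l) (there m) = sorted l m
    nonempty : ∀ l {σ} → σ ∈ flag l → σ ≢ []
    nonempty (v ∷ l) (here refl) = ∈⇒≢[] (∈-setOf⁺ (v ∷ l) (here refl))
    nonempty (v ∷ l) (there m) = nonempty l m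
    nested : ∀ l σ τ → σ ∈ flag l → τ ∈ flag l → _⊆_ O σ τ ⊎ _⊆_ O τ σ
    nested (v ∷ l) σ τ (here refl) (here refl) = inj₁ λ _ m → m
    nested (v ∷ l) σ τ (here refl) (there m) = inj₂ λ _ z∈ → ∈-setOf⁺ (v ∷ l) (there (flag-⊆ m z∈))
    nested (v ∷ l) σ τ (there m) (here refl) = inj₁ λ _ z∈ → ∈-setOf⁺ (v ∷ l) (there (flag-⊆ m z∈))
    nested (v ∷ l) σ τ (there m) (there m') = nested l σ τ m m'

  module _ {c : List (List A)} (fl : Flag c) (uc : Unique c) where

    sizes-unique : Unique (map length c)
    sizes-unique = map-unique-on length c same uc
      where
      same : ∀ {σ τ} → σ ∈ c → τ ∈ c → length σ ≡ length τ → σ ≡ τ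
      same {σ} {τ} m m' e with proj₂ fl σ τ m m'
      ... | inj₁ f = sorted-⊆-≡ (K-sorted (proj₁ (proj₁ fl σ m))) (K-sorted (proj₁ (proj₁ fl τ m'))) (f _) (ℕP.≤-reflexive (sym e))
      ... | inj₂ f = sym (sorted-⊆-≡ (K-sorted (proj₁ (proj₁ fl τ m'))) (K-sorted (proj₁ (proj₁ fl σ m))) (f _) (ℕP.≤-reflexive e))

    open SubsetLength ℕ._≟_ using () renaming (length-⊆ to ℕ-length-⊆; ⊆-full to ℕ-⊆-full)

    sizes-range : ∀ {k} → k ∈ map length c → k ∈ applyUpTo suc N
    sizes-range m with ∈-map⁻ length m
    ... | [] , σ∈ , refl = ⊥-elim (proj₂ (proj₁ fl _ σ∈) refl)
    ... | v ∷ σ , σ∈ , refl = ∈-applyUpTo⁺ suc (K-bound (proj₁ (proj₁ fl _ σ∈)))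

    -- Members of a flag have distinct sizes, and these lie between 1 and `N`.
    flag-bound : length c ≤ N
    flag-bound = subst₂ _≤_ (LP.length-map length c) (LP.length-applyUpTo suc N) (ℕ-length-⊆ sizes-unique sizes-range)

    -- A flag with as many members as a top simplex has vertices contains one simplex of every
    -- size, so it is the flag of an ordering of the vertices of its largest member.
    full-flag : length c ≡ N → Σ (List A) λ l → Unique l × K ∋ setOf O l × length l ≡ N × (∀ {σ} → σ ∈ flag l → σ ∈ c)
    full-flag lc = finish (build N ℕP.≤-refl)
      where
      member : ∀ n → n < N → Σ (List A) λ σ → σ ∈ c × suc n ≡ length σ
      member n lt = ∈-map⁻ length (ℕ-⊆-full sizes-unique sizes-range
        (ℕP.≤-reflexive (trans (LP.length-applyUpTo suc N) (trans (sym lc) (sym (LP.length-map length c)))))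
        (∈-applyUpTo⁺ suc lt))
      inside : ∀ l {σ} → Unique l → (∀ {ρ} → ρ ∈ flag l → ρ ∈ c) → σ ∈ c → suc (length l) ≡ length σ → ∀ {z} → z ∈ l → z ∈ σ
      inside l@(v ∷ l') {σ} u f m e z∈ with proj₂ fl (setOf O l) σ (f (here refl)) m
      ... | inj₁ g = g _ (∈-setOf⁺ l z∈)
      ... | inj₂ g = ⊥-elim (ℕP.<-irrefl refl (ℕP.≤-trans (ℕP.≤-reflexive e)
              (ℕP.≤-trans (length-⊆ (sorted-unique (K-sorted (proj₁ (proj₁ fl σ m)))) (g _)) (ℕP.≤-reflexive (length-setOf l u)))))
      build : ∀ n → n ≤ N → Σ (List A) λ l → Unique l × length l ≡ n × (∀ {σ} → σ ∈ flag l → σ ∈ c)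
      build zero _ = [] , [] , refl , λ ()
      build (suc n) le with build n (ℕP.<⇒≤ le) | member n le
      ... | l , u , len , f | σ , σ∈ , e = extend (missing-vertex sσ e')
        where
        sσ = K-sorted (proj₁ (proj₁ fl σ σ∈))
        e' : suc (length l) ≡ length σ
        e' = trans (cong suc len) e
        extend : (Σ A λ v → v ∈ σ × v ∉ l) → Σ (List A) λ l → Unique l × length l ≡ suc n × (∀ {σ} → σ ∈ flag l → σ ∈ c)
        extend (v , v∈ , v∉) = v ∷ l , u' , cong suc len , λ { (here refl) → subst (_∈ c) (sym set≡σ) σ∈ ; (there m) → f m }
          where
          u' : Unique (v ∷ l)
          u' = All.tabulate (λ k e'' → v∉ (subst (_∈ l) (sym e'') k)) ∷ u
          g : ∀ {z} → z ∈ v ∷ l → z ∈ σ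
          g (here refl) = v∈
          g (there k) = inside l u f σ∈ e' k
          set≡σ : setOf O (v ∷ l) ≡ σ
          set≡σ = setOf-ext sσ g (⊆-full u' g (ℕP.≤-reflexive (sym e')))
      finish : (Σ (List A) λ l → Unique l × length l ≡ N × (∀ {σ} → σ ∈ flag l → σ ∈ c)) →
               Σ (List A) λ l → Unique l × K ∋ setOf O l × length l ≡ N × (∀ {σ} → σ ∈ flag l → σ ∈ c)
      finish (v ∷ l , u , len , f) = v ∷ l , u , proj₁ (proj₁ fl _ (f (here refl))) , len , f

  Bd-bound : ∀ {c} → Bd K ∋ c → length c ≤ N
  Bd-bound (s , fl) = flag-bound fl (L.sorted-unique s)

  Face : List A → Set
  Face l = K ∋ setOf O l

  face-of : ∀ {l t} → FaceOf l t → Face l → Face t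
  face-of {l} {t} (_ , sub) k = K-down k (setOf-sorted t) λ m → ∈-setOf⁺ l (sub (∈-setOf⁻ t m))

  -- The carrier condition of the recursion: a flag inside `l` can still be coned to the barycentre
  -- of `l`.
  FlagIn : List A → List (List A) → Set
  FlagIn l w = Flag w × (∀ {σ z} → σ ∈ w → z ∈ σ → z ∈ l)

  flag-cons : ∀ {l w v} → FlagIn l w → (∀ {z} → z ∈ l → z ∈ v) → (∀ {z} → z ∈ v → z ∈ l) → K ∋ v → v ≢ [] → FlagIn l (v ∷ w)
  flag-cons {l} {w} {v} ((k , t) , sub) f g kv ne = ((λ { σ (here refl) → kv , ne ; σ (there m) → k σ m }) ,
      λ { σ τ (here refl) (here refl) → inj₁ λ _ z → z
        ; σ τ (here refl) (there m) → inj₂ λ _ z → f (sub m z)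
        ; σ τ (there m) (here refl) → inj₁ λ _ z → f (sub m z)
        ; σ τ (there m) (there m') → t σ τ m m' }) ,
    λ { (here refl) z → g z ; (there m) z → sub m z }

  G-Supp : ∀ l → Face l → Supp (λ w → FlagIn l w × length w ≡ length l) (G l)
  G-Supp = Carrier-recursion.R-Supp (single []) (λ _ → []) (+ 1) (setOf O) Face
    (λ l w → FlagIn l w × length w ≡ length l) face-of
    (λ _ → ((((λ _ ()) , λ _ _ ()) , λ ()) , refl) ∷ []) (λ _ _ _ → [])
    λ {l} {t} {w} k (len , sub) (fl , e) → flag-cons (weaken sub fl) (∈-setOf⁺ l) (∈-setOf⁻ l) k (nonempty l len) ,
      trans (cong suc e) (sym len)
    where
    weaken : ∀ {l t w} → (∀ {x} → x ∈ t → x ∈ l) → FlagIn t w → FlagIn l w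
    weaken sub (fl , f) = fl , λ m z → sub (f m z)
    nonempty : ∀ l {n} → length l ≡ suc n → setOf O l ≢ []
    nonempty (x ∷ l) e = ∈⇒≢[] (∈-setOf⁺ (x ∷ l) (here refl))

  -- Every term of `G t` contains the barycentre of `t`. So among top simplices a maximal flag
  -- occurs only in the subdivision of its largest member, and there with a sign as coefficient.
  flag-unit : ∀ {c} → Bd K ∋ c → length c ≡ N → IsUnit ⟨ L.κ c , ext G cycle ⟩
  flag-unit {c} (s , fl) lc with full-flag fl (L.sorted-unique s) lc
  ... | l , u , kl , ll , f = subst IsUnit (sym eq) (unit-* Θ-unit (cycle-unit kl (trans (length-setOf l u) ll)))
    where
    open ≡-Reasoning
    Θ : List A → ℤ
    Θ t = ⟨ L.κ c , G t ⟩
    Θ-alt : Alt Θ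
    Θ-alt = G-AltPres (L.Alt-κ c)
    top = setOf O l
    c⊆flag : ∀ {σ} → σ ∈ c → σ ∈ flag l
    c⊆flag = LF.⊆-full (flag-unique u) f (ℕP.≤-reflexive (trans lc (trans (sym ll) (sym (length-flag l)))))
    flag≡c : setOf L (flag l) ≡ c
    flag≡c = L.setOf-ext s f c⊆flag
    off-flag : ∀ {w σ} → σ ∈ w → σ ∉ flag l → L.κ c w ≡ + 0
    off-flag {w} m n = L.κ-≢ {c} w λ e → n (c⊆flag (subst (_ ∈_) e (L.∈-setOf⁺ w m)))
    -- `flag-coefficient` evaluates at the ordering `l`; the signs `e` and `e'` come from sorting
    -- `l` and sorting its flag.
    Θ-unit : IsUnit (Θ top)
    Θ-unit with unitExt l u | L.unitExt (flag l) (flag-unique u)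
    ... | e , ue , ee | e' , ue' , ee' = subst IsUnit (unit-cancel ue (begin
        e * (e * e')   ≡⟨ trans (sym (ℤP.*-assoc e e e')) (trans (cong (_* e') (unit-square ue)) (ℤP.*-identityˡ e')) ⟩
        e'             ≡⟨ sym (ℤP.*-identityʳ e') ⟩
        e' * + 1       ≡⟨ cong (e' *_) (sym (trans (cong (L.κ c) flag≡c) (L.κ-refl s))) ⟩
        e' * L.κ c (setOf L (flag l)) ≡⟨ sym (ee' (L.Alt-κ c)) ⟩
        L.κ c (flag l) ≡⟨ sym (flag-coefficient u (L.Alt-κ c) off-flag) ⟩
        Θ l            ≡⟨ ee Θ-alt ⟩
        e * Θ top ∎)) (unit-* ue ue')
    elsewhere : ∀ t → K ∋ t → length t ≡ N → t ≢ top → Θ t ≡ + 0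
    elsewhere [] k () n
    elsewhere (x ∷ t) k len n = trans (G-step (L.κ c) x t) (trans (⟨⟩-cong (faces (x ∷ t)) λ r →
        trans (⟨⟩-cong (G r) λ w → off-flag {b ∷ w} (here refl) b∉) (⟨⟩-0 (G r))) (⟨⟩-0 (faces (x ∷ t))))
      where
      b = setOf O (x ∷ t)
      b∉ : b ∉ flag l
      b∉ m = n (sorted-⊆-≡ (K-sorted k) (setOf-sorted l)
        (λ z∈ → ∈-setOf⁺ l (flag-⊆ m (∈-setOf⁺ (x ∷ t) z∈)))
        (ℕP.≤-reflexive (trans (length-setOf l u) (trans ll (sym len)))))
    at : ∀ t → K ∋ t → length t ≡ N → Θ t ≡ Θ top * κ top t
    at t k len with eqV L t top
    ... | yes e = trans (cong Θ e) (trans (sym (ℤP.*-identityʳ _))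
            (cong (Θ top *_) (sym (trans (cong (κ top) e) (κ-refl (setOf-sorted l))))))
    ... | no n = trans (elsewhere t k len n) (sym (trans (cong (Θ top *_) (κ-≢ t (n ∘ trans (sym (setOf-id (K-sorted k))))))
            (ℤP.*-zeroʳ (Θ top))))
    eq : ⟨ L.κ c , ext G cycle ⟩ ≡ Θ top * ⟨ κ top , cycle ⟩
    eq = trans (⟨⟩-ext (L.κ c) G cycle) (trans (⟨⟩-congS cycle cycle-Supp λ t (k , len) →
      altExt Θ-alt (Alt-* (Θ top) (Alt-κ top)) t λ len' → at (setOf O t) k (trans len' len)) (⟨⟩-* (Θ top) (κ top) cycle))

-- The subdivision operator is a homotopy inverse, on Bd K, of the simplicial map to K sending
-- the barycentre of σ to a chosen vertex of σ: so top cycles of Bd K come from K.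
module SubdividedCycle (O : Ordered) (≺-trans : Transitive (_≺_ O)) (K : Cx O) (N' : ℕ)
  (F : Fundamental O ≺-trans K (suc N')) where
  private
    A = Carrier O
    L = ListOrd O
    N = suc N'
    module L = Sorting L (Lex-trans O ≺-trans)
  open Sorting O ≺-trans
  open Subdivision O ≺-trans
  open Fundamental F
  open SubdividedComplex O ≺-trans K N' F

  -- The value of `pick` at the empty list, which no flag contains.
  default : A
  default with facet | facet-length
  ... | v ∷ _ | _ = v

  pick : List A → A
  pick [] = default
  pick (x ∷ _) = x

  pick-∈ : ∀ {σ} → σ ≢ [] → pick σ ∈ σ
  pick-∈ {[]} n = ⊥-elim (n refl)
  pick-∈ {x ∷ σ} n = here refl

  -- The difference of the two chain maps to be joined by the homotopy; `D` cones `E - D ∂` to the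
  -- barycentre of the union.
  E : List (List A) → FC (List (List A))
  E w = G (map pick w) ++ scale (- (+ 1)) (single w)

  E-eval : ∀ Φ w → ⟨ Φ , E w ⟩ ≡ ⟨ Φ , G (map pick w) ⟩ - Φ w
  E-eval Φ w = trans (⟨⟩-++ Φ (G (map pick w)) _) (+-congˡ ⟨ Φ , G (map pick w) ⟩
    (trans (⟨⟩-scale Φ (- (+ 1)) (single w)) (trans (ℤP.-1*i≡-i _) (cong -_ (⟨⟩-single Φ w)))))

  union : List (List A) → List A
  union = setOf O ∘ concat

  private
    module RD = Carrier-recursion {List A} {List A} [] E (- (+ 1)) union

  D : List (List A) → FC (List (List A))
  D = RD.R

  D-step : ∀ Φ x w → ⟨ Φ , D (x ∷ w) ⟩ ≡
    ⟨ Φ ∘ (union (x ∷ w) ∷_) , E (x ∷ w) ⟩ - δ (λ t → ⟨ Φ ∘ (union (x ∷ w) ∷_) , D t ⟩) (x ∷ w)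
  D-step Φ x w = trans (RD.R-step Φ x w) (+-congˡ ⟨ Φ ∘ (union (x ∷ w) ∷_) , E (x ∷ w) ⟩ (ℤP.-1*i≡-i _))

  -- `E` commutes with `∂`, so by induction `E w - D ∂ w` is a cycle, and the boundary of a cone
  -- over a cycle is that cycle.
  D-homotopy : ∀ Φ w → ⟨ δ Φ , D w ⟩ + δ (λ t → ⟨ Φ , D t ⟩) w ≡ ⟨ Φ , G (map pick w) ⟩ - Φ w
  D-homotopy Φ w = go (length w) Φ w ℕP.≤-refl
    where
    go : ∀ n Φ w → length w ≤ n → ⟨ δ Φ , D w ⟩ + δ (λ t → ⟨ Φ , D t ⟩) w ≡ ⟨ Φ , G (map pick w) ⟩ - Φ w
    go _ Φ [] _ = sym (ℤP.i≡j⇒i-j≡0 (⟨⟩-single Φ []))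
    go (suc n) Φ (x ∷ w) (s≤s le) = begin
      ⟨ δ Φ , D W ⟩ + dD Φ ≡⟨ cong (λ u → u + dD Φ) (D-step (δ Φ) x w) ⟩
      ⟨ δ Φ ∘ (v ∷_) , E W ⟩ - δ (λ t → ⟨ δ Φ ∘ (v ∷_) , D t ⟩) W + dD Φ
        ≡⟨ cong₂ (λ u y → u - y + dD Φ) (trans (⟨δ-cone⟩ Φ v (E W)) (cong (λ u → ⟨ Φ , E W ⟩ - u) δE))
             (trans (⟨⟩-congS (faces W) (faces-face W) (λ t (e , _) → trans (⟨δ-cone⟩ Φ v (D t))
                (cong (λ u → ⟨ Φ , D t ⟩ - u) (trans (lem₀ _ (δ (λ t → ⟨ Ψ , D t ⟩) t))
                  (cong (λ u → u - δ (λ t → ⟨ Ψ , D t ⟩) t) (go n Ψ t (subst (_≤ n) (ℕP.suc-injective e) le)))))))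
               inner) ⟩
      ⟨ Φ , E W ⟩ - (gΨ - δ Ψ W) - (dD Φ - (gΨ - δ Ψ W - + 0)) + dD Φ ≡⟨ lem ⟨ Φ , E W ⟩ (gΨ - δ Ψ W) (dD Φ) ⟩
      ⟨ Φ , E W ⟩ ≡⟨ E-eval Φ W ⟩
      ⟨ Φ , G (map pick W) ⟩ - Φ W ∎
      where
      open ≡-Reasoning
      W = x ∷ w
      v = union W
      Ψ = Φ ∘ (v ∷_)
      dD : (List (List A) → ℤ) → ℤ
      dD Φ = δ (λ t → ⟨ Φ , D t ⟩) W
      gΨ = δ (λ t → ⟨ Ψ , G (map pick t) ⟩) W
      lem₀ : ∀ u v → u ≡ u + v - v
      lem₀ = solve-∀
      lem : ∀ e r d → e - r - (d - (r - + 0)) + d ≡ e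
      lem = solve-∀
      δE : ⟨ δ Ψ , E W ⟩ ≡ gΨ - δ Ψ W
      δE = trans (E-eval (δ Ψ) W) (cong (λ u → u - δ Ψ W)
        (trans (G-chain-map Ψ (map pick W)) (δ-map pick (λ t → ⟨ Ψ , G t ⟩) W)))
      P Q : List (List A) → ℤ
      P t = ⟨ Ψ , G (map pick t) ⟩ - Ψ t
      Q = δ (λ t → ⟨ Ψ , D t ⟩)
      inner : ⟨ (λ t → ⟨ Φ , D t ⟩ - (P t - Q t)) , faces W ⟩ ≡ dD Φ - (gΨ - δ Ψ W - + 0)
      inner = trans (⟨⟩-- (λ t → ⟨ Φ , D t ⟩) (λ t → P t - Q t) (faces W)) (cong (λ u → dD Φ - u)
        (trans (⟨⟩-- P Q (faces W)) (cong₂ _-_ (⟨⟩-- (λ t → ⟨ Ψ , G (map pick t) ⟩) Ψ (faces W)) (δδ (λ t → ⟨ Ψ , D t ⟩) W))))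

  D-AltPres : AltPres D
  D-AltPres = RD.R-AltPres E-AltPres λ xs a b ys → setOf-≡ (mem xs a b ys) (mem xs b a ys)
    where
    E-AltPres : AltPres E
    E-AltPres {Φ} a = Alt-cong (λ w → sym (E-eval Φ w)) (Alt-+ (Alt-map pick (G-AltPres a)) (Alt-neg a))
    mem : ∀ xs a b ys {z} → z ∈ concat (xs ++ a ∷ b ∷ ys) → z ∈ concat (xs ++ b ∷ a ∷ ys)
    mem xs a b ys m with ∈-concat⁻′ (xs ++ a ∷ b ∷ ys) m
    ... | σ , z∈ , σ∈ = ∈-concat⁺′ z∈ (∈-swap xs a b ys σ∈)

  -- Inclusion is total on a flag, so the union is its largest member; this is why the cone in `D`
  -- stays within `Bd K`.
  union-∈ : ∀ x w → Flag (x ∷ w) → union (x ∷ w) ∈ x ∷ w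
  union-∈ x [] fl = here (setOf-ext (K-sorted (proj₁ (proj₁ fl x (here refl))))
    (λ m → subst (_ ∈_) (LP.++-identityʳ x) m) (λ m → subst (_ ∈_) (sym (LP.++-identityʳ x)) m))
  union-∈ x (y ∷ w) fl with union-∈ y w (Flag-⊆ fl there)
  ... | u∈ with proj₂ fl x (union (y ∷ w)) (here refl) (there u∈)
  ...   | inj₁ f = there (subst (_∈ y ∷ w) (setOf-≡ (∈-++⁺ʳ x) back) u∈)
    where
    back : ∀ {z} → z ∈ x ++ concat (y ∷ w) → z ∈ concat (y ∷ w)
    back m with ∈-++⁻ x m
    ... | inj₁ zx = ∈-setOf⁻ (concat (y ∷ w)) (f _ zx)
    ... | inj₂ zc = zc
  ...   | inj₂ f = here (setOf-ext (K-sorted (proj₁ (proj₁ fl x (here refl)))) back ∈-++⁺ˡ)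
    where
    back : ∀ {z} → z ∈ x ++ concat (y ∷ w) → z ∈ x
    back m with ∈-++⁻ x m
    ... | inj₁ zx = zx
    ... | inj₂ zc = f _ (∈-setOf⁺ (concat (y ∷ w)) zc)

  pick-concat : ∀ {w} → Flag w → ∀ {z} → z ∈ map pick w → z ∈ concat w
  pick-concat fl m with ∈-map⁻ pick m
  ... | σ , σ∈ , refl = ∈-concat⁺′ (pick-∈ (proj₂ (proj₁ fl σ σ∈))) σ∈

  pick-Face : ∀ w → Flag w → Face (map pick w)
  pick-Face [] fl = K-down facet-K [] λ ()
  pick-Face (x ∷ w) fl = K-down (proj₁ (proj₁ fl _ (union-∈ x w fl))) (setOf-sorted (map pick (x ∷ w))) λ m →
    ∈-setOf⁺ (concat (x ∷ w)) (pick-concat fl (∈-setOf⁻ (map pick (x ∷ w)) m))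

  D-Supp : ∀ w → Flag w → Supp (λ u → FlagIn (concat w) u × length u ≡ suc (length w)) (D w)
  D-Supp = RD.R-Supp Flag (λ w u → FlagIn (concat w) u × length u ≡ suc (length w))
    (λ (_ , sub) fl → Flag-⊆ fl sub) (λ _ → []) E-Supp
    λ { {x ∷ l} {t} fl (len , sub) (fi , e) → coned x l fl (weaken sub fi) , trans (cong suc e) (cong suc (sym len)) }
    where
    weaken : ∀ {l t : List (List A)} {u} → (∀ {x} → x ∈ t → x ∈ l) → FlagIn (concat t) u → FlagIn (concat l) u
    weaken {l} {t} sub (fl , f) = fl , λ m z → let σ , z∈ , σ∈ = ∈-concat⁻′ t (f m z) in ∈-concat⁺′ z∈ (sub σ∈)
    coned : ∀ x l {u} → Flag (x ∷ l) → FlagIn (concat (x ∷ l)) u → FlagIn (concat (x ∷ l)) (union (x ∷ l) ∷ u)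
    coned x l fl fi = flag-cons fi (∈-setOf⁺ (concat (x ∷ l))) (∈-setOf⁻ (concat (x ∷ l)))
      (proj₁ (proj₁ fl _ (union-∈ x l fl))) (proj₂ (proj₁ fl _ (union-∈ x l fl)))
    E-Supp : ∀ x l → Flag (x ∷ l) → Supp (λ u → FlagIn (concat (x ∷ l)) (union (x ∷ l) ∷ u) × suc (length u) ≡ suc (suc (length l))) (E (x ∷ l))
    E-Supp x l fl = AllP.++⁺
      (Supp-map (λ u ((fu , f) , e) → coned x l fl (fu , λ m z → pick-concat fl (f m z)) ,
          cong suc (trans e (LP.length-map pick (x ∷ l))))
        (G-Supp (map pick (x ∷ l)) (pick-Face (x ∷ l) fl)))
      ((coned x l fl (fl , λ m z → ∈-concat⁺′ z m) , refl) ∷ [])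

  Simplex′ : List (List A) → Set
  Simplex′ w = Bd K ∋ setOf L w × length w ≡ N

  -- On a top cycle `c` the homotopy contributes nothing: `D c` would exceed the top dimension, and
  -- `D ∂ c` is 0. So `c` is `G` of its image under `pick`, and that image is a multiple of the
  -- cycle of `K`.
  generated : ∀ c → Supp Simplex′ c → (∀ {Φ} → Alt Φ → ⟨ δ Φ , c ⟩ ≡ + 0) →
              Σ ℤ λ n → ∀ {Φ} → Alt Φ → ⟨ Φ , c ⟩ ≡ n * ⟨ Φ , ext G cycle ⟩
  generated c sp closed = proj₁ base , λ {Φ} a → begin
      ⟨ Φ , c ⟩ ≡⟨ sym (ℤP.i-j≡0⇒i≡j _ _ (trans (sym (⟨⟩-- (λ w → ⟨ Φ , G (map pick w) ⟩) Φ c)) (null a))) ⟩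
      ⟨ (λ w → ⟨ Φ , G (map pick w) ⟩) , c ⟩ ≡⟨ sym (⟨⟩-mapFC (λ t → ⟨ Φ , G t ⟩) (map pick) c) ⟩
      ⟨ (λ t → ⟨ Φ , G t ⟩) , mapFC (map pick) c ⟩ ≡⟨ proj₂ base (G-AltPres a) ⟩
      proj₁ base * ⟨ (λ t → ⟨ Φ , G t ⟩) , cycle ⟩ ≡⟨ cong (proj₁ base *_) (sym (⟨⟩-ext Φ G cycle)) ⟩
      proj₁ base * ⟨ Φ , ext G cycle ⟩ ∎
    where
    open ≡-Reasoning
    base = generates (mapFC (map pick) c)
      (Supp-mapFC (map pick) c sp λ w (k , e) → pick-Face w (Bd⇒Flag k) , trans (LP.length-map pick w) e)
      λ {Φ} a → trans (⟨⟩-mapFC (δ Φ) (map pick) c) (trans (⟨⟩-cong c (δ-map pick Φ)) (closed (Alt-map pick a)))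
    null : ∀ {Φ} → Alt Φ → ⟨ (λ w → ⟨ Φ , G (map pick w) ⟩ - Φ w) , c ⟩ ≡ + 0
    null {Φ} a = begin
      ⟨ (λ w → ⟨ Φ , G (map pick w) ⟩ - Φ w) , c ⟩ ≡⟨ ⟨⟩-cong c (λ w → sym (D-homotopy Φ w)) ⟩
      ⟨ (λ w → ⟨ δ Φ , D w ⟩ + δ (λ t → ⟨ Φ , D t ⟩) w) , c ⟩ ≡⟨ ⟨⟩-+ (λ w → ⟨ δ Φ , D w ⟩) (δ (λ t → ⟨ Φ , D t ⟩)) c ⟩
      ⟨ (λ w → ⟨ δ Φ , D w ⟩) , c ⟩ + ⟨ δ (λ t → ⟨ Φ , D t ⟩) , c ⟩ ≡⟨ cong₂ _+_
        (⟨⟩-0S c sp λ w (k , e) → ⟨⟩-0S (D w) (D-Supp w (Bd⇒Flag k)) λ u ((fu , _) , e') → L.Alt-0 (Alt-δ a) u λ len →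
          ⊥-elim (ℕP.<-irrefl refl (subst (_≤ N) (trans len (trans e' (cong suc e))) (Bd-bound (Flag⇒Bd fu)))))
        (closed (D-AltPres a)) ⟩
      + 0 ∎

  fundamental : Fundamental L (Lex-trans O ≺-trans) (Bd K) N
  fundamental = record
    { K-sorted = proj₁
    ; K? = Bd?
    ; K-down = λ (_ , fl) s f → s , Flag-⊆ fl f
    ; K-bound = Bd-bound
    ; facet = setOf L (flag facet)
    ; facet-K = Flag⇒Bd (flag-Flag facet (subst (K ∋_) (sym (setOf-id (K-sorted facet-K))) facet-K))
    ; facet-length = trans (L.length-setOf (flag facet) (flag-unique (sorted-unique (K-sorted facet-K))))
        (trans (length-flag facet) facet-length)
    ; cycle = ext G cycle
    ; cycle-Supp = Supp-ext G cycle cycle-Supp λ l (k , e) →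
        Supp-map (λ w ((fl , _) , e') → Flag⇒Bd fl , trans e' e) (G-Supp l k)
    ; cycle-closed = λ {Φ} a → trans (⟨⟩-ext (δ Φ) G cycle) (trans (⟨⟩-cong cycle (G-chain-map Φ)) (cycle-closed (G-AltPres a)))
    ; cycle-unit = flag-unit
    ; generates = generated
    }

-- Iterated subdivision and the induced self-map

module Iterated (O : Ordered) (≺-trans : Transitive (_≺_ O)) where
  private
    A = Carrier O
    module S (k : ℕ) = Subdivision (Lv k O) (Lv-trans k ≺-trans)

  Gᵏ : ∀ k → List A → FC (List (Carrier (Lv k O)))
  Gᵏ zero = single
  Gᵏ (suc k) = ext (S.G k) ∘ Gᵏ k

  ⟨⟩-Gᵏ-suc : ∀ k Φ l → ⟨ Φ , Gᵏ (suc k) l ⟩ ≡ ⟨ (λ u → ⟨ Φ , S.G k u ⟩) , Gᵏ k l ⟩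
  ⟨⟩-Gᵏ-suc k Φ l = ⟨⟩-ext Φ (S.G k) (Gᵏ k l)

  Gᵏ-AltPres : ∀ k → AltPres (Gᵏ k)
  Gᵏ-AltPres zero {Φ} a = Alt-cong (λ l → sym (⟨⟩-single Φ l)) a
  Gᵏ-AltPres (suc k) {Φ} a = AltPres-ext {T = S.G k} {U = Gᵏ k} (S.G-AltPres k) (Gᵏ-AltPres k) {Φ} a

  Gᵏ-chain-map : ∀ k Φ l → ⟨ δ Φ , Gᵏ k l ⟩ ≡ δ (λ t → ⟨ Φ , Gᵏ k t ⟩) l
  Gᵏ-chain-map zero Φ l = trans (⟨⟩-single (δ Φ) l) (⟨⟩-cong (faces l) λ t → sym (⟨⟩-single Φ t))
  Gᵏ-chain-map (suc k) Φ l = begin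
    ⟨ δ Φ , Gᵏ (suc k) l ⟩ ≡⟨ ⟨⟩-Gᵏ-suc k (δ Φ) l ⟩
    ⟨ (λ u → ⟨ δ Φ , S.G k u ⟩) , Gᵏ k l ⟩ ≡⟨ ⟨⟩-cong (Gᵏ k l) (S.G-chain-map k Φ) ⟩
    ⟨ δ (λ u → ⟨ Φ , S.G k u ⟩) , Gᵏ k l ⟩ ≡⟨ Gᵏ-chain-map k (λ u → ⟨ Φ , S.G k u ⟩) l ⟩
    δ (λ t → ⟨ (λ u → ⟨ Φ , S.G k u ⟩) , Gᵏ k t ⟩) l ≡⟨ ⟨⟩-cong (faces l) (λ t → sym (⟨⟩-Gᵏ-suc k Φ t)) ⟩
    δ (λ t → ⟨ Φ , Gᵏ (suc k) t ⟩) l ∎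
    where open ≡-Reasoning

  Gᵏ-augmented : ∀ k Φ → ⟨ Φ , Gᵏ k [] ⟩ ≡ Φ []
  Gᵏ-augmented zero Φ = ⟨⟩-single Φ []
  Gᵏ-augmented (suc k) Φ = trans (⟨⟩-Gᵏ-suc k Φ []) (trans (Gᵏ-augmented k (λ u → ⟨ Φ , S.G k u ⟩)) (⟨⟩-single Φ []))

  -- The barycentre of the image of a list is the image of its barycentre under the induced map, so
  -- the two recursions agree apex by apex.
  G-natural : ∀ k (f : Carrier (Lv k O) → Carrier (Lv k O)) Φ l →
    ⟨ Φ , S.G k (map f l) ⟩ ≡ ⟨ Φ ∘ map (λ σ → setOf (Lv k O) (map f σ)) , S.G k l ⟩
  G-natural k f Φ l = go (length l) Φ l ℕP.≤-refl
    where
    open ≡-Reasoning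
    F = λ σ → setOf (Lv k O) (map f σ)
    go : ∀ n Φ l → length l ≤ n → ⟨ Φ , S.G k (map f l) ⟩ ≡ ⟨ Φ ∘ map F , S.G k l ⟩
    go n Φ [] _ = refl
    go (suc n) Φ (x ∷ l) (s≤s le) = begin
      ⟨ Φ , S.G k (map f (x ∷ l)) ⟩ ≡⟨ S.G-step k Φ (f x) (map f l) ⟩
      δ (λ t → ⟨ Φ ∘ (F (x ∷ l) ∷_) , S.G k t ⟩) (map f (x ∷ l)) ≡⟨ δ-map f (λ t → ⟨ Φ ∘ (F (x ∷ l) ∷_) , S.G k t ⟩) (x ∷ l) ⟩
      δ (λ t → ⟨ Φ ∘ (F (x ∷ l) ∷_) , S.G k (map f t) ⟩) (x ∷ l)
        ≡⟨ ⟨⟩-congS (faces (x ∷ l)) (faces-face (x ∷ l)) (λ t (e , _) → trans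
             (go n (Φ ∘ (F (x ∷ l) ∷_)) t (subst (_≤ n) (ℕP.suc-injective e) le))
             (cong (λ v → ⟨ Φ ∘ (v ∷_) ∘ map F , S.G k t ⟩)
               (sym (map-setOf (Lv k O) (Lv k O) (Lv-trans k ≺-trans) f (x ∷ l))))) ⟩
      δ (λ t → ⟨ Φ ∘ map F ∘ (setOf (Lv k O) (x ∷ l) ∷_) , S.G k t ⟩) (x ∷ l) ≡⟨ sym (S.G-step k (Φ ∘ map F) x l) ⟩
      ⟨ Φ ∘ map F , S.G k (x ∷ l) ⟩ ∎

  Gᵏ-natural : ∀ k (h : A → A) Φ l → ⟨ Φ , Gᵏ k (map h l) ⟩ ≡ ⟨ Φ ∘ map (actk {O} h k 1) , Gᵏ k l ⟩
  Gᵏ-natural zero h Φ l = trans (⟨⟩-single Φ (map h l)) (sym (trans (⟨⟩-single (Φ ∘ map (iter h 1)) l)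
    (cong Φ (LP.map-cong (λ _ → refl) l))))
  Gᵏ-natural (suc k) h Φ l = begin
    ⟨ Φ , Gᵏ (suc k) (map h l) ⟩ ≡⟨ ⟨⟩-Gᵏ-suc k Φ (map h l) ⟩
    ⟨ (λ u → ⟨ Φ , S.G k u ⟩) , Gᵏ k (map h l) ⟩ ≡⟨ Gᵏ-natural k h (λ u → ⟨ Φ , S.G k u ⟩) l ⟩
    ⟨ (λ u → ⟨ Φ , S.G k (map (actk {O} h k 1) u) ⟩) , Gᵏ k l ⟩ ≡⟨ ⟨⟩-cong (Gᵏ k l) (G-natural k (actk {O} h k 1) Φ) ⟩
    ⟨ (λ u → ⟨ Φ ∘ map (actk {O} h (suc k) 1) , S.G k u ⟩) , Gᵏ k l ⟩ ≡⟨ sym (⟨⟩-Gᵏ-suc k (Φ ∘ map (actk {O} h (suc k) 1)) l) ⟩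
    ⟨ Φ ∘ map (actk {O} h (suc k) 1) , Gᵏ (suc k) l ⟩ ∎
    where open ≡-Reasoning

  module _ (K : Cx O) (N' : ℕ) (F : Fundamental O ≺-trans K (suc N')) where

    fundamentalᵏ : ∀ k → Fundamental (Lv k O) (Lv-trans k ≺-trans) (Bdk k K) (suc N')
    fundamentalᵏ zero = F
    fundamentalᵏ (suc k) = SubdividedCycle.fundamental (Lv k O) (Lv-trans k ≺-trans) (Bdk k K) N' (fundamentalᵏ k)

    cycleᵏ : ∀ k Φ → ⟨ Φ , Fundamental.cycle (fundamentalᵏ k) ⟩ ≡ ⟨ (λ l → ⟨ Φ , Gᵏ k l ⟩) , Fundamental.cycle F ⟩
    cycleᵏ zero Φ = ⟨⟩-cong (Fundamental.cycle F) λ l → sym (⟨⟩-single Φ l)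
    cycleᵏ (suc k) Φ = trans (⟨⟩-ext Φ (S.G k) (Fundamental.cycle (fundamentalᵏ k)))
      (trans (cycleᵏ k (λ u → ⟨ Φ , S.G k u ⟩)) (⟨⟩-cong (Fundamental.cycle F) λ l → sym (⟨⟩-Gᵏ-suc k Φ l)))

    Gᵏ-Supp : ∀ k l → K ∋ setOf O l → Supp (λ u → Bdk k K ∋ setOf (Lv k O) u × length u ≡ length l) (Gᵏ k l)
    Gᵏ-Supp zero l kl = (kl , refl) ∷ []
    Gᵏ-Supp (suc k) l kl = Supp-ext (S.G k) (Gᵏ k l) (Gᵏ-Supp k l kl) λ u (ku , e) →
      Supp-map (λ w ((fl , _) , e') → SC.Flag⇒Bd fl , trans e' e) (SC.G-Supp u ku)
      where
      module SC = SubdividedComplex (Lv k O) (Lv-trans k ≺-trans) (Bdk k K) N' (fundamentalᵏ k)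

module InducedMap (O : Ordered) (≺-trans : Transitive (_≺_ O)) (K : Cx O) (M : Matching O (K ∋_)) (N' : ℕ)
  (F : Fundamental O ≺-trans K (suc N')) (k : ℕ) (f : Carrier (Lv k O) → Carrier O)
  (f-simplicial : IsSimplicial {Lv k O} {O} (Bdk k K) K f) where
  private
    A = Carrier O
  open Iterated O ≺-trans
  open Lefschetz O ≺-trans (K ∋_) M

  ψ : List A → FC (List A)
  ψ l = mapFC (map f) (Gᵏ k l)

  ψ-eval : ∀ Φ l → ⟨ Φ , ψ l ⟩ ≡ ⟨ Φ ∘ map f , Gᵏ k l ⟩
  ψ-eval Φ l = ⟨⟩-mapFC Φ (map f) (Gᵏ k l)

  image-K : ∀ u → Bdk k K ∋ setOf (Lv k O) u → K ∋ setOf O (map f u)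
  image-K u ku = subst (K ∋_) (map-setOf (Lv k O) O ≺-trans f u) (f-simplicial _ ku)

  ψ-SelfMap : SelfMap ψ
  ψ-SelfMap = record
    { altPres = λ {Φ} a → Alt-cong (λ l → sym (ψ-eval Φ l)) (Gᵏ-AltPres k (Alt-map f a))
    ; chain-map = λ Φ l → trans (ψ-eval (δ Φ) l) (trans (⟨⟩-cong (Gᵏ k l) (δ-map f Φ))
        (trans (Gᵏ-chain-map k (Φ ∘ map f) l) (⟨⟩-cong (faces l) λ t → sym (ψ-eval Φ t))))
    ; preserves = λ l (kl , e) → Supp-mapFC (map f) (Gᵏ k l) (Gᵏ-Supp K N' F k l kl) λ u (ku , e') →
        image-K u ku , trans (LP.length-map f u) (trans e' e)
    ; augmented = λ Φ → trans (ψ-eval Φ []) (Gᵏ-augmented k (Φ ∘ map f))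
    }

  -- Equivariance of `f` is known only at vertices of `Bdᵏ K`, so the support of `Gᵏ k l` has to be
  -- controlled first.
  ψ-equivariant : (h : A → A) → (∀ w → VertexOf (Bdk k K) w → f (actk {O} h k 1 w) ≡ h (f w)) →
                  ∀ Φ l → K ∋ setOf O l → ⟨ Φ , ψ (map h l) ⟩ ≡ ⟨ Φ ∘ map h , ψ l ⟩
  ψ-equivariant h equi Φ l kl = begin
    ⟨ Φ , ψ (map h l) ⟩ ≡⟨ ψ-eval Φ (map h l) ⟩
    ⟨ Φ ∘ map f , Gᵏ k (map h l) ⟩ ≡⟨ Gᵏ-natural k h (Φ ∘ map f) l ⟩
    ⟨ Φ ∘ map f ∘ map (actk {O} h k 1) , Gᵏ k l ⟩
      ≡⟨ ⟨⟩-congS (Gᵏ k l) (Gᵏ-Supp K N' F k l kl) (λ u (ku , _) → cong Φ (trans (sym (LP.map-∘ u))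
           (trans (LP.map-cong-local (All.tabulate λ {w} m → equi w (setOf (Lv k O) u , ku , Order.∈-setOf⁺ (Lv k O) u m)))
             (LP.map-∘ u)))) ⟩
    ⟨ Φ ∘ map h ∘ map f , Gᵏ k l ⟩ ≡⟨ sym (ψ-eval (Φ ∘ map h) l) ⟩
    ⟨ Φ ∘ map h , ψ l ⟩ ∎
    where open ≡-Reasoning

-- Chains of oriented simplices and the degree

module _ {X Y : Set} where

  ⟨⟩-map-terms : (φ : Y → ℤ) (ψ : X → ℤ) (a : ℤ) (g : ℤ × X → ℤ × Y) →
    (∀ b x → proj₁ (g (b , x)) * φ (proj₂ (g (b , x))) ≡ a * (b * ψ x)) → ∀ c → ⟨ φ , map g c ⟩ ≡ a * ⟨ ψ , c ⟩
  ⟨⟩-map-terms φ ψ a g e [] = sym (ℤP.*-zeroʳ a)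
  ⟨⟩-map-terms φ ψ a g e ((b , x) ∷ c) = trans (cong₂ _+_ (e b x) (⟨⟩-map-terms φ ψ a g e c))
    (sym (ℤP.*-distribˡ-+ a (b * ψ x) ⟨ ψ , c ⟩))

  Supp-map-terms : (P : X → Set) (Q : Y → Set) (g : ℤ × X → ℤ × Y) → (∀ b x → P x → Q (proj₂ (g (b , x)))) →
    ∀ c → Supp P c → Supp Q (map g c)
  Supp-map-terms P Q g h [] [] = []
  Supp-map-terms P Q g h ((b , x) ∷ c) (p ∷ ps) = h b x p ∷ Supp-map-terms P Q g h c ps

⟨⟩-extC : {O O' : Ordered} (φ : List (Carrier O') → ℤ) (h : List (Carrier O) → Chain O') (c : Chain O) →
  ⟨ φ , Chain.terms (extC {O} {O'} h c) ⟩ ≡ ⟨ (λ s → ⟨ φ , Chain.terms (h s) ⟩) , Chain.terms c ⟩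
⟨⟩-extC φ h (chain []) = refl
⟨⟩-extC {O} {O'} φ h (chain ((a , s) ∷ c)) = trans (⟨⟩-++ φ (map _ (Chain.terms (h s))) (Chain.terms (extC {O} {O'} h (chain c))))
  (cong₂ _+_ (⟨⟩-map-terms φ φ a _ (λ b t → ℤP.*-assoc a b (φ t)) (Chain.terms (h s))) (⟨⟩-extC {O} {O'} φ h (chain c)))

Supp-extC : {O O' : Ordered} {P : List (Carrier O) → Set} {Q : List (Carrier O') → Set} (h : List (Carrier O) → Chain O') (c : Chain O) →
  Supp P (Chain.terms c) → (∀ s → P s → Supp Q (Chain.terms (h s))) → Supp Q (Chain.terms (extC {O} {O'} h c))
Supp-extC h (chain []) [] k = []
Supp-extC {O} {O'} {P} {Q} h (chain ((a , s) ∷ c)) (p ∷ ps) k =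
  AllP.++⁺ (Supp-map-terms Q Q _ (λ _ _ q → q) (Chain.terms (h s)) (k s p)) (Supp-extC {O} {O'} h (chain c) ps k)

⟨⟩-facesSigned : (O : Ordered) (φ : List (Carrier O) → ℤ) (l : List (Carrier O)) → ⟨ φ , facesSigned O l ⟩ ≡ δ φ l
⟨⟩-facesSigned O φ [] = refl
⟨⟩-facesSigned O φ (x ∷ l) = trans (cong₂ _+_ (ℤP.*-identityˡ (φ l))
    (trans (⟨⟩-map-terms φ (φ ∘ (x ∷_)) (- (+ 1)) _ (λ b t → lem b (φ (x ∷ t))) (facesSigned O l))
      (trans (ℤP.-1*i≡-i _) (cong -_ (⟨⟩-facesSigned O (φ ∘ (x ∷_)) l))))) (sym (δ-∷ φ x l))
  where
  lem : ∀ b u → - b * u ≡ - (+ 1) * (b * u)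
  lem = solve-∀

-- The bound on the length excludes vertices, whose boundary is 0 for `bdS` but the empty simplex
-- for `faces`.
⟨⟩-bdS : (O : Ordered) (φ : List (Carrier O) → ℤ) (l : List (Carrier O)) → 2 ≤ length l → ⟨ φ , Chain.terms (bdS O l) ⟩ ≡ δ φ l
⟨⟩-bdS O φ (x ∷ []) (s≤s ())
⟨⟩-bdS O φ (x ∷ y ∷ l) _ = ⟨⟩-facesSigned O φ (x ∷ y ∷ l)

module Chains (O : Ordered) (≺-trans : Transitive (_≺_ O)) where
  private
    A = Carrier O
    L = ListOrd O
    module L = Sorting L (Lex-trans O ≺-trans)
  open Sorting O ≺-trans
  open Subdivision O ≺-trans

  -- The empty list is excluded because `gS` and `G` differ there.
  Proper : List A → Set
  Proper s = Sorted O s × 1 ≤ length s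

  oriented-sorted : ∀ l → Supp (λ s → Sorted O s × length s ≡ length l) (Chain.terms (oriented O l))
  oriented-sorted l with sortView l
  ... | degenerate e _ _ rewrite e = []
  ... | proper n e len _ rewrite e = (setOf-sorted l , len) ∷ []

  ⟨⟩-oriented : ∀ {Φ} → Alt Φ → ∀ l → ⟨ Φ , Chain.terms (oriented O l) ⟩ ≡ Φ l
  ⟨⟩-oriented {Φ} a l = trans (oriented-oF Φ l) (oF-alt a l)

  facesSigned-sorted : ∀ l → Sorted O l → Supp (λ t → Sorted O t × length l ≡ suc (length t)) (facesSigned O l)
  facesSigned-sorted l s = Supp-map (λ t (p , f) → AllPairs⇒Linked p , proj₁ f) (go l (sorted-pairs s))
    where
    go : ∀ l → AllPairs (_≺_ O) l → Supp (λ t → AllPairs (_≺_ O) t × FaceOf l t) (facesSigned O l)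
    go [] [] = []
    go (x ∷ l) (p ∷ ps) = (ps , refl , there) ∷ Supp-map-terms (λ t → AllPairs (_≺_ O) t × FaceOf l t)
      (λ t → AllPairs (_≺_ O) t × FaceOf (x ∷ l) t) _
      (λ b t (q , e , sub) → All.tabulate (λ m → All.lookup p (sub m)) ∷ q , cong suc e , λ { (here r) → here r ; (there m) → there (sub m) })
      (facesSigned O l) (go l ps)

  -- Alternating cochains do not see the sorting inside `gS`, and for a sorted simplex `s` the apex
  -- `setOf O s` of `G` is `s` itself.
  gS-G : ∀ n {Φ} → Alt Φ → ∀ s → Proper s → length s ≤ n → ⟨ Φ , Chain.terms (gS O n s) ⟩ ≡ ⟨ Φ , G s ⟩
  gS-G n a [] (_ , ()) _
  gS-G n {Φ} a (v ∷ []) _ _ = trans (⟨⟩-single Φ ((v ∷ []) ∷ [])) (sym (trans (G-step Φ v [])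
    (trans (⟨⟩-single (λ t → ⟨ Φ ∘ ((v ∷ []) ∷_) , G t ⟩) []) (⟨⟩-single (Φ ∘ ((v ∷ []) ∷_)) []))))
  gS-G (suc n) {Φ} a s@(x ∷ y ∷ l) (st , _) (s≤s le) = begin
    ⟨ Φ , Chain.terms (gS O (suc n) s) ⟩
      ≡⟨ ⟨⟩-extC {L} {L} Φ (λ τ → oriented L (s ∷ τ)) (extC {O} {L} (gS O n) (bdS O s)) ⟩
    ⟨ (λ τ → ⟨ Φ , Chain.terms (oriented L (s ∷ τ)) ⟩) , Chain.terms (extC {O} {L} (gS O n) (bdS O s)) ⟩
      ≡⟨ ⟨⟩-cong (Chain.terms (extC {O} {L} (gS O n) (bdS O s))) (λ τ → trans (L.oriented-oF Φ (s ∷ τ)) (L.oF-alt a (s ∷ τ))) ⟩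
    ⟨ Φ ∘ (s ∷_) , Chain.terms (extC {O} {L} (gS O n) (bdS O s)) ⟩ ≡⟨ ⟨⟩-extC {O} {L} (Φ ∘ (s ∷_)) (gS O n) (bdS O s) ⟩
    ⟨ (λ t → ⟨ Φ ∘ (s ∷_) , Chain.terms (gS O n t) ⟩) , facesSigned O s ⟩
      ≡⟨ ⟨⟩-congS (facesSigned O s) (facesSigned-sorted s st) (λ t (pt , e) → gS-G n (Alt-∷ a s) t
           (pt , ℕP.≤-trans (s≤s z≤n) (ℕP.≤-reflexive (ℕP.suc-injective e))) (subst (_≤ n) (ℕP.suc-injective e) le)) ⟩
    ⟨ (λ t → ⟨ Φ ∘ (s ∷_) , G t ⟩) , facesSigned O s ⟩ ≡⟨ ⟨⟩-facesSigned O (λ t → ⟨ Φ ∘ (s ∷_) , G t ⟩) s ⟩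
    δ (λ t → ⟨ Φ ∘ (s ∷_) , G t ⟩) s ≡⟨ cong (λ v → δ (λ t → ⟨ Φ ∘ (v ∷_) , G t ⟩) s) (sym (setOf-id st)) ⟩
    δ (λ t → ⟨ Φ ∘ (setOf O s ∷_) , G t ⟩) s ≡⟨ sym (G-step Φ x (y ∷ l)) ⟩
    ⟨ Φ , G s ⟩ ∎
    where open ≡-Reasoning

  ProperL : List (List A) → Set
  ProperL s = Sorted L s × 1 ≤ length s

  gS-proper : ∀ n s → Supp ProperL (Chain.terms (gS O n s))
  gS-proper n [] = []
  gS-proper n (v ∷ []) = ([-] , s≤s z≤n) ∷ []
  gS-proper zero (_ ∷ _ ∷ _) = []
  gS-proper (suc n) s@(x ∷ y ∷ l) = Supp-extC {L} {L} {P = λ _ → ⊤} {Q = ProperL} (λ τ → oriented L (s ∷ τ))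
    (extC {O} {L} (gS O n) (bdS O s)) (All.tabulate λ _ → tt) λ τ _ → or τ
    where
    or : ∀ τ → Supp ProperL (Chain.terms (oriented L (s ∷ τ)))
    or τ with L.sortView (s ∷ τ)
    ... | L.degenerate e _ _ rewrite e = []
    ... | L.proper n e len _ rewrite e = (L.setOf-sorted (s ∷ τ) , ℕP.≤-trans (s≤s z≤n) (ℕP.≤-reflexive (sym len))) ∷ []

module IteratedChains (O : Ordered) (≺-trans : Transitive (_≺_ O)) where
  open Iterated O ≺-trans
  private
    A = Carrier O
    module C (k : ℕ) = Chains (Lv k O) (Lv-trans k ≺-trans)

  gk-proper : ∀ k c → Supp (C.Proper 0) (Chain.terms c) → Supp (C.Proper k) (Chain.terms (gk O k c))
  gk-proper zero c p = p
  gk-proper (suc k) c p = Supp-extC {Lv k O} {Lv (suc k) O} {P = λ _ → ⊤} {Q = C.Proper (suc k)}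
    (λ s → gS (Lv k O) (length s) s) (gk O k c) (All.tabulate λ _ → tt) λ s _ → C.gS-proper k (length s) s

  gk-Gᵏ : ∀ k c → Supp (C.Proper 0) (Chain.terms c) → ∀ {Φ} → Alt Φ →
          ⟨ Φ , Chain.terms (gk O k c) ⟩ ≡ ⟨ (λ t → ⟨ Φ , Gᵏ k t ⟩) , Chain.terms c ⟩
  gk-Gᵏ zero c p {Φ} a = ⟨⟩-cong (Chain.terms c) λ t → sym (⟨⟩-single Φ t)
  gk-Gᵏ (suc k) c p {Φ} a = begin
    ⟨ Φ , Chain.terms (gk O (suc k) c) ⟩ ≡⟨ ⟨⟩-extC {Lv k O} {Lv (suc k) O} Φ (λ s → gS (Lv k O) (length s) s) (gk O k c) ⟩
    ⟨ (λ s → ⟨ Φ , Chain.terms (gS (Lv k O) (length s) s) ⟩) , Chain.terms (gk O k c) ⟩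
      ≡⟨ ⟨⟩-congS (Chain.terms (gk O k c)) (gk-proper k c p) (λ s q → C.gS-G k (length s) a s q ℕP.≤-refl) ⟩
    ⟨ (λ s → ⟨ Φ , S.G s ⟩) , Chain.terms (gk O k c) ⟩ ≡⟨ gk-Gᵏ k c p (S.G-AltPres a) ⟩
    ⟨ (λ t → ⟨ (λ s → ⟨ Φ , S.G s ⟩) , Gᵏ k t ⟩) , Chain.terms c ⟩ ≡⟨ ⟨⟩-cong (Chain.terms c) (λ t → sym (⟨⟩-Gᵏ-suc k Φ t)) ⟩
    ⟨ (λ t → ⟨ Φ , Gᵏ (suc k) t ⟩) , Chain.terms c ⟩ ∎
    where
    open ≡-Reasoning
    module S = Subdivision (Lv k O) (Lv-trans k ≺-trans)

  -- Chains are equal when their coefficients are, whatever terms cancel inside. A functional pulled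
  -- back along `gk` lets one representative of a chain be replaced by another.
  gk-linear : ∀ k φ → Σ (List A → ℤ) λ φ' → ∀ c → ⟨ φ , Chain.terms (gk O k c) ⟩ ≡ ⟨ φ' , Chain.terms c ⟩
  gk-linear zero φ = φ , λ _ → refl
  gk-linear (suc k) φ with gk-linear k (λ s → ⟨ φ , Chain.terms (gS (Lv k O) (length s) s) ⟩)
  ... | φ' , e = φ' , λ c → trans (⟨⟩-extC {Lv k O} {Lv (suc k) O} φ (λ s → gS (Lv k O) (length s) s) (gk O k c)) (e c)

⟨⟩-filter : {X : Set} {P : X → Set} (P? : ∀ x → Dec (P x)) (φ : X → ℤ) → (∀ x → ¬ P x → φ x ≡ + 0) →
            ∀ c → ⟨ φ , c ⟩ ≡ ⟨ φ , filter (P? ∘ proj₂) c ⟩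
⟨⟩-filter P? φ h [] = refl
⟨⟩-filter P? φ h ((a , t) ∷ c) with P? t
... | yes _ = +-congˡ (a * φ t) (⟨⟩-filter P? φ h c)
... | no n = trans (cong₂ (λ u v → a * u + v) (h t n) (⟨⟩-filter P? φ h c))
        (trans (cong (_+ ⟨ φ , filter (P? ∘ proj₂) c ⟩) (ℤP.*-zeroʳ a)) (ℤP.+-identityˡ _))

matching-fundamental : (O : Ordered) (≺-trans : Transitive (_≺_ O)) (K : Cx O) (M : Matching O (K ∋_)) {N : ℕ} →
  length (Matching.top M) ≡ N → (∀ {x} → K ∋ x → length x ≡ length (Matching.top M) →
    IsUnit ⟨ Sorting.κ O ≺-trans x , Contraction.η O ≺-trans (K ∋_) M ⟩) →
  Fundamental O ≺-trans K N
matching-fundamental O ≺-trans K M {N} e units = record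
  { K-sorted = K-sorted
  ; K? = K?
  ; K-down = K-down
  ; K-bound = λ {x} k → subst (length x ≤_) e (K-bound k)
  ; facet = top
  ; facet-K = K-top
  ; facet-length = e
  ; cycle = η
  ; cycle-Supp = Supp-map (λ _ (k , l) → k , trans l e) η-Supp
  ; cycle-closed = δη
  ; cycle-unit = λ k l → units k (trans l (sym e))
  ; generates = λ c sp closed → ⟨ Sorting.κ O ≺-trans top , c ⟩ ,
      top-cycle c (Supp-map (λ _ (k , l) → k , trans l (sym e)) sp) closed
  }
  where
  open Matching M
  open Contraction O ≺-trans (K ∋_) M

module Orientations (O : Ordered) (≺-trans : Transitive (_≺_ O)) (K : Cx O) (D : ℕ)
  (F : Fundamental O ≺-trans K (suc D)) where
  private
    A = Carrier O
    N = suc D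
  open Sorting O ≺-trans
  open Bases O ≺-trans
  open Chains O ≺-trans
  open Fundamental F

  TopSimplex : List A → Set
  TopSimplex s = K ∋ s × length s ≡ N

  top? : ∀ s → Dec (TopSimplex s)
  top? s = K? s ×-dec (length s ℕ.≟ N)

  -- `coeff` compares lists literally, so the terms of `cycle` must be sorted before the cycle can
  -- be read as an orientation.
  normalize : FC (List A) → FC (List A)
  normalize = ext (λ l → Chain.terms (oriented O l))

  ⟨⟩-normalize : ∀ φ c → ⟨ φ , normalize c ⟩ ≡ ⟨ oF φ , c ⟩
  ⟨⟩-normalize φ c = trans (⟨⟩-ext φ (λ l → Chain.terms (oriented O l)) c) (⟨⟩-cong c (oriented-oF φ))

  SortedN : List A → Set
  SortedN s = Sorted O s × length s ≡ N

  normal-cycle : FC (List A)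
  normal-cycle = normalize cycle

  normal-cycle-sorted : Supp SortedN normal-cycle
  normal-cycle-sorted = Supp-ext (λ l → Chain.terms (oriented O l)) cycle cycle-Supp λ l (_ , e) →
    Supp-map (λ s (st , e') → st , trans e' e) (oriented-sorted l)

  coeff-normal-cycle : ∀ s → coeffL O normal-cycle s ≡ ⟨ κ s , cycle ⟩
  coeff-normal-cycle s = trans (coeffL-χ normal-cycle s) (⟨⟩-normalize (χ s) cycle)

  κ-off-top : ∀ {s} → ¬ TopSimplex s → ∀ c → Supp Simplex c → ⟨ κ s , c ⟩ ≡ + 0
  κ-off-top {s} n c sp = ⟨⟩-0S c sp λ l (k , e) → Alt-0 (Alt-κ s) l λ len →
    κ-≢ {s} (setOf O l) λ e' → n (subst TopSimplex (trans (sym (setOf-id (setOf-sorted l))) e') (k , trans len e))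

  TopSimplex⇒Simplex : ∀ {s} → TopSimplex s → Simplex s
  TopSimplex⇒Simplex (k , e) = subst (K ∋_) (sym (setOf-id (K-sorted k))) k , e

  coeff-∂ : ∀ φ c → ⟨ φ , Chain.terms (∂ {O} (chain c)) ⟩ ≡ ⟨ (λ s → ⟨ φ , Chain.terms (bdS O s) ⟩) , c ⟩
  coeff-∂ φ c = ⟨⟩-extC {O} {O} φ (bdS O) (chain c)

  length-1 : ∀ φ s → length s ≡ 1 → ⟨ φ , Chain.terms (bdS O s) ⟩ ≡ + 0
  length-1 φ (x ∷ []) _ = refl

  bdS-sorted : ∀ s → Sorted O s → Supp (Sorted O) (Chain.terms (bdS O s))
  bdS-sorted [] _ = []
  bdS-sorted (x ∷ []) _ = []
  bdS-sorted (x ∷ y ∷ l) st = Supp-map (λ _ → proj₁) (facesSigned-sorted (x ∷ y ∷ l) st)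

  isOrientation : IsOrientation K D (chain normal-cycle)
  isOrientation =
    (λ σ k e → subst IsUnit (sym (coeff-normal-cycle σ)) (cycle-unit k e)) ,
    (λ σ n → trans (coeff-normal-cycle σ) (κ-off-top n cycle cycle-Supp)) ,
    λ τ → trans (coeffL-χ (Chain.terms (∂ {O} (chain normal-cycle))) τ) (trans (coeff-∂ (χ τ) normal-cycle) (closed τ D refl))
    where
    -- The dimension is split off because `bdS` is 0 on vertices by convention and agrees with the
    -- augmented `faces` only above.
    closed : ∀ τ d → D ≡ d → ⟨ (λ s → ⟨ χ τ , Chain.terms (bdS O s) ⟩) , normal-cycle ⟩ ≡ + 0
    closed τ zero refl = ⟨⟩-0S normal-cycle normal-cycle-sorted λ s (_ , e) → length-1 (χ τ) s e
    closed τ (suc d) refl = begin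
      ⟨ (λ s → ⟨ χ τ , Chain.terms (bdS O s) ⟩) , normal-cycle ⟩
        ≡⟨ ⟨⟩-congS normal-cycle normal-cycle-sorted (λ s (st , e) → trans
             (⟨⟩-congS (Chain.terms (bdS O s)) (bdS-sorted s st) λ t q → sym (oF-sorted (χ τ) t q))
             (⟨⟩-bdS O (κ τ) s (ℕP.≤-trans (s≤s (s≤s z≤n)) (ℕP.≤-reflexive (sym e))))) ⟩
      ⟨ δ (κ τ) , normal-cycle ⟩ ≡⟨ ⟨⟩-normalize (δ (κ τ)) cycle ⟩
      ⟨ oF (δ (κ τ)) , cycle ⟩ ≡⟨ ⟨⟩-cong cycle (oF-alt (Alt-δ (Alt-κ τ))) ⟩
      ⟨ δ (κ τ) , cycle ⟩ ≡⟨ cycle-closed (Alt-κ τ) ⟩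
      + 0 ∎
      where open ≡-Reasoning

  module _ (ξ : Chain O) (orientation : IsOrientation K D ξ) where

    -- An orientation is given by its coefficients and may carry terms off the top simplices that
    -- cancel. Dropping these gives an equal chain whose terms are all top simplices.
    kept : FC (List A)
    kept = filter (top? ∘ proj₂) (Chain.terms ξ)

    kept-Supp : Supp TopSimplex kept
    kept-Supp = AllP.all-filter (top? ∘ proj₂) (Chain.terms ξ)

    kept-coeff : ∀ s → coeffL O (Chain.terms ξ) s ≡ coeffL O kept s
    kept-coeff s = trans (coeffL-χ (Chain.terms ξ) s) (trans (case (top? s)) (sym (coeffL-χ kept s)))
      where
      case : Dec (TopSimplex s) → ⟨ χ s , Chain.terms ξ ⟩ ≡ ⟨ χ s , kept ⟩
      case (yes q) = ⟨⟩-filter top? (χ s) (λ t n → χ-≢ λ e → n (subst TopSimplex (sym e) q)) (Chain.terms ξ)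
      case (no n) = trans (sym (coeffL-χ (Chain.terms ξ) s)) (trans (proj₁ (proj₂ orientation) s n)
        (sym (⟨⟩-0S kept kept-Supp λ t q → χ-≢ λ e → n (subst TopSimplex e q))))

    ⟨⟩-kept : ∀ φ → ⟨ φ , Chain.terms ξ ⟩ ≡ ⟨ φ , kept ⟩
    ⟨⟩-kept φ = ≈⇒⟨⟩ φ (Chain.terms ξ) kept kept-coeff

    kept-closed : 1 ≤ D → ∀ Φ → ⟨ δ Φ , kept ⟩ ≡ + 0
    kept-closed D≥1 Φ = begin
      ⟨ δ Φ , kept ⟩ ≡⟨ ⟨⟩-congS kept kept-Supp (λ s (_ , e) → sym (⟨⟩-bdS O Φ s
                          (ℕP.≤-trans (s≤s D≥1) (ℕP.≤-reflexive (sym e))))) ⟩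
      ⟨ (λ s → ⟨ Φ , Chain.terms (bdS O s) ⟩) , kept ⟩ ≡⟨ sym (⟨⟩-kept (λ s → ⟨ Φ , Chain.terms (bdS O s) ⟩)) ⟩
      ⟨ (λ s → ⟨ Φ , Chain.terms (bdS O s) ⟩) , Chain.terms ξ ⟩ ≡⟨ sym (coeff-∂ Φ (Chain.terms ξ)) ⟩
      ⟨ Φ , Chain.terms (∂ {O} ξ) ⟩ ≡⟨ ≈⇒⟨⟩ Φ (Chain.terms (∂ {O} ξ)) [] (proj₂ (proj₂ orientation)) ⟩
      + 0 ∎
      where open ≡-Reasoning

    -- In dimension 0 an orientation need not be an augmented cycle, but any two
    -- sign vectors agree modulo 2.
    orientation-mod : ∀ {n} → (D ≡ 0 → Div n (+ 2)) →
                      Σ ℤ λ a → ∀ {Φ} → Alt Φ → Div n (⟨ Φ , kept ⟩ - a * ⟨ Φ , cycle ⟩)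
    orientation-mod {n} even = case D refl
      where
      case : ∀ d → D ≡ d → Σ ℤ λ a → ∀ {Φ} → Alt Φ → Div n (⟨ Φ , kept ⟩ - a * ⟨ Φ , cycle ⟩)
      case (suc d) e with generates kept (Supp-map (λ _ → TopSimplex⇒Simplex) kept-Supp)
        (λ {Φ} _ → kept-closed (ℕP.≤-trans (s≤s z≤n) (ℕP.≤-reflexive (sym e))) Φ)
      ... | a , gen = a , λ {Φ} aΦ → subst (Div n) (sym (ℤP.i≡j⇒i-j≡0 (gen aΦ))) Div-0
      case zero e = + 1 , λ {Φ} aΦ → subst (Div n) (diff-alt aΦ) (coeffs-determine n Φ difference coefficients)
        where
        difference : FC (List A)
        difference = kept ++ scale (- (+ 1)) normal-cycle
        diff : ∀ φ → ⟨ φ , difference ⟩ ≡ ⟨ φ , kept ⟩ - ⟨ oF φ , cycle ⟩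
        diff φ = trans (⟨⟩-++ φ kept _) (+-congˡ ⟨ φ , kept ⟩ (trans (⟨⟩-scale φ (- (+ 1)) normal-cycle)
          (trans (ℤP.-1*i≡-i _) (cong -_ (⟨⟩-normalize φ cycle)))))
        diff-alt : ∀ {Φ} → Alt Φ → ⟨ Φ , difference ⟩ ≡ ⟨ Φ , kept ⟩ - + 1 * ⟨ Φ , cycle ⟩
        diff-alt {Φ} aΦ = trans (diff Φ) (cong (λ u → ⟨ Φ , kept ⟩ - u)
          (trans (⟨⟩-cong cycle (oF-alt aΦ)) (sym (ℤP.*-identityˡ _))))
        units-agree : ∀ {u v} → IsUnit u → IsUnit v → Div n (u - v)
        units-agree (inj₁ refl) (inj₁ refl) = Div-0
        units-agree (inj₁ refl) (inj₂ refl) = even e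
        units-agree (inj₂ refl) (inj₁ refl) = Div-neg (even e)
        units-agree (inj₂ refl) (inj₂ refl) = Div-0
        coefficients : ∀ s → Div n ⟨ χ s , difference ⟩
        coefficients s with top? s
        ... | yes (k , l) = subst (Div n) (sym (diff (χ s))) (units-agree
                (subst IsUnit (trans (kept-coeff s) (coeffL-χ kept s)) (proj₁ orientation s k l)) (cycle-unit k l))
        ... | no q = subst (Div n) (sym (trans (diff (χ s)) (cong₂ _-_
                (⟨⟩-0S kept kept-Supp λ t q' → χ-≢ λ e → q (subst TopSimplex e q')) (κ-off-top q cycle cycle-Supp)))) Div-0

module Degree (O : Ordered) (≺-trans : Transitive (_≺_ O)) (K : Cx O) (M : Matching O (K ∋_)) (D : ℕ)
  (top-length : length (Matching.top M) ≡ suc D)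
  (units : ∀ {x} → K ∋ x → length x ≡ length (Matching.top M) →
    IsUnit ⟨ Sorting.κ O ≺-trans x , Contraction.η O ≺-trans (K ∋_) M ⟩)
  (k : ℕ) (f : Carrier (Lv k O) → Carrier O) (f-simplicial : IsSimplicial {Lv k O} {O} (Bdk k K) K f) where
  private
    A = Carrier O
    Lᵏ = Lv k O
    trᵏ : Transitive (_≺_ Lᵏ)
    trᵏ = Lv-trans k {O} ≺-trans
    F = matching-fundamental O ≺-trans K M top-length units
    open Iterated O ≺-trans
    Fᵏ = fundamentalᵏ K D F k
    module Fᵏ = Fundamental Fᵏ
    module Lᵏ = Sorting Lᵏ trᵏ
  open Sorting O ≺-trans using (κ)
  open Contraction O ≺-trans (K ∋_) M using (η; top-cycle)
  open Matching M using (top)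
  open InducedMap O ≺-trans K M D F k f f-simplicial public
  open Orientations Lᵏ trᵏ (Bdk k K) D Fᵏ
  open IteratedChains O ≺-trans
  private
    module C = Chains O ≺-trans

  degree : ℤ
  degree = ⟨ κ top , ext ψ η ⟩

  pullback : (List (Carrier Lᵏ) → ℤ) → List (Carrier Lᵏ) → ℤ
  pullback Φ s = ⟨ Φ , Gᵏ k (map f s) ⟩

  pullback-Alt : ∀ {Φ} → Alt Φ → Alt (pullback Φ)
  pullback-Alt a = Alt-map f (Gᵏ-AltPres k a)

  -- With `n` for `degree`: `gᵏ f (gᵏ η) = gᵏ (n η) = n gᵏ η`. The first equality holds because
  -- `f gᵏ η` is a top cycle of `K`, hence a multiple of `η`.
  pullback-cycle : ∀ {Φ} → Alt Φ → ⟨ pullback Φ , Fᵏ.cycle ⟩ ≡ degree * ⟨ Φ , Fᵏ.cycle ⟩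
  pullback-cycle {Φ} a = begin
    ⟨ pullback Φ , Fᵏ.cycle ⟩ ≡⟨ sym (⟨⟩-mapFC Φ′ (map f) Fᵏ.cycle) ⟩
    ⟨ Φ′ , image ⟩ ≡⟨ top-cycle image image-Supp image-closed (Gᵏ-AltPres k a) ⟩
    ⟨ κ top , image ⟩ * ⟨ Φ′ , η ⟩ ≡⟨ cong₂ _*_ image-degree (sym (cycleᵏ K D F k Φ)) ⟩
    degree * ⟨ Φ , Fᵏ.cycle ⟩ ∎
    where
    open ≡-Reasoning
    Φ′ : List A → ℤ
    Φ′ l = ⟨ Φ , Gᵏ k l ⟩
    image = mapFC (map f) Fᵏ.cycle
    image-Supp : Supp (λ l → K ∋ setOf O l × length l ≡ length top) image
    image-Supp = Supp-mapFC (map f) Fᵏ.cycle Fᵏ.cycle-Supp λ u (ku , e) →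
      image-K u ku , trans (LP.length-map f u) (trans e (sym top-length))
    image-closed : ∀ {Φ} → Alt Φ → ⟨ δ Φ , image ⟩ ≡ + 0
    image-closed {Φ} a = trans (⟨⟩-mapFC (δ Φ) (map f) Fᵏ.cycle) (trans (⟨⟩-cong Fᵏ.cycle (δ-map f Φ))
      (Fᵏ.cycle-closed (Alt-map f a)))
    image-degree : ⟨ κ top , image ⟩ ≡ degree
    image-degree = trans (⟨⟩-mapFC (κ top) (map f) Fᵏ.cycle) (trans (cycleᵏ K D F k (κ top ∘ map f))
      (trans (⟨⟩-cong η λ l → sym (ψ-eval (κ top) l)) (sym (⟨⟩-ext (κ top) ψ η))))

  transfer : FC (List (Carrier Lᵏ)) → FC (List (Carrier Lᵏ))
  transfer c = Chain.terms (gk O k (mapC {Lᵏ} {O} f (chain c)))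

  module _ (c : FC (List (Carrier Lᵏ))) (c-length : Supp (λ s → length s ≡ suc D) c) where

    image-proper : Supp C.Proper (Chain.terms (mapC {Lᵏ} {O} f (chain c)))
    image-proper = Supp-extC {Lᵏ} {O} (λ s → oriented O (map f s)) (chain c) c-length λ s e →
      Supp-map (λ t (st , e') → st , ℕP.≤-trans (s≤s z≤n) (ℕP.≤-reflexive (sym (trans e' (trans (LP.length-map f s) e)))))
        (C.oriented-sorted (map f s))

    transfer-eval : ∀ {Φ} → Alt Φ → ⟨ Φ , transfer c ⟩ ≡ ⟨ pullback Φ , c ⟩
    transfer-eval {Φ} a = begin
      ⟨ Φ , transfer c ⟩ ≡⟨ gk-Gᵏ k (mapC {Lᵏ} {O} f (chain c)) image-proper a ⟩
      ⟨ (λ t → ⟨ Φ , Gᵏ k t ⟩) , Chain.terms (mapC {Lᵏ} {O} f (chain c)) ⟩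
        ≡⟨ ⟨⟩-extC {Lᵏ} {O} (λ t → ⟨ Φ , Gᵏ k t ⟩) (λ s → oriented O (map f s)) (chain c) ⟩
      ⟨ (λ s → ⟨ (λ t → ⟨ Φ , Gᵏ k t ⟩) , Chain.terms (oriented O (map f s)) ⟩) , c ⟩
        ≡⟨ ⟨⟩-cong c (λ s → C.⟨⟩-oriented (Gᵏ-AltPres k a) (map f s)) ⟩
      ⟨ pullback Φ , c ⟩ ∎
      where open ≡-Reasoning

    transfer-coeff : ∀ s → coeffL Lᵏ (transfer c) s ≡ ⟨ pullback (Lᵏ.κ s) , c ⟩
    transfer-coeff s = trans (Lᵏ.coeffL-κ (transfer c) s
      (Supp-map (λ _ → proj₁) (gk-proper k (mapC {Lᵏ} {O} f (chain c)) image-proper)))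
      (transfer-eval (Lᵏ.Alt-κ s))

  transfer-linear : ∀ φ → Σ (List (Carrier Lᵏ) → ℤ) λ φ' → ∀ c → ⟨ φ , transfer c ⟩ ≡ ⟨ φ' , c ⟩
  transfer-linear φ with gk-linear k φ
  ... | φ' , e = (λ s → ⟨ φ' , Chain.terms (oriented O (map f s)) ⟩) , λ c →
    trans (e (mapC {Lᵏ} {O} f (chain c))) (⟨⟩-extC {Lᵏ} {O} φ' (λ s → oriented O (map f s)) (chain c))

  coeff-scaleC : ∀ n c s → coeff Lᵏ (scaleC {Lᵏ} n (chain c)) s ≡ n * ⟨ Lᵏ.χ s , c ⟩
  coeff-scaleC n c s = trans (Lᵏ.coeffL-χ (Chain.terms (scaleC {Lᵏ} n (chain c))) s)
    (⟨⟩-map-terms (Lᵏ.χ s) (Lᵏ.χ s) n _ (λ b t → ℤP.*-assoc n b (Lᵏ.χ s t)) c)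

  degree-exists : IsDegree {O} k K D f degree
  degree-exists = chain normal-cycle , isOrientation , λ s → begin
    coeffL Lᵏ (transfer normal-cycle) s ≡⟨ transfer-coeff normal-cycle (Supp-map (λ _ → proj₂) normal-cycle-sorted) s ⟩
    ⟨ pullback (Lᵏ.κ s) , normal-cycle ⟩ ≡⟨ ⟨⟩-normalize (pullback (Lᵏ.κ s)) Fᵏ.cycle ⟩
    ⟨ Lᵏ.oF (pullback (Lᵏ.κ s)) , Fᵏ.cycle ⟩ ≡⟨ ⟨⟩-cong Fᵏ.cycle (Lᵏ.oF-alt (pullback-Alt (Lᵏ.Alt-κ s))) ⟩
    ⟨ pullback (Lᵏ.κ s) , Fᵏ.cycle ⟩ ≡⟨ pullback-cycle (Lᵏ.Alt-κ s) ⟩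
    degree * ⟨ Lᵏ.κ s , Fᵏ.cycle ⟩ ≡⟨ cong (degree *_) (sym (⟨⟩-normalize (Lᵏ.χ s) Fᵏ.cycle)) ⟩
    degree * ⟨ Lᵏ.χ s , normal-cycle ⟩ ≡⟨ sym (coeff-scaleC degree normal-cycle s) ⟩
    coeff Lᵏ (scaleC {Lᵏ} degree (chain normal-cycle)) s ∎
    where open ≡-Reasoning

  -- Modulo `n` the orientation is `a` times the cycle, on which the degree is known. Comparing
  -- coefficients at one top simplex `w`, where the orientation has the unit `u`, isolates
  -- `u * u * (d - degree)`.
  degree-unique : ∀ {n} → (D ≡ 0 → Div n (+ 2)) → ∀ d → IsDegree {O} k K D f d → Div n (d - degree)
  degree-unique {n} even d (ξ , orientation , e) = subst (Div n) cancel (Div-* u (Div-+ multiplied (Div-neg (Div-* degree at-w))))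
    where
    open ≡-Reasoning
    w = Fᵏ.facet
    κw = Lᵏ.κ w
    c = kept ξ orientation
    c-length : Supp (λ s → length s ≡ suc D) c
    c-length = Supp-map (λ _ → proj₂) (kept-Supp ξ orientation)
    u = ⟨ κw , c ⟩
    u≡ : u ≡ ⟨ Lᵏ.χ w , c ⟩
    u≡ = ⟨⟩-congS c (kept-Supp ξ orientation) λ t (kt , _) → Lᵏ.oF-sorted (Lᵏ.χ w) t (Fᵏ.K-sorted kt)
    u-unit : IsUnit u
    u-unit = subst IsUnit (trans (kept-coeff ξ orientation w) (trans (Lᵏ.coeffL-χ c w) (sym u≡)))
      (proj₁ orientation w Fᵏ.facet-K Fᵏ.facet-length)
    a = proj₁ (orientation-mod ξ orientation even)
    z = ⟨ κw , Fᵏ.cycle ⟩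
    at-w : Div n (u - a * z)
    at-w = proj₂ (orientation-mod ξ orientation even) (Lᵏ.Alt-κ w)
    transferred : ⟨ pullback κw , c ⟩ ≡ d * u
    transferred = begin
      ⟨ pullback κw , c ⟩ ≡⟨ sym (transfer-coeff c c-length w) ⟩
      coeffL Lᵏ (transfer c) w ≡⟨ Lᵏ.coeffL-χ (transfer c) w ⟩
      ⟨ Lᵏ.χ w , transfer c ⟩ ≡⟨ proj₂ lin c ⟩
      ⟨ proj₁ lin , c ⟩ ≡⟨ sym (⟨⟩-kept ξ orientation (proj₁ lin)) ⟩
      ⟨ proj₁ lin , Chain.terms ξ ⟩ ≡⟨ sym (proj₂ lin (Chain.terms ξ)) ⟩
      ⟨ Lᵏ.χ w , transfer (Chain.terms ξ) ⟩ ≡⟨ sym (Lᵏ.coeffL-χ (transfer (Chain.terms ξ)) w) ⟩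
      coeffL Lᵏ (transfer (Chain.terms ξ)) w ≡⟨ e w ⟩
      coeff Lᵏ (scaleC {Lᵏ} d ξ) w ≡⟨ coeff-scaleC d (Chain.terms ξ) w ⟩
      d * ⟨ Lᵏ.χ w , Chain.terms ξ ⟩ ≡⟨ cong (d *_) (trans (⟨⟩-kept ξ orientation (Lᵏ.χ w)) (sym u≡)) ⟩
      d * u ∎
      where
      lin = transfer-linear (Lᵏ.χ w)
    multiplied : Div n (d * u - a * (degree * z))
    multiplied = subst (Div n) (cong₂ (λ x y → x - a * y) transferred (pullback-cycle (Lᵏ.Alt-κ w)))
      (proj₂ (orientation-mod ξ orientation even) (pullback-Alt (Lᵏ.Alt-κ w)))
    cancel : u * (d * u - a * (degree * z) + - (degree * (u - a * z))) ≡ d - degree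
    cancel = trans (lem u d a degree z) (trans (cong (_* (d - degree)) (unit-square u-unit)) (ℤP.*-identityˡ _))
      where
      lem : ∀ u d a m z → u * (d * u - a * (m * z) + - (m * (u - a * z))) ≡ u * u * (d - m)
      lem = solve-∀

-- The diagonal action on the join

module JoinAction (O : Ordered) (≺-trans : Transitive (_≺_ O)) {m : ℕ} (S : Fin m → Cx O) (ds : Fin m → ℕ)
  (p : ℕ) (h : Carrier O → Carrier O) (spheres : ∀ i → IsZpCombSphere p h (S i) (ds i)) (disjoint : PairwiseDisjoint S) where
  open Sorting O ≺-trans

  S-sorted : ∀ i {σ} → S i ∋ σ → Sorted O σ
  S-sorted i {σ} = IsComplex.sorted (proj₁ (proj₁ (spheres i))) σ

  same-index : ∀ {i j σ τ v} → S i ∋ σ → S j ∋ τ → v ∈ σ → v ∈ τ → i ≡ j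
  same-index {i} {j} {σ} {τ} {v} kσ kτ vσ vτ with i FP.≟ j
  ... | yes e = e
  ... | no n = ⊥-elim (disjoint i j n v (σ , kσ , vσ) (τ , kτ , vτ))

  image : (Carrier O → Carrier O) → List (Carrier O) → List (Carrier O)
  image g σ = setOf O (map g σ)

  ∈-image⁺ : ∀ g {σ v} → v ∈ σ → g v ∈ image g σ
  ∈-image⁺ g {σ} m = ∈-setOf⁺ (map g σ) (∈-map⁺ g m)

  ∈-image⁻ : ∀ g {σ v} → v ∈ image g σ → Σ _ λ w → w ∈ σ × v ≡ g w
  ∈-image⁻ g {σ} m = ∈-map⁻ g (∈-setOf⁻ (map g σ) m)

  iter-simplicial : ∀ i n {σ} → S i ∋ σ → S i ∋ image (iter h n) σ
  iter-simplicial i zero {σ} k = subst (S i ∋_) (sym (trans (cong (setOf O) (LP.map-id σ)) (setOf-id (S-sorted i k)))) k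
  iter-simplicial i (suc n) {σ} k = subst (S i ∋_)
    (trans (map-setOf O O ≺-trans h (map (iter h n) σ)) (cong (setOf O) (sym (LP.map-∘ σ))))
    (proj₁ (proj₂ (proj₂ (spheres i))) _ (iter-simplicial i n k))

  join-simplicial : ∀ {x} → Join S ∋ x → Join S ∋ image h x
  join-simplicial {x} (s , τ , k , cov) = setOf-sorted (map h x) , image h ∘ τ , (λ i → proj₁ (proj₂ (proj₂ (spheres i))) (τ i) (k i)) , λ v →
    (λ m → let w , w∈ , e = ∈-image⁻ h m ; i , wi = proj₁ (cov w) w∈ in i , subst (_∈ image h (τ i)) (sym e) (∈-image⁺ h wi)) ,
    λ i m → let w , w∈ , e = ∈-image⁻ h m in subst (_∈ image h x) (sym e) (∈-image⁺ h (proj₂ (cov w) i w∈))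

  -- A power of `h` fixing `x` fixes each part of `x`, because it preserves the factors and these
  -- are disjoint; the part containing `v` is nonempty, against freeness in its factor.
  join-free : ∀ g → 1 ≤ g → g < p → ∀ {x} → Join S ∋ x → x ≢ [] → image (iter h g) x ≢ x
  join-free g g≥1 g<p {[]} _ ne _ = ne refl
  join-free g g≥1 g<p {v ∷ x'} (s , τ , k , cov) _ e =
    let i , vi = proj₁ (cov v) (here refl) in
    proj₂ (proj₂ (proj₂ (spheres i))) g g≥1 g<p (τ i) (k i) (∈⇒≢[] vi) (fixed i)
    where
    x = v ∷ x'
    hᵍ = iter h g
    fixed : ∀ i → image hᵍ (τ i) ≡ τ i
    fixed i = setOf-ext (S-sorted i (k i)) to from
      where
      to : ∀ {z} → z ∈ map hᵍ (τ i) → z ∈ τ i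
      to {z} m with ∈-map⁻ hᵍ m
      ... | w , wi , refl with proj₁ (cov z) (subst (z ∈_) e (∈-image⁺ hᵍ (proj₂ (cov w) i wi)))
      ...   | j , zj = subst (λ j → z ∈ τ j) (sym (same-index (iter-simplicial i g (k i)) (k j) (∈-image⁺ hᵍ wi) zj)) zj
      from : ∀ {z} → z ∈ τ i → z ∈ map hᵍ (τ i)
      from {z} zi with ∈-image⁻ hᵍ (subst (z ∈_) (sym e) (proj₂ (cov z) i zi))
      ... | w , wx , refl with proj₁ (cov w) wx
      ...   | j , wj with same-index (iter-simplicial j g (k j)) (k i) (∈-image⁺ hᵍ wj) zi
      ...     | refl = ∈-map⁺ hᵍ wj

Div⇒≡mod : ∀ {p a b} → Div (+ p) (a - b) → a ≡ b [modℤ p ]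
Div⇒≡mod {p} (div q e) = ℕD.divides ∣ q ∣ (trans (cong ∣_∣ e) (trans (ℤP.abs-* (+ p) q) (ℕP.*-comm p ∣ q ∣)))

suc-joinDim : ∀ {m} → 1 ≤ m → (ds : Fin m → ℕ) → sum (tabulate (suc ∘ ds)) ≡ suc (joinDim ds)
suc-joinDim {suc m} _ ds = cong (λ l → suc (ds F.zero ℕ.+ sum l)) (sym (LP.map-tabulate F.suc (suc ∘ ds)))

theorem1p9 :
    (V : Set) (_<<_ : Rel V 0ℓ) (sto : IsStrictTotalOrder _≡_ _<<_) →
    let O = fromSTO V _<<_ sto in
    (p : ℕ) → Prime p → (k m : ℕ) → 1 ≤ m →
    (S : Fin m → Cx O) (ds : Fin m → ℕ) (h : V → V) →
    (∀ i → IsZpCombSphere p h (S i) (ds i)) →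
    PairwiseDisjoint S →
    (f : Carrier (Lv k O) → V) →
    IsSimplicial (Bdk k (Join S)) (Join S) f →
    (∀ g → g < p → ∀ w → VertexOf (Bdk k (Join S)) w →
      f (actk h k g w) ≡ iter h g (f w)) →
    Σ ℤ (IsDegree k (Join S) (joinDim ds) f) ×
    (∀ d → IsDegree k (Join S) (joinDim ds) f d → d ≡ + 1 [modℤ p ])
theorem1p9 V _<<_ sto p p-prime k m m≥1 S ds h spheres disjoint f f-simplicial equi =
  go p (nonTrivial⇒n>1 p {{prime⇒nonTrivial p-prime}}) spheres equi
  where
  O = fromSTO V _<<_ sto
  ≺-trans : Transitive (_≺_ O)
  ≺-trans = IsStrictTotalOrder.trans sto
  go : ∀ p → 1 < p → (∀ i → IsZpCombSphere {O} p h (S i) (ds i)) →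
       (∀ g → g < p → ∀ w → VertexOf (Bdk k (Join S)) w → f (actk {O} h k g w) ≡ iter h g (f w)) →
       Σ ℤ (IsDegree {O} k (Join S) (joinDim ds) f) ×
       (∀ d → IsDegree {O} k (Join S) (joinDim ds) f d → d ≡ + 1 [modℤ p ])
  go (suc p') 1<p spheres equi = (Dg.degree , Dg.degree-exists) , λ d isD →
      Div⇒≡mod {suc p'} {d} {+ 1} (subst (Div (+ suc p')) (lem d Dg.degree) (Div-+ (Dg.degree-unique even d isD) congruence))
    where
    lem : ∀ d m → d - m + (m - + 1) ≡ d - + 1
    lem = solve-∀
    matchings : ∀ i → Σ (Matching O (S i ∋_)) λ M → length (Matching.top M) ≡ suc (ds i)
    matchings i = sphere-matching O ≺-trans (S i) (ds i) (proj₁ (spheres i))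
    Ms : ∀ i → Matching O (S i ∋_)
    Ms i = proj₁ (matchings i)
    module JM = JoinMatching O ≺-trans S Ms disjoint
    module JU = JoinUnits O ≺-trans S Ms disjoint ds (λ i → proj₂ (matchings i)) (λ i → proj₁ (proj₂ (proj₁ (spheres i))))
    module JA = JoinAction O ≺-trans S ds (suc p') h spheres disjoint
    top-length : length JM.top ≡ suc (joinDim ds)
    top-length = trans (JM.length-J JM.tops JM.tops-K)
      (trans (cong sum (LP.tabulate-cong λ i → proj₂ (matchings i))) (suc-joinDim m≥1 ds))
    module Dg = Degree O ≺-trans (Join S) JM.join-matching (joinDim ds) top-length JU.η-unit k f f-simplicial
    -- A condition on `h` alone, so any one factor supplies it.
    period : ∀ v → iter h (suc p') v ≡ v
    period = proj₁ (proj₂ (spheres (F.fromℕ< m≥1)))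
    module FA = FreeAction O ≺-trans (Join S ∋_) JM.join-matching h p' period JA.join-simplicial JA.join-free
    top≢[] : JM.top ≢ []
    top≢[] e = ℕP.0≢1+n (trans (cong length (sym e)) top-length)
    -- Since `1 < p`, the exponent 1 is among those of `equi` and gives equivariance under the
    -- generator.
    congruence : Div (+ suc p') (Dg.degree - + 1)
    congruence = FA.degree≡1 Dg.ψ Dg.ψ-SelfMap (Dg.ψ-equivariant h (equi 1 1<p)) top≢[]
    -- In dimension 0 the top simplex has one vertex and sign -1, so the parity congruence is about
    -- `1 - (-1) = 2`.
    even : joinDim ds ≡ 0 → Div (+ suc p') (+ 2)
    even e = subst (λ n → Div (+ suc p') (+ 1 - sgn O n)) (trans top-length (cong suc e)) (FA.sphere-parity top≢[])
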